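{- Let $L$ be a nonnegative integer. For nonnegative integers $n_1,n_2,n_3$ put $N_1=n_1+n_2+n_3$, $N_2=n_2+n_3$, $N_3=n_3$. Then \[ C_L(q)=\sum_{\substack{n_1,n_2,n_3\ge 0\\ N_1+N_2+N_3\le L-1}}\frac{q^{N_1^2+N_2^2+N_3^2+N_1+N_2+N_3}(q;q)_{L-N_1-1}(q;q)_{2L-N_1-N_2-1}}{(q;q)_{2L-2N_1-1}(q;q)_{L-N_1-N_2-N_3-1}(q;q)_{n_1}(q;q)_{n_2}(q;q)_{n_3}}. \]
   Context: $(a;q)_n=\prod_{i=0}^{n-1}(1-aq^i)$. The Borwein polynomials $A_n,B_n,C_n$ are the unique polynomials in $q$ such that $A_n(q^3)-qB_n(q^3)-q^2C_n(q^3)=(q;q^3)_n(q^2;q^3)_n$; i.e. $-q^2C_n(q^3)$ collects the terms of $(q;q^3)_n(q^2;q^3)_n$ whose exponent is congruent to $2$ modulo $3$. -}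

module Defs where

open import Data.Nat as ℕ using (ℕ; zero; suc; _∸_; _≡ᵇ_; _<ᵇ_)
open import Data.Nat.DivMod using (_%_)
open import Data.Integer using (ℤ; 0ℤ; 1ℤ; _+_; _*_; -_; _-_)
open import Data.Bool using (if_then_else_)

-- Formal power series in q with integer coefficients: n ↦ coefficient of q^n.
PS : Set
PS = ℕ → ℤ

sumTo : ℕ → (ℕ → ℤ) → ℤ
sumTo zero    f = 0ℤ
sumTo (suc n) f = sumTo n f + f n

sumPS : ℕ → (ℕ → PS) → PS
sumPS n F k = sumTo n (λ i → F i k)

infixl 7 _⊛_
_⊛_ : PS → PS → PS
(f ⊛ g) n = sumTo (suc n) (λ i → f i * g (n ∸ i))

mono : ℕ → PS
mono a n = if a ≡ᵇ n then 1ℤ else 0ℤ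

oneP : PS
oneP = mono 0

oneMinus : ℕ → PS
oneMinus a n = mono 0 n - mono a n

qpoch : ℕ → ℕ → ℕ → PS
qpoch a d zero    = oneP
qpoch a d (suc n) = qpoch a d n ⊛ oneMinus (a ℕ.+ d ℕ.* n)

qq : ℕ → PS
qq n = qpoch 1 1 n

-- 1/(1 - q^{j+1}) = Σ_k q^{(j+1)k} as a formal power series
geo : ℕ → PS
geo j m = if (m % suc j) ≡ᵇ 0 then 1ℤ else 0ℤ

invqq : ℕ → PS
invqq zero    = oneP
invqq (suc n) = invqq n ⊛ geo n

borweinProd : ℕ → PS
borweinProd L = qpoch 1 3 L ⊛ qpoch 2 3 L

-- Borwein polynomial C_L: -q^2 C_L(q^3) collects the terms of exponent ≡ 2 (mod 3),
-- so [q^k] C_L = - [q^{3k+2}] (q;q^3)_L (q^2;q^3)_L.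
borweinC : ℕ → PS
borweinC L k = - borweinProd L (2 ℕ.+ 3 ℕ.* k)

-- summand for given n1 n2 n3 (only used when N1+N2+N3 ≤ L-1)
summand : ℕ → ℕ → ℕ → ℕ → PS
summand L n1 n2 n3 =
  mono (N1 ℕ.* N1 ℕ.+ N2 ℕ.* N2 ℕ.+ N3 ℕ.* N3 ℕ.+ N1 ℕ.+ N2 ℕ.+ N3)
  ⊛ qq (L ∸ N1 ∸ 1)
  ⊛ qq (2 ℕ.* L ∸ N1 ∸ N2 ∸ 1)
  ⊛ invqq (2 ℕ.* L ∸ 2 ℕ.* N1 ∸ 1)
  ⊛ invqq (L ∸ N1 ∸ N2 ∸ N3 ∸ 1)
  ⊛ invqq n1 ⊛ invqq n2 ⊛ invqq n3
  where
    N1 = n1 ℕ.+ n2 ℕ.+ n3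
    N2 = n2 ℕ.+ n3
    N3 = n3

-- right-hand side: sum over n1,n2,n3 ≥ 0 with N1+N2+N3 ≤ L-1, i.e. N1+N2+N3 < L
-- (each n_i ≤ N1+N2+N3 < L, so the ranges n_i < L cover all terms)
rhs : ℕ → PS
rhs L = sumPS L λ n1 → sumPS L λ n2 → sumPS L λ n3 →
  λ k → if ((n1 ℕ.+ n2 ℕ.+ n3) ℕ.+ (n2 ℕ.+ n3) ℕ.+ n3) <ᵇ L
        then summand L n1 n2 n3 k else 0ℤ

{-# OPTIONS --safe #-}

-- Write [n;k] for the Gaussian binomial.  Expanding both products by the q-binomial theorem and collecting the
-- diagonals gives (q;q³)_L (q²;q³)_L = Σ_d (−1)^d q^{d(3d−1)/2} [2L; L+d]_{q³}, and hence
--   C_L(q) = Σ_j (−1)^j q^{j(9j+7)/2} [2L; L+3j+1],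
-- in which the terms j and −1−j are paired.  Since 3j + 3/2 = 3 (j + 1/2), three summation steps, each producing
-- a factor q^{N²+N−j²−j}, turn the binomials into 1/((q)_{N₃−j} (q)_{N₃+j+1}): a q-Vandermonde sum over N₁, a Burge
-- transform over N₂, and a Bailey step over N₃.  What is left of the j-sum is
--   Σ_{j≥0} (−1)^j q^{j(3j+1)/2} (1 − q^{2j+1}) / ((q)_{n−j} (q)_{n+1+j}) = 1/(q)_n,
-- one more Bailey step away from a telescoping sum.
module Submission where

open import Defs
open import Algebra.Bundles using (CommutativeRing)
import Algebra.Properties.Semiring.Exp as Exp
open import Algebra.Solver.Ring.AlmostCommutativeRing using (_-Raw-AlmostCommutative⟶_; fromCommutativeRing)
import Data.Integer as ℤ
import Data.Integer.Properties as ℤ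
import Data.Integer.Tactic.RingSolver as ℤSolver
import Data.Maybe as Maybe
open import Data.Nat using (ℕ; zero; suc; _∸_; _≤_; _<_; s≤s; z≤n; _≡ᵇ_; _<ᵇ_)
import Data.Nat as ℕ
open import Data.Nat.DivMod using (_%_; m<n⇒m%n≡m; [m+n]%n≡m%n)
import Data.Nat.Properties as ℕ
import Data.Nat.Tactic.RingSolver as ℕSolver
open import Data.Product using (∃; _,_)
open import Data.Sum using (_⊎_; inj₁; inj₂)
open import Level using (0ℓ)
open import Relation.Binary.PropositionalEquality using (_≡_)
import Relation.Binary.PropositionalEquality as ≡
open import Relation.Nullary.Decidable using (dec⇒maybe)

-- Finite sums in a commutative ring

-- In the first Vandermonde sum 2L is split as (L + j) + (L - j): of the offset 3j + 1 = j + (2j +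
-- 1) the part j enters the tops, and 2j + 1 becomes the distance between the bottoms N - j and N +
-- j + 1. The Burge transform then frees the tops from j, and the last step removes them. The
-- obstacle is one of parity. The bottoms are exchanged by j ↦ -1 - j, but tops with that symmetry
-- would have an odd sum, and 2L is even. So the Burge step ends with the unequal tops P and P + 1,
-- and neither product of binomials fits the Bailey sum alone. The difference of the terms j and -1
-- - j does, at the price of the factor 1 - q^(2j+1); hence the pairs are kept together from the
-- start. All sums have bounds that do not depend on j, so that they can be interchanged.
-- Restrictions such as j ≤ N are encoded in the summand by reading 1/(q)_n and [m; n] as 0 at
-- negative n.

module Sums (R : CommutativeRing 0ℓ 0ℓ) where
  open CommutativeRing R
  open import Relation.Binary.Reasoning.Setoid setoid
  open import Algebra.Properties.CommutativeSemigroup +-commutativeSemigroup using (interchange)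

  ∑ : ℕ → (ℕ → Carrier) → Carrier
  ∑ zero    f = 0#
  ∑ (suc n) f = ∑ n f + f n

  infix 5 ∑
  syntax ∑ n (λ i → t) = ∑[ i < n ] t

  ∑-cong< : ∀ n {f g} → (∀ i → i < n → f i ≈ g i) → ∑ n f ≈ ∑ n g
  ∑-cong< zero    f≈g = refl
  ∑-cong< (suc n) f≈g =
    +-cong (∑-cong< n λ i i<n → f≈g i (ℕ.m<n⇒m<1+n i<n)) (f≈g n ℕ.≤-refl)

  ∑-cong : ∀ n {f g} → (∀ i → f i ≈ g i) → ∑ n f ≈ ∑ n g
  ∑-cong n f≈g = ∑-cong< n λ i _ → f≈g i

  ∑-+ : ∀ n f g → ∑[ i < n ] (f i + g i) ≈ ∑ n f + ∑ n g
  ∑-+ zero    f g = sym (+-identityˡ 0#)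
  ∑-+ (suc n) f g = trans (+-congʳ (∑-+ n f g)) (interchange _ _ _ _)

  *-∑ : ∀ c n f → c * ∑ n f ≈ ∑[ i < n ] (c * f i)
  *-∑ c zero    f = zeroʳ c
  *-∑ c (suc n) f = trans (distribˡ c _ _) (+-congʳ (*-∑ c n f))

  ∑-* : ∀ c n f → ∑ n f * c ≈ ∑[ i < n ] (f i * c)
  ∑-* c n f = trans (*-comm _ c) (trans (*-∑ c n f) (∑-cong n λ i → *-comm c (f i)))

  ∑-zero : ∀ n {f} → (∀ i → i < n → f i ≈ 0#) → ∑ n f ≈ 0#
  ∑-zero zero    f≈0 = refl
  ∑-zero (suc n) f≈0 =
    trans (+-cong (∑-zero n λ i i<n → f≈0 i (ℕ.m<n⇒m<1+n i<n)) (f≈0 n ℕ.≤-refl)) (+-identityˡ 0#)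

  ∑-swap : ∀ m n (f : ℕ → ℕ → Carrier) →
           ∑[ i < m ] ∑[ j < n ] f i j ≈ ∑[ j < n ] ∑[ i < m ] f i j
  ∑-swap zero    n f = sym (∑-zero n λ _ _ → refl)
  ∑-swap (suc m) n f = trans (+-congʳ (∑-swap m n f)) (sym (∑-+ n _ (f m)))

  ∑-split : ∀ m n f → ∑ (m ℕ.+ n) f ≈ ∑ m f + (∑[ i < n ] f (m ℕ.+ i))
  ∑-split m zero    f rewrite ℕ.+-identityʳ m = sym (+-identityʳ _)
  ∑-split m (suc n) f rewrite ℕ.+-suc m n = trans (+-congʳ (∑-split m n f)) (+-assoc _ _ _)

  ∑-head : ∀ n f → ∑ (suc n) f ≈ f 0 + (∑[ i < n ] f (suc i))
  ∑-head n f = trans (∑-split 1 n f) (+-congʳ (+-identityˡ (f 0)))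

  ∑-truncate : ∀ {m n f} → m ≤ n → (∀ i → m ≤ i → f i ≈ 0#) → ∑ n f ≈ ∑ m f
  ∑-truncate {m} {n} {f} m≤n f≈0 = begin
    ∑ n f                                    ≡⟨ ≡.cong (λ k → ∑ k f) (ℕ.m+[n∸m]≡n m≤n) ⟨
    ∑ (m ℕ.+ (n ∸ m)) f                      ≈⟨ ∑-split m (n ∸ m) f ⟩
    ∑ m f + (∑[ i < n ∸ m ] f (m ℕ.+ i))     ≈⟨ +-congˡ (∑-zero (n ∸ m) λ i _ → f≈0 (m ℕ.+ i) (ℕ.m≤m+n m i)) ⟩
    ∑ m f + 0#                               ≈⟨ +-identityʳ _ ⟩
    ∑ m f                                    ∎

  ∑-bounds : ∀ m n {f} → (∀ i → m ≤ i → f i ≈ 0#) → (∀ i → n ≤ i → f i ≈ 0#) → ∑ m f ≈ ∑ n f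
  ∑-bounds m n f≈0 f≈0′ with ℕ.≤-total m n
  ... | inj₁ m≤n = sym (∑-truncate m≤n f≈0)
  ... | inj₂ n≤m = ∑-truncate n≤m f≈0′

  -- Shifted sequences and changes of summation variable

  -- delay j f N is f (N − j), read as 0 when N < j.
  delay : ℕ → (ℕ → Carrier) → ℕ → Carrier
  delay zero    f N       = f N
  delay (suc j) f zero    = 0#
  delay (suc j) f (suc N) = delay j f N

  delay-+ : ∀ j f x → delay j f (j ℕ.+ x) ≡ f x
  delay-+ zero    f x = ≡.refl
  delay-+ (suc j) f x = delay-+ j f x

  delay-< : ∀ {j N} f → N < j → delay j f N ≡ 0#
  delay-< {suc j} {zero}  f _         = ≡.refl
  delay-< {suc j} {suc N} f (s≤s N<j) = delay-< f N<j

  delay-+-cancel : ∀ m j f N → delay (m ℕ.+ j) f (m ℕ.+ N) ≡ delay j f N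
  delay-+-cancel zero    j f N = ≡.refl
  delay-+-cancel (suc m) j f N = delay-+-cancel m j f N

  offset : ∀ j N → (∃ λ x → N ≡ j ℕ.+ x) ⊎ N < j
  offset j N with ℕ.≤-<-connex j N
  ... | inj₁ j≤N = inj₁ (N ∸ j , ≡.sym (ℕ.m+[n∸m]≡n j≤N))
  ... | inj₂ N<j = inj₂ N<j

  -- The substitution N = j + x. The bounds n and m are unrelated: each sum may stop anywhere once
  -- its terms have become zero, so that one bound, eventually L, can serve all variables.
  ∑-delay : ∀ j n m (f h : ℕ → Carrier) →
            (∀ N → n ≤ N → delay j f N * h N ≈ 0#) →
            (∀ x → m ≤ x → f x * h (j ℕ.+ x) ≈ 0#) →
            ∑[ N < n ] (delay j f N * h N) ≈ ∑[ x < m ] (f x * h (j ℕ.+ x))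
  ∑-delay j n m f h vanishₙ vanishₘ = begin
    ∑ n F                                       ≈⟨ ∑-bounds n (j ℕ.+ m) vanishₙ vanish ⟩
    ∑ (j ℕ.+ m) F                               ≈⟨ ∑-split j m F ⟩
    ∑ j F + (∑[ x < m ] F (j ℕ.+ x))            ≈⟨ +-cong initial (∑-cong m λ x → *-congʳ (reflexive (delay-+ j f x))) ⟩
    0# + (∑[ x < m ] (f x * h (j ℕ.+ x)))       ≈⟨ +-identityˡ _ ⟩
    ∑[ x < m ] (f x * h (j ℕ.+ x))              ∎
    where
    F : ℕ → Carrier
    F N = delay j f N * h N
    initial : ∑ j F ≈ 0#
    initial = ∑-zero j λ N N<j → trans (*-congʳ (reflexive (delay-< f N<j))) (zeroˡ _)
    vanish : ∀ N → j ℕ.+ m ≤ N → F N ≈ 0#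
    vanish N j+m≤N with offset j N
    ... | inj₁ (x , ≡.refl) =
      trans (*-congʳ (reflexive (delay-+ j f x))) (vanishₘ x (ℕ.+-cancelˡ-≤ j m x j+m≤N))
    ... | inj₂ N<j = trans (*-congʳ (reflexive (delay-< f N<j))) (zeroˡ _)

  ∑-triangle : ∀ n (f : ℕ → ℕ → Carrier) →
               ∑[ b < n ] ∑[ a < b ] f a b ≈ ∑[ a < n ] ∑[ d < n ∸ suc a ] f a (a ℕ.+ suc d)
  ∑-triangle zero    f = refl
  ∑-triangle (suc n) f = begin
    (∑[ b < n ] ∑[ a < b ] f a b) + (∑[ a < n ] f a n)
      ≈⟨ +-congʳ (∑-triangle n f) ⟩
    (∑[ a < n ] ∑[ d < n ∸ suc a ] f a (a ℕ.+ suc d)) + (∑[ a < n ] f a n)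
      ≈⟨ ∑-+ n _ _ ⟨
    ∑[ a < n ] ((∑[ d < n ∸ suc a ] f a (a ℕ.+ suc d)) + f a n)
      ≈⟨ ∑-cong< n extend ⟩
    ∑[ a < n ] ∑[ d < n ∸ a ] f a (a ℕ.+ suc d)
      ≈⟨ +-identityʳ _ ⟨
    (∑[ a < n ] ∑[ d < n ∸ a ] f a (a ℕ.+ suc d)) + 0#
      ≈⟨ +-congˡ (reflexive (≡.cong (λ k → ∑ k (λ d → f n (n ℕ.+ suc d))) (ℕ.n∸n≡0 n))) ⟨
    ∑[ a < suc n ] ∑[ d < n ∸ a ] f a (a ℕ.+ suc d) ∎
    where
    extend : ∀ a → a < n → (∑[ d < n ∸ suc a ] f a (a ℕ.+ suc d)) + f a n ≈ ∑[ d < n ∸ a ] f a (a ℕ.+ suc d)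
    extend a a<n = begin
      (∑[ d < n ∸ suc a ] f a (a ℕ.+ suc d)) + f a n
        ≡⟨ ≡.cong (λ k → (∑[ d < n ∸ suc a ] f a (a ℕ.+ suc d)) + f a k)
             (≡.trans (ℕ.+-suc a (n ∸ suc a)) (ℕ.m+[n∸m]≡n a<n)) ⟨
      ∑[ d < suc (n ∸ suc a) ] f a (a ℕ.+ suc d)
        ≡⟨ ≡.cong (λ k → ∑[ d < k ] f a (a ℕ.+ suc d)) (ℕ.+-∸-assoc 1 a<n) ⟨
      ∑[ d < n ∸ a ] f a (a ℕ.+ suc d) ∎

  -- The square is cut into the diagonals a - b = d and b - a = d + 1. Since f vanishes outside the
  -- square, every diagonal may be summed over the full range, which lets d become the outer
  -- variable.
  ∑-diagonals : ∀ n (f : ℕ → ℕ → Carrier) →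
                (∀ a b → n ≤ a → f a b ≈ 0#) → (∀ a b → n ≤ b → f a b ≈ 0#) →
                ∑[ a < n ] ∑[ b < n ] f a b
                ≈ (∑[ d < n ] ∑[ b < n ] f (b ℕ.+ d) b) + (∑[ d < n ] ∑[ a < n ] f a (a ℕ.+ suc d))
  ∑-diagonals n f vanish₁ vanish₂ = begin
    ∑[ a < n ] ∑[ b < n ] f a b
      ≈⟨ ∑-swap n n f ⟩
    ∑[ b < n ] ∑[ a < n ] f a b
      ≈⟨ ∑-cong n split ⟩
    ∑[ b < n ] ((∑[ a < b ] f a b) + (∑[ d < n ] f (b ℕ.+ d) b))
      ≈⟨ trans (∑-+ n _ _) (+-comm _ _) ⟩
    (∑[ b < n ] ∑[ d < n ] f (b ℕ.+ d) b) + (∑[ b < n ] ∑[ a < b ] f a b)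
      ≈⟨ +-cong (∑-swap n n λ b d → f (b ℕ.+ d) b) (trans (∑-triangle n f) (∑-cong n extend)) ⟩
    (∑[ d < n ] ∑[ b < n ] f (b ℕ.+ d) b) + (∑[ a < n ] ∑[ d < n ] f a (a ℕ.+ suc d))
      ≈⟨ +-congˡ (∑-swap n n λ a d → f a (a ℕ.+ suc d)) ⟩
    (∑[ d < n ] ∑[ b < n ] f (b ℕ.+ d) b) + (∑[ d < n ] ∑[ a < n ] f a (a ℕ.+ suc d)) ∎
    where
    split : ∀ b → ∑[ a < n ] f a b ≈ (∑[ a < b ] f a b) + (∑[ d < n ] f (b ℕ.+ d) b)
    split b = trans (sym (∑-truncate (ℕ.m≤n+m n b) λ a → vanish₁ a b)) (∑-split b n λ a → f a b)
    extend : ∀ a → ∑[ d < n ∸ suc a ] f a (a ℕ.+ suc d) ≈ ∑[ d < n ] f a (a ℕ.+ suc d)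
    extend a = sym (∑-truncate (ℕ.m∸n≤m n (suc a)) λ d n∸[1+a]≤d → vanish₂ a (a ℕ.+ suc d)
      (ℕ.≤-trans (ℕ.≤-trans (ℕ.m≤n+m∸n n (suc a)) (ℕ.+-monoʳ-≤ (suc a) n∸[1+a]≤d)) (ℕ.≤-reflexive (≡.sym (ℕ.+-suc a d)))))

-- Gaussian binomials

-- fromℤ supplies the ring solver with coefficients whose equality is decidable.
module QBinomial (R : CommutativeRing 0ℓ 0ℓ)
                 (fromℤ : ℤ.+-*-rawRing -Raw-AlmostCommutative⟶ fromCommutativeRing R)
                 (q : CommutativeRing.Carrier R) where
  open CommutativeRing R
  open import Relation.Binary.Reasoning.Setoid setoid
  open Exp semiring using (_^_; ^-homo-*)
  open _-Raw-AlmostCommutative⟶_ fromℤ using (⟦_⟧)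

  ⟦⟧-cong? : ∀ c d → Maybe.Maybe (⟦ c ⟧ ≈ ⟦ d ⟧)
  ⟦⟧-cong? c d = Maybe.map (λ c≡d → reflexive (≡.cong ⟦_⟧ c≡d)) (dec⇒maybe (c ℤ.≟ d))

  open import Algebra.Solver.Ring ℤ.+-*-rawRing (fromCommutativeRing R) fromℤ ⟦⟧-cong? public
    using (solve; _:=_; _:+_; _:*_; _:-_; :-_; con; _:^_; Polynomial)
  open Sums R

  𝟙 : ∀ {n} → Polynomial n
  𝟙 = con ℤ.1ℤ :^ 0

  q^-+ : ∀ {e} a b → e ≡ a ℕ.+ b → q ^ e ≈ q ^ a * q ^ b
  q^-+ a b ≡.refl = ^-homo-* q a b

  gauss : ℕ → ℕ → Carrier
  gauss n       zero    = 1#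
  gauss zero    (suc k) = 0#
  gauss (suc n) (suc k) = gauss n k + q ^ suc k * gauss n (suc k)

  gauss-> : ∀ {n k} → n < k → gauss n k ≈ 0#
  gauss-> {zero}  {suc k} _         = refl
  gauss-> {suc n} {suc k} (s≤s n<k) = begin
    gauss n k + q ^ suc k * gauss n (suc k)  ≈⟨ +-cong (gauss-> n<k) (*-congˡ (gauss-> (ℕ.m<n⇒m<1+n n<k))) ⟩
    0# + q ^ suc k * 0#                      ≈⟨ +-identityˡ _ ⟩
    q ^ suc k * 0#                           ≈⟨ zeroʳ _ ⟩
    0#                                       ∎

  gauss-self : ∀ n → gauss n n ≈ 1#
  gauss-self zero    = refl
  gauss-self (suc n) = begin
    gauss n n + q ^ suc n * gauss n (suc n)  ≈⟨ +-cong (gauss-self n) (*-congˡ (gauss-> (ℕ.n<1+n n))) ⟩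
    1# + q ^ suc n * 0#                      ≈⟨ +-congˡ (zeroʳ _) ⟩
    1# + 0#                                  ≈⟨ +-identityʳ 1# ⟩
    1#                                       ∎

  -- Truncated subtraction gives a wrong exponent only for n < k, and there the binomial is zero
  -- because n < k ≤ l.
  q^-∸-gauss : ∀ n {k l} → k ≤ l → q ^ k * (q ^ (n ∸ k) * gauss n l) ≈ q ^ n * gauss n l
  q^-∸-gauss n {k} {l} k≤l with ℕ.≤-<-connex k n
  ... | inj₁ k≤n = trans (sym (*-assoc _ _ _)) (*-congʳ (sym (q^-+ k (n ∸ k) (≡.sym (ℕ.m+[n∸m]≡n k≤n)))))
  ... | inj₂ n<k = begin
    q ^ k * (q ^ (n ∸ k) * gauss n l)  ≈⟨ *-congˡ (*-congˡ gauss≈0) ⟩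
    q ^ k * (q ^ (n ∸ k) * 0#)         ≈⟨ *-congˡ (zeroʳ _) ⟩
    q ^ k * 0#                         ≈⟨ zeroʳ _ ⟩
    0#                                 ≈⟨ zeroʳ _ ⟨
    q ^ n * 0#                         ≈⟨ *-congˡ gauss≈0 ⟨
    q ^ n * gauss n l                  ∎
    where
    gauss≈0 : gauss n l ≈ 0#
    gauss≈0 = gauss-> (ℕ.<-≤-trans n<k k≤l)

  gauss-pascal : ∀ n k → gauss (suc n) (suc k) ≈ gauss n (suc k) + q ^ (n ∸ k) * gauss n k
  gauss-pascal zero zero = begin
    1# + q ^ 1 * 0#  ≈⟨ +-congˡ (zeroʳ _) ⟩
    1# + 0#          ≈⟨ +-comm 1# 0# ⟩
    0# + 1#          ≈⟨ +-congˡ (*-identityˡ 1#) ⟨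
    0# + 1# * 1#     ∎
  gauss-pascal zero (suc k) = trans (+-congˡ (zeroʳ _)) (+-congˡ (sym (zeroʳ _)))
  gauss-pascal (suc n) zero = begin
    1# + q ^ 1 * (1# + q ^ 1 * gauss n 1)
      ≈⟨ +-congˡ (*-congˡ (gauss-pascal n 0)) ⟩
    1# + q ^ 1 * (gauss n 1 + q ^ n * 1#)
      ≈⟨ solve 3 (λ x y g → 𝟙 :+ x :^ 1 :* (g :+ y :* 𝟙) := 𝟙 :+ x :^ 1 :* g :+ x :* y :* 𝟙) refl q (q ^ n) (gauss n 1) ⟩
    (1# + q ^ 1 * gauss n 1) + q ^ suc n * 1# ∎
  gauss-pascal (suc n) (suc k) = begin
    (a + q ^ suc k * b) + q ^ suc (suc k) * (b + q ^ suc (suc k) * c)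
      ≈⟨ +-cong (gauss-pascal n k) (*-congˡ (gauss-pascal n (suc k))) ⟩
    (b + q ^ (n ∸ k) * a) + q ^ suc (suc k) * (c + q ^ (n ∸ suc k) * b)
      ≈⟨ solve 7 (λ x a b c u v w → (b :+ u :* a) :+ x :* w :* (c :+ v :* b)
           := (b :+ x :* w :* c) :+ u :* a :+ x :* (w :* (v :* b))) refl q a b c (q ^ (n ∸ k)) (q ^ (n ∸ suc k)) (q ^ suc k) ⟩
    (b + q ^ suc (suc k) * c) + q ^ (n ∸ k) * a + q * (q ^ suc k * (q ^ (n ∸ suc k) * b))
      -- The two ways of splitting the exponent n, as (k + 1) + (n - k - 1) and as k + (n - k), are
      -- identified in front of b.
      ≈⟨ +-congˡ (*-congˡ (trans (q^-∸-gauss n (ℕ.≤-refl {suc k})) (sym (q^-∸-gauss n (ℕ.n≤1+n k))))) ⟩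
    (b + q ^ suc (suc k) * c) + q ^ (n ∸ k) * a + q * (q ^ k * (q ^ (n ∸ k) * b))
      ≈⟨ solve 6 (λ x a b d u w → d :+ u :* a :+ x :* (w :* (u :* b))
           := d :+ u :* (a :+ x :* w :* b)) refl q a b (b + q ^ suc (suc k) * c) (q ^ (n ∸ k)) (q ^ k) ⟩
    (b + q ^ suc (suc k) * c) + q ^ (n ∸ k) * (a + q ^ suc k * b) ∎
    where
    a = gauss n k
    b = gauss n (suc k)
    c = gauss n (suc (suc k))

  -- Shared induction step of both Vandermonde sums and of the q-binomial theorem. Pascal's rule
  -- splits [m+1; x+1] into pieces with [m; x] and [m; x+1]; moving the first piece back by one
  -- index puts both over the same [m; x].
  ∑-gauss-step : ∀ m (F A B : ℕ → Carrier) → F 0 ≈ B 0 → (∀ x → F (suc x) ≈ A x + B (suc x)) → B (suc m) ≈ 0# →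
                 ∑ (2 ℕ.+ m) F ≈ ∑[ x < suc m ] (B x + A x)
  ∑-gauss-step m F A B F₀≈B₀ F-suc B-last = begin
    ∑ (2 ℕ.+ m) F
      ≈⟨ ∑-head (suc m) F ⟩
    F 0 + (∑[ x < suc m ] F (suc x))
      ≈⟨ +-cong F₀≈B₀ (trans (∑-cong (suc m) F-suc) (trans (∑-+ (suc m) _ _) (+-comm _ _))) ⟩
    B 0 + ((∑[ x < suc m ] B (suc x)) + (∑[ x < suc m ] A x))
      ≈⟨ +-assoc _ _ _ ⟨
    B 0 + (∑[ x < suc m ] B (suc x)) + (∑[ x < suc m ] A x)
      ≈⟨ +-congʳ (∑-head (suc m) B) ⟨
    (∑[ x < 2 ℕ.+ m ] B x) + (∑[ x < suc m ] A x)
      ≈⟨ +-congʳ (trans (+-congˡ B-last) (+-identityʳ _)) ⟩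
    (∑[ x < suc m ] B x) + (∑[ x < suc m ] A x)
      ≈⟨ ∑-+ (suc m) B A ⟨
    ∑[ x < suc m ] (B x + A x) ∎

  -- q-Vandermonde sums

  IsPascal : (ℕ → ℕ → Carrier) → Set
  IsPascal b = ∀ n k → b (suc n) (suc k) ≈ b n k + q ^ suc k * b n (suc k)

  gauss-isPascal : IsPascal gauss
  gauss-isPascal n k = refl

  -- The induction trades (m + 1, n, c) for (m, n + 1, c + 1), so b is only ever used through Pascal's rule.
  vandermonde : ∀ b → IsPascal b → ∀ m n c →
                ∑[ x < suc m ] (q ^ (x ℕ.* (x ℕ.+ c)) * gauss m x * b n (x ℕ.+ c)) ≈ b (m ℕ.+ n) (m ℕ.+ c)
  vandermonde b isPascal zero n c = trans (+-identityˡ _) (trans (*-congʳ (*-identityʳ _)) (*-identityˡ _))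
  vandermonde b isPascal (suc m) n c = begin
    ∑ (2 ℕ.+ m) F
      ≈⟨ ∑-gauss-step m F A B (sym (*-congʳ (*-congˡ (*-identityˡ 1#)))) F-suc B-last ⟩
    ∑[ x < suc m ] (B x + A x)
      ≈⟨ ∑-cong (suc m) B+A ⟩
    ∑[ x < suc m ] (q ^ (x ℕ.* (x ℕ.+ suc c)) * gauss m x * b (suc n) (x ℕ.+ suc c))
      ≈⟨ vandermonde b isPascal m (suc n) (suc c) ⟩
    b (m ℕ.+ suc n) (m ℕ.+ suc c)
      ≡⟨ ≡.cong₂ b (ℕ.+-suc m n) (ℕ.+-suc m c) ⟩
    b (suc m ℕ.+ n) (suc m ℕ.+ c) ∎
    where
    F A B : ℕ → Carrier
    F x = q ^ (x ℕ.* (x ℕ.+ c)) * gauss (suc m) x * b n (x ℕ.+ c)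
    A x = q ^ (suc x ℕ.* suc (x ℕ.+ c)) * gauss m x * b n (suc (x ℕ.+ c))
    B x = q ^ (x ℕ.* (x ℕ.+ c)) * (q ^ x * gauss m x) * b n (x ℕ.+ c)
    F-suc : ∀ x → F (suc x) ≈ A x + B (suc x)
    F-suc x = trans (*-congʳ (distribˡ _ _ _)) (distribʳ _ _ _)
    B-last : B (suc m) ≈ 0#
    B-last = trans (*-congʳ (trans (*-congˡ (trans (*-congˡ (gauss-> (ℕ.n<1+n m))) (zeroʳ _))) (zeroʳ _))) (zeroˡ _)
    B+A : ∀ x → B x + A x ≈ q ^ (x ℕ.* (x ℕ.+ suc c)) * gauss m x * b (suc n) (x ℕ.+ suc c)
    B+A x = begin
      B x + A x
        ≈⟨ +-congˡ (*-congʳ (*-congʳ (trans (q^-+ _ (suc (x ℕ.+ c)) (e₁ x c)) (*-congʳ (q^-+ (x ℕ.* (x ℕ.+ c)) x ≡.refl))))) ⟩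
      B x + (q ^ (x ℕ.* (x ℕ.+ c)) * q ^ x) * q ^ suc (x ℕ.+ c) * gauss m x * b n (suc (x ℕ.+ c))
        ≈⟨ solve 6 (λ u v w g b₀ b₁ → u :* (v :* g) :* b₀ :+ (u :* v) :* w :* g :* b₁ := u :* v :* g :* (b₀ :+ w :* b₁)) refl
             (q ^ (x ℕ.* (x ℕ.+ c))) (q ^ x) (q ^ suc (x ℕ.+ c)) (gauss m x) (b n (x ℕ.+ c)) (b n (suc (x ℕ.+ c))) ⟩
      q ^ (x ℕ.* (x ℕ.+ c)) * q ^ x * gauss m x * (b n (x ℕ.+ c) + q ^ suc (x ℕ.+ c) * b n (suc (x ℕ.+ c)))
        ≈⟨ *-cong (*-congʳ (sym (q^-+ (x ℕ.* (x ℕ.+ c)) x (e₂ x c)))) (sym (isPascal n (x ℕ.+ c))) ⟩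
      q ^ (x ℕ.* (x ℕ.+ suc c)) * gauss m x * b (suc n) (suc (x ℕ.+ c))
        ≡⟨ ≡.cong (λ k → q ^ (x ℕ.* (x ℕ.+ suc c)) * gauss m x * b (suc n) k) (ℕ.+-suc x c) ⟨
      q ^ (x ℕ.* (x ℕ.+ suc c)) * gauss m x * b (suc n) (x ℕ.+ suc c) ∎
      where
      e₁ : ∀ x c → suc x ℕ.* suc (x ℕ.+ c) ≡ (x ℕ.* (x ℕ.+ c) ℕ.+ x) ℕ.+ suc (x ℕ.+ c)
      e₁ = ℕSolver.solve-∀
      e₂ : ∀ x c → x ℕ.* (x ℕ.+ suc c) ≡ x ℕ.* (x ℕ.+ c) ℕ.+ x
      e₂ = ℕSolver.solve-∀

  -- The trade is (m + 1, n, c) for (m, n, c + 1), now through the dual rule `gauss-pascal`, because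
  -- the weight (m - x)(n - x) decreases with x. Writing the top as n + c makes the binomial vanish
  -- as soon as x > n, where n ∸ x is truncated.
  vandermonde′ : ∀ m n c →
                 ∑[ x < suc m ] (q ^ ((m ∸ x) ℕ.* (n ∸ x)) * gauss m x * gauss (n ℕ.+ c) (x ℕ.+ c)) ≈ gauss (m ℕ.+ (n ℕ.+ c)) (m ℕ.+ c)
  vandermonde′ zero n c = trans (+-identityˡ _) (trans (*-congʳ (*-identityʳ _)) (*-identityˡ _))
  vandermonde′ (suc m) n c = begin
    ∑ (2 ℕ.+ m) F
      ≈⟨ ∑-gauss-step m F A B refl F-suc B-last ⟩
    ∑[ x < suc m ] (B x + A x)
      ≈⟨ ∑-cong< (suc m) B+A ⟩
    ∑[ x < suc m ] (q ^ ((m ∸ x) ℕ.* (n ∸ x)) * gauss m x * gauss (n ℕ.+ suc c) (x ℕ.+ suc c))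
      ≈⟨ vandermonde′ m n (suc c) ⟩
    gauss (m ℕ.+ (n ℕ.+ suc c)) (m ℕ.+ suc c)
      ≡⟨ ≡.cong₂ gauss (≡.trans (≡.cong (m ℕ.+_) (ℕ.+-suc n c)) (ℕ.+-suc m (n ℕ.+ c))) (ℕ.+-suc m c) ⟩
    gauss (suc m ℕ.+ (n ℕ.+ c)) (suc m ℕ.+ c) ∎
    where
    F A B : ℕ → Carrier
    F x = q ^ ((suc m ∸ x) ℕ.* (n ∸ x)) * gauss (suc m) x * gauss (n ℕ.+ c) (x ℕ.+ c)
    A x = q ^ ((m ∸ x) ℕ.* (n ∸ suc x)) * (q ^ (m ∸ x) * gauss m x) * gauss (n ℕ.+ c) (suc x ℕ.+ c)
    B x = q ^ ((suc m ∸ x) ℕ.* (n ∸ x)) * gauss m x * gauss (n ℕ.+ c) (x ℕ.+ c)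
    F-suc : ∀ x → F (suc x) ≈ A x + B (suc x)
    F-suc x = trans (*-congʳ (trans (*-congˡ (trans (gauss-pascal m x) (+-comm _ _))) (distribˡ _ _ _))) (distribʳ _ _ _)
    B-last : B (suc m) ≈ 0#
    B-last = trans (*-congʳ (trans (*-congˡ (gauss-> (ℕ.n<1+n m))) (zeroʳ _))) (zeroˡ _)
    A-exponent : ∀ x → q ^ ((m ∸ x) ℕ.* (n ∸ suc x)) * q ^ (m ∸ x) * gauss (n ℕ.+ c) (suc x ℕ.+ c)
                     ≈ q ^ ((m ∸ x) ℕ.* (n ∸ x)) * gauss (n ℕ.+ c) (suc x ℕ.+ c)
    A-exponent x with ℕ.≤-<-connex n x
    ... | inj₁ n≤x = trans (trans (*-congˡ g≈0) (zeroʳ _)) (sym (trans (*-congˡ g≈0) (zeroʳ _)))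
      where g≈0 = gauss-> (s≤s (ℕ.+-monoˡ-≤ c n≤x))
    ... | inj₂ x<n = *-congʳ (sym (q^-+ _ (m ∸ x) (≡.trans (≡.cong ((m ∸ x) ℕ.*_) (ℕ.+-∸-assoc 1 x<n))
                       (≡.trans (ℕ.*-suc (m ∸ x) (n ∸ suc x)) (ℕ.+-comm (m ∸ x) _)))))
    B+A : ∀ x → x < suc m → B x + A x ≈ q ^ ((m ∸ x) ℕ.* (n ∸ x)) * gauss m x * gauss (n ℕ.+ suc c) (x ℕ.+ suc c)
    B+A x (s≤s x≤m) = begin
      B x + A x
        ≈⟨ +-cong (*-congʳ (*-congʳ (q^-+ (n ∸ x) e (≡.cong (ℕ._* (n ∸ x)) (ℕ.+-∸-assoc 1 x≤m)))))
             (solve 4 (λ u v g b → u :* (v :* g) :* b := g :* (u :* v :* b)) refl _ _ _ _) ⟩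
      q ^ (n ∸ x) * q ^ e * gauss m x * b₀ + gauss m x * (q ^ ((m ∸ x) ℕ.* (n ∸ suc x)) * q ^ (m ∸ x) * b₁)
        ≈⟨ +-congˡ (*-congˡ (A-exponent x)) ⟩
      q ^ (n ∸ x) * q ^ e * gauss m x * b₀ + gauss m x * (q ^ e * b₁)
        ≈⟨ solve 5 (λ u v g b₀ b₁ → u :* v :* g :* b₀ :+ g :* (v :* b₁) := v :* g :* (b₁ :+ u :* b₀)) refl
             (q ^ (n ∸ x)) (q ^ e) (gauss m x) b₀ b₁ ⟩
      q ^ e * gauss m x * (b₁ + q ^ (n ∸ x) * b₀)
        ≡⟨ ≡.cong (λ k → q ^ e * gauss m x * (b₁ + q ^ k * b₀)) (≡.trans (≡.cong₂ _∸_ (ℕ.+-comm n c) (ℕ.+-comm x c)) (ℕ.[m+n]∸[m+o]≡n∸o c n x)) ⟨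
      q ^ e * gauss m x * (b₁ + q ^ ((n ℕ.+ c) ∸ (x ℕ.+ c)) * b₀)
        ≈⟨ *-congˡ (gauss-pascal (n ℕ.+ c) (x ℕ.+ c)) ⟨
      q ^ e * gauss m x * gauss (suc (n ℕ.+ c)) (suc (x ℕ.+ c))
        ≡⟨ ≡.cong₂ (λ k l → q ^ e * gauss m x * gauss k l) (ℕ.+-suc n c) (ℕ.+-suc x c) ⟨
      q ^ e * gauss m x * gauss (n ℕ.+ suc c) (x ℕ.+ suc c) ∎
      where
      e = (m ∸ x) ℕ.* (n ∸ x)
      b₀ = gauss (n ℕ.+ c) (x ℕ.+ c)
      b₁ = gauss (n ℕ.+ c) (suc x ℕ.+ c)

  -- The q-binomial theorem and a finite triple product

  pochhammer : Carrier → ℕ → Carrier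
  pochhammer z zero    = 1#
  pochhammer z (suc n) = pochhammer z n * (1# - z * q ^ n)

  -- binomCoeff z a = (−z)^a q^{a(a−1)/2}
  binomCoeff : Carrier → ℕ → Carrier
  binomCoeff z zero    = 1#
  binomCoeff z (suc a) = - (binomCoeff z a * (z * q ^ a))

  q-binomial-theorem : ∀ z n → pochhammer z n ≈ ∑[ a < suc n ] (binomCoeff z a * gauss n a)
  q-binomial-theorem z zero    = sym (trans (+-identityˡ _) (*-identityˡ 1#))
  q-binomial-theorem z (suc n) = begin
    pochhammer z n * (1# - z * q ^ n)
      ≈⟨ *-congʳ (q-binomial-theorem z n) ⟩
    (∑[ a < suc n ] (binomCoeff z a * gauss n a)) * (1# - z * q ^ n)
      ≈⟨ ∑-* _ (suc n) _ ⟩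
    ∑[ a < suc n ] (binomCoeff z a * gauss n a * (1# - z * q ^ n))
      ≈⟨ ∑-cong< (suc n) B+A ⟨
    ∑[ a < suc n ] (B a + A a)
      ≈⟨ ∑-gauss-step n F A B refl F-suc B-last ⟨
    ∑[ a < 2 ℕ.+ n ] (binomCoeff z a * gauss (suc n) a) ∎
    where
    F A B : ℕ → Carrier
    F a = binomCoeff z a * gauss (suc n) a
    A a = binomCoeff z (suc a) * (q ^ (n ∸ a) * gauss n a)
    B a = binomCoeff z a * gauss n a
    F-suc : ∀ a → F (suc a) ≈ A a + B (suc a)
    F-suc a = trans (*-congˡ (trans (gauss-pascal n a) (+-comm _ _))) (distribˡ _ _ _)
    B-last : B (suc n) ≈ 0#
    B-last = trans (*-congˡ (gauss-> (ℕ.n<1+n n))) (zeroʳ _)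
    B+A : ∀ a → a < suc n → B a + A a ≈ binomCoeff z a * gauss n a * (1# - z * q ^ n)
    B+A a (s≤s a≤n) = begin
      c * g + - (c * (z * q ^ a)) * (q ^ (n ∸ a) * g)
        ≈⟨ solve 5 (λ c g z u v → c :* g :+ (:- (c :* (z :* u))) :* (v :* g) := c :* g :* (𝟙 :- z :* (u :* v))) refl
             c g z (q ^ a) (q ^ (n ∸ a)) ⟩
      c * g * (1# - z * (q ^ a * q ^ (n ∸ a)))
        ≈⟨ *-congˡ (+-congˡ (-‿cong (*-congˡ (sym (q^-+ a (n ∸ a) (≡.sym (ℕ.m+[n∸m]≡n a≤n))))))) ⟩
      c * g * (1# - z * q ^ n) ∎
      where
      c = binomCoeff z a
      g = gauss n a

  -- The condition z w = q turns (z w)^b into q^b, which completes the two triangular exponents to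
  -- d(d-1)/2 plus the Vandermonde weight b(b + d).
  binomCoeff-* : ∀ z w → z * w ≈ q → ∀ b d →
                 binomCoeff z (b ℕ.+ d) * binomCoeff w b ≈ binomCoeff z d * q ^ (b ℕ.* (b ℕ.+ d))
  binomCoeff-* z w zw≈q zero    d = refl
  binomCoeff-* z w zw≈q (suc b) d = begin
    - (c * (z * q ^ (b ℕ.+ d))) * - (c′ * (w * q ^ b))
      ≈⟨ solve 6 (λ c c′ z w u v → (:- (c :* (z :* u))) :* (:- (c′ :* (w :* v))) := (c :* c′) :* (z :* w :* (u :* v))) refl
           c c′ z w (q ^ (b ℕ.+ d)) (q ^ b) ⟩
    (c * c′) * (z * w * (q ^ (b ℕ.+ d) * q ^ b))
      ≈⟨ *-cong (binomCoeff-* z w zw≈q b d) (*-cong zw≈q (sym (q^-+ (b ℕ.+ d) b ≡.refl))) ⟩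
    binomCoeff z d * q ^ (b ℕ.* (b ℕ.+ d)) * q ^ suc (b ℕ.+ d ℕ.+ b)
      ≈⟨ trans (*-assoc _ _ _) (*-congˡ (sym (q^-+ (b ℕ.* (b ℕ.+ d)) (suc (b ℕ.+ d ℕ.+ b)) (e b d)))) ⟩
    binomCoeff z d * q ^ (suc b ℕ.* (suc b ℕ.+ d)) ∎
    where
    c = binomCoeff z (b ℕ.+ d)
    c′ = binomCoeff w b
    e : ∀ b d → suc b ℕ.* (suc b ℕ.+ d) ≡ b ℕ.* (b ℕ.+ d) ℕ.+ suc (b ℕ.+ d ℕ.+ b)
    e = ℕSolver.solve-∀

  -- A finite form of the Jacobi triple product. The half with negative d is written in terms of w,
  -- which stands for q/z, and with [2n; n-d] = [2n; n+d]; thus z is never inverted.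
  pochhammer-* : ∀ z w → z * w ≈ q → ∀ n →
    pochhammer z n * pochhammer w n
    ≈ (∑[ d < suc n ] (binomCoeff z d * gauss (n ℕ.+ n) (n ℕ.+ d)))
      + (∑[ d < suc n ] (binomCoeff w (suc d) * gauss (n ℕ.+ n) (n ℕ.+ suc d)))
  pochhammer-* z w zw≈q n = begin
    pochhammer z n * pochhammer w n
      ≈⟨ *-cong (q-binomial-theorem z n) (q-binomial-theorem w n) ⟩
    (∑[ a < suc n ] U a) * ∑ (suc n) V
      ≈⟨ trans (∑-* _ (suc n) _) (∑-cong (suc n) λ a → *-∑ (U a) (suc n) _) ⟩
    ∑[ a < suc n ] ∑[ b < suc n ] (U a * V b)
      ≈⟨ ∑-diagonals (suc n) (λ a b → U a * V b)
           (λ a b n<a → trans (*-congʳ (trans (*-congˡ (gauss-> n<a)) (zeroʳ _))) (zeroˡ _))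
           (λ a b n<b → trans (*-congˡ (trans (*-congˡ (gauss-> n<b)) (zeroʳ _))) (zeroʳ _)) ⟩
    (∑[ d < suc n ] ∑[ b < suc n ] (U (b ℕ.+ d) * V b)) + (∑[ d < suc n ] ∑[ a < suc n ] (U a * V (a ℕ.+ suc d)))
      ≈⟨ +-cong (∑-cong (suc n) λ d → diagonal z w zw≈q d)
                (∑-cong (suc n) λ d → trans (∑-cong (suc n) λ _ → *-comm _ _) (diagonal w z (trans (*-comm w z) zw≈q) (suc d))) ⟩
    (∑[ d < suc n ] (binomCoeff z d * gauss (n ℕ.+ n) (n ℕ.+ d)))
      + (∑[ d < suc n ] (binomCoeff w (suc d) * gauss (n ℕ.+ n) (n ℕ.+ suc d))) ∎
    where
    U V : ℕ → Carrier
    U a = binomCoeff z a * gauss n a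
    V b = binomCoeff w b * gauss n b
    diagonal : ∀ z w → z * w ≈ q → ∀ d →
      ∑[ b < suc n ] ((binomCoeff z (b ℕ.+ d) * gauss n (b ℕ.+ d)) * (binomCoeff w b * gauss n b))
      ≈ binomCoeff z d * gauss (n ℕ.+ n) (n ℕ.+ d)
    diagonal z w zw≈q d = begin
      ∑[ b < suc n ] ((binomCoeff z (b ℕ.+ d) * gauss n (b ℕ.+ d)) * (binomCoeff w b * gauss n b))
        ≈⟨ ∑-cong (suc n) term ⟩
      ∑[ b < suc n ] (binomCoeff z d * (q ^ (b ℕ.* (b ℕ.+ d)) * gauss n b * gauss n (b ℕ.+ d)))
        ≈⟨ *-∑ _ (suc n) _ ⟨
      binomCoeff z d * (∑[ b < suc n ] (q ^ (b ℕ.* (b ℕ.+ d)) * gauss n b * gauss n (b ℕ.+ d)))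
        ≈⟨ *-congˡ (vandermonde gauss gauss-isPascal n n d) ⟩
      binomCoeff z d * gauss (n ℕ.+ n) (n ℕ.+ d) ∎
      where
      term : ∀ b → (binomCoeff z (b ℕ.+ d) * gauss n (b ℕ.+ d)) * (binomCoeff w b * gauss n b)
                 ≈ binomCoeff z d * (q ^ (b ℕ.* (b ℕ.+ d)) * gauss n b * gauss n (b ℕ.+ d))
      term b = begin
        (binomCoeff z (b ℕ.+ d) * gauss n (b ℕ.+ d)) * (binomCoeff w b * gauss n b)
          ≈⟨ solve 4 (λ c g c′ h → (c :* g) :* (c′ :* h) := (c :* c′) :* (h :* g)) refl _ _ _ _ ⟩
        (binomCoeff z (b ℕ.+ d) * binomCoeff w b) * (gauss n b * gauss n (b ℕ.+ d))
          ≈⟨ *-congʳ (binomCoeff-* z w zw≈q b d) ⟩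
        (binomCoeff z d * q ^ (b ℕ.* (b ℕ.+ d))) * (gauss n b * gauss n (b ℕ.+ d))
          ≈⟨ solve 4 (λ c u h g → (c :* u) :* (h :* g) := c :* (u :* h :* g)) refl _ _ _ _ ⟩
        binomCoeff z d * (q ^ (b ℕ.* (b ℕ.+ d)) * gauss n b * gauss n (b ℕ.+ d)) ∎

-- The Burge transform and the Bailey chain

-- For N = j + x and c = 2j + 1 the Vandermonde weight x(x + c) equals N² + N - j² - j. Every
-- summation step of the chain therefore costs one factor q^(j²+j) on the side of j.
square-shift : ∀ j x → (j ℕ.+ x) ℕ.* suc (j ℕ.+ x) ≡ j ℕ.* suc j ℕ.+ x ℕ.* (x ℕ.+ (j ℕ.+ suc j))
square-shift = ℕSolver.solve-∀

index-shift : ∀ j x → j ℕ.+ x ℕ.+ suc j ≡ x ℕ.+ (j ℕ.+ suc j)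
index-shift = ℕSolver.solve-∀

-- The proof divides only by elements 1 - q^(n+1); their inverses already provide every 1/(q)_n. For
-- power series `inv` will be the geometric series `geo`.
InvertsOneMinusPowers : (R : CommutativeRing 0ℓ 0ℓ) →
                        CommutativeRing.Carrier R → (ℕ → CommutativeRing.Carrier R) → Set
InvertsOneMinusPowers R q inv = ∀ n → inv n * (1# - q ^ suc n) ≈ 1#
  where
  open CommutativeRing R
  open Exp semiring using (_^_)

module QSeries (R : CommutativeRing 0ℓ 0ℓ)
               (fromℤ : ℤ.+-*-rawRing -Raw-AlmostCommutative⟶ fromCommutativeRing R)
               (q : CommutativeRing.Carrier R) (inv : ℕ → CommutativeRing.Carrier R)
               (inv-inverse : InvertsOneMinusPowers R q inv) where
  open CommutativeRing R
  open Exp semiring using (_^_)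
  open import Relation.Binary.Reasoning.Setoid setoid
  open import Algebra.Properties.Ring ring using (-0#≈0#)
  open Sums R
  open QBinomial R fromℤ q

  0-* : ∀ {x} y → x ≈ 0# → x * y ≈ 0#
  0-* y x≈0 = trans (*-congʳ x≈0) (zeroˡ y)

  *-0 : ∀ x {y} → y ≈ 0# → x * y ≈ 0#
  *-0 x y≈0 = trans (*-congˡ y≈0) (zeroʳ x)

  delay-<-0 : ∀ {j N} f → N < j → delay j f N ≈ 0#
  delay-<-0 f N<j = reflexive (delay-< f N<j)

  *-cong₈ : ∀ {a b c d e f g h a′ b′ c′ d′ e′ f′ g′ h′} →
    a ≈ a′ → b ≈ b′ → c ≈ c′ → d ≈ d′ → e ≈ e′ → f ≈ f′ → g ≈ g′ → h ≈ h′ →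
    a * b * c * d * e * f * g * h ≈ a′ * b′ * c′ * d′ * e′ * f′ * g′ * h′
  *-cong₈ a b c d e f g h = *-cong (*-cong (*-cong (*-cong (*-cong (*-cong (*-cong a b) c) d) e) f) g) h

  -- q-factorials, their reciprocals and trinomials

  qfac : ℕ → Carrier
  qfac zero    = 1#
  qfac (suc n) = qfac n * (1# - q ^ suc n)

  iqfac : ℕ → Carrier
  iqfac zero    = 1#
  iqfac (suc n) = iqfac n * inv n

  iqfac-suc : ∀ n → iqfac (suc n) * (1# - q ^ suc n) ≈ iqfac n
  iqfac-suc n = trans (*-assoc _ _ _) (trans (*-congˡ (inv-inverse n)) (*-identityʳ _))

  qfac-iqfac : ∀ n → qfac n * iqfac n ≈ 1#
  qfac-iqfac zero    = *-identityˡ 1#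
  qfac-iqfac (suc n) = begin
    qfac n * (1# - q ^ suc n) * iqfac (suc n)    ≈⟨ trans (*-assoc _ _ _) (*-congˡ (*-comm _ _)) ⟩
    qfac n * (iqfac (suc n) * (1# - q ^ suc n))  ≈⟨ *-congˡ (iqfac-suc n) ⟩
    qfac n * iqfac n                             ≈⟨ qfac-iqfac n ⟩
    1#                                           ∎

  -- The case n = 0 is included: the missing 1/(q)_n at n = -1 is read as 0, and 1 - q^0 = 0.
  iqfac-pred : ∀ n → delay 1 iqfac n ≈ iqfac n * (1# - q ^ n)
  iqfac-pred zero    = sym (*-0 1# (-‿inverseʳ 1#))
  iqfac-pred (suc n) = sym (iqfac-suc n)

  -- 1/(q)_k is the limit of [n; k] for n → ∞, and Pascal's rule survives the limit. This makes
  -- `vandermonde` applicable to the limiting Bailey step as well.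
  iqfac-isPascal : IsPascal (λ _ → iqfac)
  iqfac-isPascal n k = begin
    iqfac (suc k)
      ≈⟨ solve 2 (λ i y → i := i :* (𝟙 :- y) :+ y :* i) refl (iqfac (suc k)) (q ^ suc k) ⟩
    iqfac (suc k) * (1# - q ^ suc k) + q ^ suc k * iqfac (suc k)
      ≈⟨ +-congʳ (iqfac-suc k) ⟩
    iqfac k + q ^ suc k * iqfac (suc k) ∎

  -- The quotient satisfies Pascal's rule because (1 - u) + u (1 - v) = 1 - u v, with u = q^(m+1)
  -- and v = q^(n+1).
  gauss-qfac : ∀ m n → gauss (m ℕ.+ n) m ≈ qfac (m ℕ.+ n) * (iqfac m * iqfac n)
  gauss-qfac zero    n       = sym (trans (*-congˡ (*-identityˡ _)) (qfac-iqfac n))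
  gauss-qfac (suc m) zero    = begin
    gauss (suc m ℕ.+ 0) (suc m)                       ≡⟨ ≡.cong (λ k → gauss k (suc m)) (ℕ.+-identityʳ (suc m)) ⟩
    gauss (suc m) (suc m)                             ≈⟨ gauss-self (suc m) ⟩
    1#                                                ≈⟨ trans (*-congˡ (*-identityʳ _)) (qfac-iqfac (suc m)) ⟨
    qfac (suc m) * (iqfac (suc m) * 1#)               ≡⟨ ≡.cong (λ k → qfac k * (iqfac (suc m) * 1#)) (ℕ.+-identityʳ (suc m)) ⟨
    qfac (suc m ℕ.+ 0) * (iqfac (suc m) * iqfac 0)    ∎
  gauss-qfac (suc m) (suc n) = begin
    gauss (m ℕ.+ suc n) m + q ^ suc m * gauss (m ℕ.+ suc n) (suc m)
      ≈⟨ +-cong (gauss-qfac m (suc n)) (*-congˡ (trans (reflexive (≡.cong (λ k → gauss k (suc m)) (ℕ.+-suc m n))) (gauss-qfac (suc m) n))) ⟩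
    qfac (m ℕ.+ suc n) * (iqfac m * iqfac (suc n)) + q ^ suc m * (qfac (suc m ℕ.+ n) * (iqfac (suc m) * iqfac n))
      ≡⟨ ≡.cong (λ k → qfac (m ℕ.+ suc n) * (iqfac m * iqfac (suc n)) + q ^ suc m * (qfac k * (iqfac (suc m) * iqfac n))) (ℕ.+-suc m n) ⟨
    N * (iqfac m * iqfac (suc n)) + q ^ suc m * (N * (iqfac (suc m) * iqfac n))
      ≈⟨ +-cong (*-congˡ (*-congʳ (iqfac-suc m))) (*-congˡ (*-congˡ (*-congˡ (iqfac-suc n)))) ⟨
    N * (iqfac (suc m) * (1# - q ^ suc m) * iqfac (suc n)) + q ^ suc m * (N * (iqfac (suc m) * (iqfac (suc n) * (1# - q ^ suc n))))
      ≈⟨ solve 5 (λ N i j u v → N :* (i :* (𝟙 :- u) :* j) :+ u :* (N :* (i :* (j :* (𝟙 :- v)))) := N :* (𝟙 :- u :* v) :* (i :* j)) refl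
           N (iqfac (suc m)) (iqfac (suc n)) (q ^ suc m) (q ^ suc n) ⟩
    N * (1# - q ^ suc m * q ^ suc n) * (iqfac (suc m) * iqfac (suc n))
      ≈⟨ *-congʳ (*-congˡ (+-congˡ (-‿cong (q^-+ (suc m) (suc n) ≡.refl)))) ⟨
    qfac (suc m ℕ.+ suc n) * (iqfac (suc m) * iqfac (suc n)) ∎
    where
    N = qfac (m ℕ.+ suc n)

  gauss-delay : ∀ n k → gauss n k ≈ qfac n * (iqfac k * delay k iqfac n)
  gauss-delay n k with offset k n
  ... | inj₁ (d , ≡.refl) = trans (gauss-qfac k d) (*-congˡ (*-congˡ (reflexive (≡.sym (delay-+ k iqfac d)))))
  ... | inj₂ n<k = trans (gauss-> n<k) (sym (*-0 _ (*-0 _ (delay-<-0 iqfac n<k))))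

  gauss-sym : ∀ m n → gauss (m ℕ.+ n) m ≈ gauss (m ℕ.+ n) n
  gauss-sym m n = begin
    gauss (m ℕ.+ n) m                        ≈⟨ gauss-qfac m n ⟩
    qfac (m ℕ.+ n) * (iqfac m * iqfac n)     ≈⟨ *-congˡ (*-comm _ _) ⟩
    qfac (m ℕ.+ n) * (iqfac n * iqfac m)     ≡⟨ ≡.cong (λ k → qfac k * (iqfac n * iqfac m)) (ℕ.+-comm m n) ⟩
    qfac (n ℕ.+ m) * (iqfac n * iqfac m)     ≈⟨ gauss-qfac n m ⟨
    gauss (n ℕ.+ m) n                        ≡⟨ ≡.cong (λ k → gauss k n) (ℕ.+-comm n m) ⟩
    gauss (m ℕ.+ n) n                        ∎

  trinomial : ℕ → ℕ → ℕ → Carrier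
  trinomial a b c = qfac (a ℕ.+ b ℕ.+ c) * (iqfac a * iqfac b * iqfac c)

  gauss-gauss-inner : ∀ a b c → gauss (a ℕ.+ b ℕ.+ c) (a ℕ.+ b) * gauss (a ℕ.+ b) a ≈ trinomial a b c
  gauss-gauss-inner a b c = begin
    gauss (a ℕ.+ b ℕ.+ c) (a ℕ.+ b) * gauss (a ℕ.+ b) a
      ≈⟨ *-cong (gauss-qfac (a ℕ.+ b) c) (gauss-qfac a b) ⟩
    qfac (a ℕ.+ b ℕ.+ c) * (iqfac (a ℕ.+ b) * iqfac c) * (qfac (a ℕ.+ b) * (iqfac a * iqfac b))
      ≈⟨ solve 6 (λ u v w x y z → u :* (v :* w) :* (x :* (y :* z)) := x :* v :* (u :* (y :* z :* w))) refl _ _ _ _ _ _ ⟩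
    qfac (a ℕ.+ b) * iqfac (a ℕ.+ b) * trinomial a b c
      ≈⟨ trans (*-congʳ (qfac-iqfac (a ℕ.+ b))) (*-identityˡ _) ⟩
    trinomial a b c ∎

  gauss-gauss-outer : ∀ a b c → gauss (a ℕ.+ (b ℕ.+ c)) a * gauss (b ℕ.+ c) b ≈ trinomial a b c
  gauss-gauss-outer a b c = begin
    gauss (a ℕ.+ (b ℕ.+ c)) a * gauss (b ℕ.+ c) b
      ≈⟨ *-cong (gauss-qfac a (b ℕ.+ c)) (gauss-qfac b c) ⟩
    qfac (a ℕ.+ (b ℕ.+ c)) * (iqfac a * iqfac (b ℕ.+ c)) * (qfac (b ℕ.+ c) * (iqfac b * iqfac c))
      ≈⟨ solve 6 (λ u v w x y z → u :* (v :* w) :* (x :* (y :* z)) := x :* w :* (u :* (v :* y :* z))) refl _ _ _ _ _ _ ⟩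
    qfac (b ℕ.+ c) * iqfac (b ℕ.+ c) * (qfac (a ℕ.+ (b ℕ.+ c)) * (iqfac a * iqfac b * iqfac c))
      ≈⟨ trans (*-congʳ (qfac-iqfac (b ℕ.+ c))) (*-identityˡ _) ⟩
    qfac (a ℕ.+ (b ℕ.+ c)) * (iqfac a * iqfac b * iqfac c)
      ≡⟨ ≡.cong (λ k → qfac k * (iqfac a * iqfac b * iqfac c)) (ℕ.+-assoc a b c) ⟨
    trinomial a b c ∎

  gauss-trinomial : ∀ n k l → gauss n k * gauss (n ∸ k) l ≈ gauss n (k ℕ.+ l) * gauss (k ℕ.+ l) k
  gauss-trinomial n k l with offset (k ℕ.+ l) n
  ... | inj₁ (d , ≡.refl) = begin
    gauss (k ℕ.+ l ℕ.+ d) k * gauss (k ℕ.+ l ℕ.+ d ∸ k) l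
      ≡⟨ ≡.cong (λ n → gauss n k * gauss (n ∸ k) l) (ℕ.+-assoc k l d) ⟩
    gauss (k ℕ.+ (l ℕ.+ d)) k * gauss (k ℕ.+ (l ℕ.+ d) ∸ k) l
      ≡⟨ ≡.cong (λ r → gauss (k ℕ.+ (l ℕ.+ d)) k * gauss r l) (ℕ.m+n∸m≡n k (l ℕ.+ d)) ⟩
    gauss (k ℕ.+ (l ℕ.+ d)) k * gauss (l ℕ.+ d) l
      ≈⟨ trans (gauss-gauss-outer k l d) (sym (gauss-gauss-inner k l d)) ⟩
    gauss (k ℕ.+ l ℕ.+ d) (k ℕ.+ l) * gauss (k ℕ.+ l) k ∎
  ... | inj₂ n<k+l = trans lhs≈0 (sym (0-* _ (gauss-> n<k+l)))
    where
    lhs≈0 : gauss n k * gauss (n ∸ k) l ≈ 0#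
    lhs≈0 with offset k n
    ... | inj₂ n<k          = 0-* _ (gauss-> n<k)
    ... | inj₁ (d , ≡.refl) = *-0 _ (gauss->
      (≡.subst (_< l) (≡.sym (ℕ.m+n∸m≡n k d)) (ℕ.+-cancelˡ-< k d l n<k+l)))

  -- Both products are the trinomial with parts k + c, n - c and m - k, taken apart in two orders;
  -- if k > m or c > n, both are zero.
  gauss-exchange : ∀ n m k c →
    gauss (n ℕ.+ m) (n ℕ.+ k) * gauss (k ℕ.+ n) (k ℕ.+ c) ≈ gauss (n ℕ.+ m) (m ℕ.+ c) * gauss (m ℕ.+ c) (k ℕ.+ c)
  gauss-exchange n m k c with offset k m | offset c n
  ... | inj₂ m<k | _ = trans (0-* _ (gauss-> (ℕ.+-monoʳ-< n m<k))) (sym (*-0 _ (gauss-> (ℕ.+-monoˡ-< c m<k))))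
  ... | inj₁ _ | inj₂ n<c = trans (*-0 _ (gauss-> (ℕ.+-monoʳ-< k n<c)))
    (sym (0-* _ (gauss-> (≡.subst (_< m ℕ.+ c) (ℕ.+-comm m n) (ℕ.+-monoʳ-< m n<c)))))
  ... | inj₁ (r , ≡.refl) | inj₁ (s , ≡.refl) = begin
    gauss (c ℕ.+ s ℕ.+ (k ℕ.+ r)) (c ℕ.+ s ℕ.+ k) * gauss (k ℕ.+ (c ℕ.+ s)) (k ℕ.+ c)
      ≡⟨ ≡.cong₂ _*_ (≡.cong₂ gauss (e₁ c s k r) (e₂ c s k)) (≡.cong (λ n → gauss n (k ℕ.+ c)) (≡.sym (ℕ.+-assoc k c s))) ⟩
    gauss (k ℕ.+ c ℕ.+ s ℕ.+ r) (k ℕ.+ c ℕ.+ s) * gauss (k ℕ.+ c ℕ.+ s) (k ℕ.+ c)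
      ≈⟨ gauss-gauss-inner (k ℕ.+ c) s r ⟩
    trinomial (k ℕ.+ c) s r
      ≈⟨ *-cong (reflexive (≡.cong qfac (e₃ c s k r))) (trans (*-assoc _ _ _) (trans (*-congˡ (*-comm _ _)) (sym (*-assoc _ _ _)))) ⟩
    trinomial (k ℕ.+ c) r s
      ≈⟨ gauss-gauss-inner (k ℕ.+ c) r s ⟨
    gauss (k ℕ.+ c ℕ.+ r ℕ.+ s) (k ℕ.+ c ℕ.+ r) * gauss (k ℕ.+ c ℕ.+ r) (k ℕ.+ c)
      ≡⟨ ≡.cong₂ (λ a b → gauss a b * gauss b (k ℕ.+ c)) (e₄ c s k r) (e₅ c k r) ⟩
    gauss (c ℕ.+ s ℕ.+ (k ℕ.+ r)) (k ℕ.+ r ℕ.+ c) * gauss (k ℕ.+ r ℕ.+ c) (k ℕ.+ c) ∎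
    where
    e₁ : ∀ c s k r → c ℕ.+ s ℕ.+ (k ℕ.+ r) ≡ k ℕ.+ c ℕ.+ s ℕ.+ r
    e₁ = ℕSolver.solve-∀
    e₂ : ∀ c s k → c ℕ.+ s ℕ.+ k ≡ k ℕ.+ c ℕ.+ s
    e₂ = ℕSolver.solve-∀
    e₃ : ∀ c s k r → k ℕ.+ c ℕ.+ s ℕ.+ r ≡ k ℕ.+ c ℕ.+ r ℕ.+ s
    e₃ = ℕSolver.solve-∀
    e₄ : ∀ c s k r → k ℕ.+ c ℕ.+ r ℕ.+ s ≡ c ℕ.+ s ℕ.+ (k ℕ.+ r)
    e₄ = ℕSolver.solve-∀
    e₅ : ∀ c k r → k ℕ.+ c ℕ.+ r ≡ k ℕ.+ r ℕ.+ c
    e₅ = ℕSolver.solve-∀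

  -- The Burge transform, an instance of the q-Pfaff–Saalschütz sum: expand the last binomial by vandermonde′ and
  -- exchange summations; both resulting sums are again of Vandermonde type.
  burge : ∀ X Y m c →
    ∑[ x < suc m ] (q ^ (x ℕ.* (x ℕ.+ c)) * gauss Y (x ℕ.+ c) * (gauss X x * gauss (X ℕ.+ Y ℕ.+ (m ∸ x)) (X ℕ.+ Y)))
    ≈ gauss (X ℕ.+ (m ℕ.+ c)) m * gauss (Y ℕ.+ m) (m ℕ.+ c)
  burge X Y m c = begin
    ∑[ x < suc m ] (E x * (gauss X x * gauss (X ℕ.+ Y ℕ.+ (m ∸ x)) (X ℕ.+ Y)))
      ≈⟨ ∑-cong< (suc m) (λ { x (s≤s x≤m) → trans (*-congˡ (expand x x≤m)) (*-∑ (E x) (suc X) _) }) ⟩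
    ∑[ x < suc m ] ∑[ k < suc X ] (E x * (U k * gauss k x))
      ≈⟨ ∑-swap (suc m) (suc X) _ ⟩
    ∑[ k < suc X ] ∑[ x < suc m ] (E x * (U k * gauss k x))
      ≈⟨ ∑-cong (suc X) contract ⟩
    ∑[ k < suc X ] (gauss (Y ℕ.+ m) (m ℕ.+ c) * (q ^ ((X ∸ k) ℕ.* (m ∸ k)) * gauss X k * gauss (m ℕ.+ c) (k ℕ.+ c)))
      ≈⟨ *-∑ _ (suc X) _ ⟨
    gauss (Y ℕ.+ m) (m ℕ.+ c) * (∑[ k < suc X ] (q ^ ((X ∸ k) ℕ.* (m ∸ k)) * gauss X k * gauss (m ℕ.+ c) (k ℕ.+ c)))
      ≈⟨ *-congˡ (vandermonde′ X m c) ⟩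
    gauss (Y ℕ.+ m) (m ℕ.+ c) * gauss (X ℕ.+ (m ℕ.+ c)) (X ℕ.+ c)
      ≡⟨ ≡.cong (λ n → gauss (Y ℕ.+ m) (m ℕ.+ c) * gauss n (X ℕ.+ c)) (e X m c) ⟩
    gauss (Y ℕ.+ m) (m ℕ.+ c) * gauss (m ℕ.+ (X ℕ.+ c)) (X ℕ.+ c)
      ≈⟨ trans (*-congˡ (sym (gauss-sym m (X ℕ.+ c)))) (*-comm _ _) ⟩
    gauss (m ℕ.+ (X ℕ.+ c)) m * gauss (Y ℕ.+ m) (m ℕ.+ c)
      ≡⟨ ≡.cong (λ n → gauss n m * gauss (Y ℕ.+ m) (m ℕ.+ c)) (e X m c) ⟨
    gauss (X ℕ.+ (m ℕ.+ c)) m * gauss (Y ℕ.+ m) (m ℕ.+ c) ∎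
    where
    E U : ℕ → Carrier
    E x = q ^ (x ℕ.* (x ℕ.+ c)) * gauss Y (x ℕ.+ c)
    U k = q ^ ((X ∸ k) ℕ.* (m ∸ k)) * gauss X k * gauss (Y ℕ.+ m) (Y ℕ.+ k)
    e : ∀ X m c → X ℕ.+ (m ℕ.+ c) ≡ m ℕ.+ (X ℕ.+ c)
    e = ℕSolver.solve-∀
    -- With r = X - x and k = x + l, the weight (r - l)(m - x - l) becomes (X - k)(m - k) and the
    -- bottom l + Y + x becomes Y + k. By `gauss-trinomial`, x is then left only in [k; x].
    expand : ∀ x → x ≤ m → gauss X x * gauss (X ℕ.+ Y ℕ.+ (m ∸ x)) (X ℕ.+ Y) ≈ ∑[ k < suc X ] (U k * gauss k x)
    expand x x≤m with offset x X
    ... | inj₂ X<x = trans (0-* _ (gauss-> X<x)) (sym (∑-zero (suc X) λ { k (s≤s k≤X) → *-0 _ (gauss-> (ℕ.≤-<-trans k≤X X<x)) }))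
    ... | inj₁ (r , ≡.refl) = begin
      gauss X x * gauss (X ℕ.+ Y ℕ.+ (m ∸ x)) (X ℕ.+ Y)
        ≡⟨ ≡.cong₂ (λ a b → gauss X x * gauss a b) (e₁ x r Y (m ∸ x)) (e₂ x r Y) ⟩
      gauss X x * gauss (r ℕ.+ (m ∸ x ℕ.+ (Y ℕ.+ x))) (r ℕ.+ (Y ℕ.+ x))
        ≈⟨ *-congˡ (vandermonde′ r (m ∸ x) (Y ℕ.+ x)) ⟨
      gauss X x * (∑[ l < suc r ] (q ^ ((r ∸ l) ℕ.* (m ∸ x ∸ l)) * gauss r l * gauss (m ∸ x ℕ.+ (Y ℕ.+ x)) (l ℕ.+ (Y ℕ.+ x))))
        ≈⟨ trans (*-∑ _ (suc r) _) (∑-cong (suc r) shift) ⟩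
      ∑[ l < suc r ] (U (x ℕ.+ l) * gauss (x ℕ.+ l) x)
        ≈⟨ +-identityˡ _ ⟨
      0# + (∑[ l < suc r ] (U (x ℕ.+ l) * gauss (x ℕ.+ l) x))
        ≈⟨ +-congʳ (∑-zero x λ k k<x → *-0 _ (gauss-> k<x)) ⟨
      (∑[ k < x ] (U k * gauss k x)) + (∑[ l < suc r ] (U (x ℕ.+ l) * gauss (x ℕ.+ l) x))
        ≈⟨ ∑-split x (suc r) _ ⟨
      ∑[ k < x ℕ.+ suc r ] (U k * gauss k x)
        ≡⟨ ≡.cong (λ n → ∑[ k < n ] (U k * gauss k x)) (ℕ.+-suc x r) ⟩
      ∑[ k < suc X ] (U k * gauss k x) ∎
      where
      e₁ : ∀ x r Y d → x ℕ.+ r ℕ.+ Y ℕ.+ d ≡ r ℕ.+ (d ℕ.+ (Y ℕ.+ x))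
      e₁ = ℕSolver.solve-∀
      e₂ : ∀ x r Y → x ℕ.+ r ℕ.+ Y ≡ r ℕ.+ (Y ℕ.+ x)
      e₂ = ℕSolver.solve-∀
      e₃ : ∀ Y d x → d ℕ.+ (Y ℕ.+ x) ≡ Y ℕ.+ (x ℕ.+ d)
      e₃ = ℕSolver.solve-∀
      e₄ : ∀ Y l x → l ℕ.+ (Y ℕ.+ x) ≡ Y ℕ.+ (x ℕ.+ l)
      e₄ = ℕSolver.solve-∀
      shift : ∀ l → gauss X x * (q ^ ((r ∸ l) ℕ.* (m ∸ x ∸ l)) * gauss r l * gauss (m ∸ x ℕ.+ (Y ℕ.+ x)) (l ℕ.+ (Y ℕ.+ x)))
                  ≈ U (x ℕ.+ l) * gauss (x ℕ.+ l) x
      shift l = begin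
        gauss X x * (q ^ ((r ∸ l) ℕ.* (m ∸ x ∸ l)) * gauss r l * gauss (m ∸ x ℕ.+ (Y ℕ.+ x)) (l ℕ.+ (Y ℕ.+ x)))
          ≡⟨ ≡.cong₂ (λ a b → gauss X x * (q ^ a * gauss r l * b))
               (≡.cong₂ ℕ._*_ (≡.sym (ℕ.[m+n]∸[m+o]≡n∸o x r l)) (ℕ.∸-+-assoc m x l))
               (≡.cong₂ gauss (≡.trans (e₃ Y (m ∸ x) x) (≡.cong (Y ℕ.+_) (ℕ.m+[n∸m]≡n x≤m))) (e₄ Y l x)) ⟩
        gauss X x * (q ^ e₀ * gauss r l * b)
          ≈⟨ solve 4 (λ g u h b → g :* (u :* h :* b) := u :* (g :* h) :* b) refl _ _ _ _ ⟩
        q ^ e₀ * (gauss X x * gauss r l) * b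
          ≡⟨ ≡.cong (λ n → q ^ e₀ * (gauss X x * gauss n l) * b) (ℕ.m+n∸m≡n x r) ⟨
        q ^ e₀ * (gauss X x * gauss (X ∸ x) l) * b
          ≈⟨ *-congʳ (*-congˡ (gauss-trinomial X x l)) ⟩
        q ^ e₀ * (gauss X (x ℕ.+ l) * gauss (x ℕ.+ l) x) * b
          ≈⟨ solve 4 (λ u g h b → u :* (g :* h) :* b := u :* g :* b :* h) refl _ _ _ _ ⟩
        U (x ℕ.+ l) * gauss (x ℕ.+ l) x ∎
        where
        e₀ = (X ∸ (x ℕ.+ l)) ℕ.* (m ∸ (x ℕ.+ l))
        b = gauss (Y ℕ.+ m) (Y ℕ.+ (x ℕ.+ l))
    -- Vandermonde needs the whole range x ≤ k. The available range x ≤ m is too short only for k >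
    -- m, where the prefactor is zero.
    inner : ∀ k → gauss (Y ℕ.+ m) (Y ℕ.+ k) * (∑[ x < suc m ] (q ^ (x ℕ.* (x ℕ.+ c)) * gauss k x * gauss Y (x ℕ.+ c)))
                ≈ gauss (Y ℕ.+ m) (Y ℕ.+ k) * gauss (k ℕ.+ Y) (k ℕ.+ c)
    inner k with ℕ.≤-<-connex k m
    ... | inj₁ k≤m = *-congˡ (trans (∑-truncate (s≤s k≤m) λ x k<x → 0-* _ (*-0 _ (gauss-> k<x)))
                                    (vandermonde gauss gauss-isPascal k Y c))
    ... | inj₂ m<k = trans (0-* _ g≈0) (sym (0-* _ g≈0))
      where g≈0 = gauss-> (ℕ.+-monoʳ-< Y m<k)
    contract : ∀ k → ∑[ x < suc m ] (E x * (U k * gauss k x))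
                   ≈ gauss (Y ℕ.+ m) (m ℕ.+ c) * (q ^ ((X ∸ k) ℕ.* (m ∸ k)) * gauss X k * gauss (m ℕ.+ c) (k ℕ.+ c))
    contract k = begin
      ∑[ x < suc m ] (E x * (U k * gauss k x))
        ≈⟨ ∑-cong (suc m) (λ x → solve 6 (λ u b v g h l → u :* b :* (v :* g :* h :* l) := v :* g :* h :* (u :* l :* b)) refl _ _ _ _ _ _) ⟩
      ∑[ x < suc m ] (U k * (q ^ (x ℕ.* (x ℕ.+ c)) * gauss k x * gauss Y (x ℕ.+ c)))
        ≈⟨ *-∑ (U k) (suc m) _ ⟨
      U k * (∑[ x < suc m ] (q ^ (x ℕ.* (x ℕ.+ c)) * gauss k x * gauss Y (x ℕ.+ c)))
        ≈⟨ trans (*-assoc _ _ _) (*-congˡ (trans (inner k) (gauss-exchange Y m k c))) ⟩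
      q ^ ((X ∸ k) ℕ.* (m ∸ k)) * gauss X k * (gauss (Y ℕ.+ m) (m ℕ.+ c) * gauss (m ℕ.+ c) (k ℕ.+ c))
        ≈⟨ solve 3 (λ u g h → u :* (g :* h) := g :* (u :* h)) refl _ _ _ ⟩
      gauss (Y ℕ.+ m) (m ℕ.+ c) * (q ^ ((X ∸ k) ℕ.* (m ∸ k)) * gauss X k * gauss (m ℕ.+ c) (k ℕ.+ c)) ∎

  -- Summation steps in the variable N = j + x

  -- `vandermonde` at c = 2j + 1. The hypothesis makes the range N < n long enough: from N = n on, N
  -- + j + 1 exceeds B.
  vandermonde-delay : ∀ A B n j → B ≤ n ℕ.+ j →
    q ^ (j ℕ.* suc j) * gauss (A ℕ.+ B) (A ℕ.+ (j ℕ.+ suc j))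
    ≈ ∑[ N < n ] (q ^ (N ℕ.* suc N) * (delay j (gauss A) N * gauss B (N ℕ.+ suc j)))
  vandermonde-delay A B n j B≤n+j = sym (begin
    ∑[ N < n ] (q ^ (N ℕ.* suc N) * (delay j (gauss A) N * gauss B (N ℕ.+ suc j)))
      ≈⟨ ∑-cong n (λ N → solve 3 (λ u d g → u :* (d :* g) := d :* (u :* g)) refl _ _ _) ⟩
    ∑[ N < n ] (delay j (gauss A) N * h N)
      ≈⟨ ∑-delay j n (suc A) (gauss A) h
           (λ N n≤N → *-0 _ (*-0 _ (gauss-> (B<N+suc-j N n≤N)))) (λ x A<x → 0-* _ (gauss-> A<x)) ⟩
    ∑[ x < suc A ] (gauss A x * h (j ℕ.+ x))
      ≈⟨ ∑-cong (suc A) shift ⟩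
    ∑[ x < suc A ] (q ^ (j ℕ.* suc j) * (q ^ (x ℕ.* (x ℕ.+ c)) * gauss A x * gauss B (x ℕ.+ c)))
      ≈⟨ *-∑ _ (suc A) _ ⟨
    q ^ (j ℕ.* suc j) * (∑[ x < suc A ] (q ^ (x ℕ.* (x ℕ.+ c)) * gauss A x * gauss B (x ℕ.+ c)))
      ≈⟨ *-congˡ (vandermonde gauss gauss-isPascal A B c) ⟩
    q ^ (j ℕ.* suc j) * gauss (A ℕ.+ B) (A ℕ.+ c) ∎)
    where
    c = j ℕ.+ suc j
    h : ℕ → Carrier
    h N = q ^ (N ℕ.* suc N) * gauss B (N ℕ.+ suc j)
    B<N+suc-j : ∀ N → n ≤ N → B < N ℕ.+ suc j
    B<N+suc-j N n≤N = ≡.subst (B <_) (≡.sym (ℕ.+-suc N j)) (s≤s (ℕ.≤-trans B≤n+j (ℕ.+-monoˡ-≤ j n≤N)))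
    shift : ∀ x → gauss A x * h (j ℕ.+ x)
                ≈ q ^ (j ℕ.* suc j) * (q ^ (x ℕ.* (x ℕ.+ c)) * gauss A x * gauss B (x ℕ.+ c))
    shift x = begin
      gauss A x * (q ^ ((j ℕ.+ x) ℕ.* suc (j ℕ.+ x)) * gauss B (j ℕ.+ x ℕ.+ suc j))
        ≈⟨ *-congˡ (*-cong (q^-+ (j ℕ.* suc j) (x ℕ.* (x ℕ.+ c)) (square-shift j x)) (reflexive (≡.cong (gauss B) (index-shift j x)))) ⟩
      gauss A x * (q ^ (j ℕ.* suc j) * q ^ (x ℕ.* (x ℕ.+ c)) * gauss B (x ℕ.+ c))
        ≈⟨ solve 4 (λ g u v h → g :* (u :* v :* h) := u :* (v :* g :* h)) refl _ _ _ _ ⟩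
      q ^ (j ℕ.* suc j) * (q ^ (x ℕ.* (x ℕ.+ c)) * gauss A x * gauss B (x ℕ.+ c)) ∎

  -- `burge` at m = N - j and c = 2j + 1. On the left j is present in the tops and in the bottoms,
  -- on the right only in the bottoms; the kernel that depends on N is free of j.
  burge-delay : ∀ X Y n N j → N < n →
    q ^ (j ℕ.* suc j) * (delay j (gauss (X ℕ.+ N ℕ.+ suc j)) N * gauss (Y ℕ.+ N ∸ j) (N ℕ.+ suc j))
    ≈ ∑[ M < n ] (q ^ (M ℕ.* suc M) * delay M (λ y → gauss (X ℕ.+ Y ℕ.+ y) (X ℕ.+ Y)) N
                  * (delay j (gauss X) M * gauss Y (M ℕ.+ suc j)))
  burge-delay X Y n N j N<n with offset j N
  ... | inj₂ N<j = trans (*-0 _ (0-* _ (delay-<-0 _ N<j))) (sym (∑-zero n vanish))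
    where
    vanish : ∀ M → M < n → q ^ (M ℕ.* suc M) * delay M (λ y → gauss (X ℕ.+ Y ℕ.+ y) (X ℕ.+ Y)) N
                           * (delay j (gauss X) M * gauss Y (M ℕ.+ suc j)) ≈ 0#
    vanish M _ with ℕ.≤-<-connex M N
    ... | inj₁ M≤N = *-0 _ (0-* _ (delay-<-0 _ (ℕ.≤-<-trans M≤N N<j)))
    ... | inj₂ N<M = 0-* _ (*-0 _ (delay-<-0 _ N<M))
  ... | inj₁ (m , ≡.refl) = begin
    q ^ (j ℕ.* suc j) * (delay j (gauss (X ℕ.+ (j ℕ.+ m) ℕ.+ suc j)) (j ℕ.+ m) * gauss (Y ℕ.+ (j ℕ.+ m) ∸ j) (j ℕ.+ m ℕ.+ suc j))
      ≡⟨ ≡.cong₂ (λ a b → q ^ (j ℕ.* suc j) * (a * b))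
           (≡.trans (delay-+ j _ m) (≡.cong (λ a → gauss a m) (e₁ X j m)))
           (≡.cong₂ gauss (≡.trans (≡.cong (_∸ j) (e₂ Y j m)) (ℕ.m+n∸m≡n j (Y ℕ.+ m))) (index-shift j m)) ⟩
    q ^ (j ℕ.* suc j) * (gauss (X ℕ.+ (m ℕ.+ c)) m * gauss (Y ℕ.+ m) (m ℕ.+ c))
      ≈⟨ *-congˡ (burge X Y m c) ⟨
    q ^ (j ℕ.* suc j) * (∑[ x < suc m ] (q ^ (x ℕ.* (x ℕ.+ c)) * gauss Y (x ℕ.+ c) * (gauss X x * K (m ∸ x))))
      ≈⟨ trans (*-∑ _ (suc m) _) (∑-cong< (suc m) shift) ⟩
    ∑[ x < suc m ] (gauss X x * h (j ℕ.+ x))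
      ≈⟨ ∑-delay j n (suc m) (gauss X) h
           (λ M n≤M → *-0 _ (0-* _ (*-0 _ (delay-<-0 K (ℕ.<-≤-trans N<n n≤M)))))
           (λ x m<x → *-0 _ (0-* _ (*-0 _ (delay-<-0 K (ℕ.+-monoʳ-< j m<x))))) ⟨
    ∑[ M < n ] (delay j (gauss X) M * h M)
      ≈⟨ ∑-cong n (λ M → solve 4 (λ d u k g → d :* (u :* k :* g) := u :* k :* (d :* g)) refl _ _ _ _) ⟩
    ∑[ M < n ] (q ^ (M ℕ.* suc M) * delay M K (j ℕ.+ m) * (delay j (gauss X) M * gauss Y (M ℕ.+ suc j))) ∎
    where
    c = j ℕ.+ suc j
    K h : ℕ → Carrier
    K y = gauss (X ℕ.+ Y ℕ.+ y) (X ℕ.+ Y)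
    h M = q ^ (M ℕ.* suc M) * delay M K (j ℕ.+ m) * gauss Y (M ℕ.+ suc j)
    e₁ : ∀ X j m → X ℕ.+ (j ℕ.+ m) ℕ.+ suc j ≡ X ℕ.+ (m ℕ.+ (j ℕ.+ suc j))
    e₁ = ℕSolver.solve-∀
    e₂ : ∀ Y j m → Y ℕ.+ (j ℕ.+ m) ≡ j ℕ.+ (Y ℕ.+ m)
    e₂ = ℕSolver.solve-∀
    delay-K : ∀ x → x ≤ m → delay (j ℕ.+ x) K (j ℕ.+ m) ≡ K (m ∸ x)
    delay-K x x≤m = ≡.trans (delay-+-cancel j x K m)
      (≡.trans (≡.cong (delay x K) (≡.sym (ℕ.m+[n∸m]≡n x≤m))) (delay-+ x K (m ∸ x)))
    shift : ∀ x → x < suc m → q ^ (j ℕ.* suc j) * (q ^ (x ℕ.* (x ℕ.+ c)) * gauss Y (x ℕ.+ c) * (gauss X x * K (m ∸ x)))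
                            ≈ gauss X x * h (j ℕ.+ x)
    shift x (s≤s x≤m) = begin
      q ^ (j ℕ.* suc j) * (q ^ (x ℕ.* (x ℕ.+ c)) * gauss Y (x ℕ.+ c) * (gauss X x * K (m ∸ x)))
        ≈⟨ solve 5 (λ u v g h k → u :* (v :* g :* (h :* k)) := h :* (u :* v :* k :* g)) refl _ _ _ _ _ ⟩
      gauss X x * (q ^ (j ℕ.* suc j) * q ^ (x ℕ.* (x ℕ.+ c)) * K (m ∸ x) * gauss Y (x ℕ.+ c))
        ≈⟨ *-congˡ (*-cong (*-cong (sym (q^-+ (j ℕ.* suc j) (x ℕ.* (x ℕ.+ c)) (square-shift j x)))
                                   (reflexive (≡.sym (delay-K x x≤m))))
                           (reflexive (≡.cong (gauss Y) (≡.sym (index-shift j x))))) ⟩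
      gauss X x * h (j ℕ.+ x) ∎

  -- Bailey's lemma relative to a = q with both parameters sent to infinity. It follows from
  -- `vandermonde` for 1/(q)_k, whose first argument is a dummy; hence the 0 in that position.
  bailey-limit : ∀ n M j → M < n →
    q ^ (j ℕ.* suc j) * (delay j iqfac M * iqfac (M ℕ.+ suc j))
    ≈ ∑[ m < n ] (q ^ (m ℕ.* suc m) * delay m iqfac M * (delay j iqfac m * iqfac (m ℕ.+ suc j)))
  bailey-limit n M j M<n with offset j M
  ... | inj₂ M<j = trans (*-0 _ (0-* _ (delay-<-0 _ M<j))) (sym (∑-zero n vanish))
    where
    vanish : ∀ m → m < n → q ^ (m ℕ.* suc m) * delay m iqfac M * (delay j iqfac m * iqfac (m ℕ.+ suc j)) ≈ 0#
    vanish m _ with ℕ.≤-<-connex m M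
    ... | inj₁ m≤M = *-0 _ (0-* _ (delay-<-0 _ (ℕ.≤-<-trans m≤M M<j)))
    ... | inj₂ M<m = 0-* _ (*-0 _ (delay-<-0 _ M<m))
  ... | inj₁ (t , ≡.refl) = begin
    q ^ (j ℕ.* suc j) * (delay j iqfac (j ℕ.+ t) * iqfac (j ℕ.+ t ℕ.+ suc j))
      ≡⟨ ≡.cong₂ (λ a b → q ^ (j ℕ.* suc j) * (a * iqfac b)) (delay-+ j iqfac t) (index-shift j t) ⟩
    q ^ (j ℕ.* suc j) * (iqfac t * iqfac (t ℕ.+ c))
      ≈⟨ *-congˡ (*-congˡ (vandermonde (λ _ → iqfac) iqfac-isPascal t 0 c)) ⟨
    q ^ (j ℕ.* suc j) * (iqfac t * (∑[ x < suc t ] (q ^ (x ℕ.* (x ℕ.+ c)) * gauss t x * iqfac (x ℕ.+ c))))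
      ≈⟨ trans (sym (*-assoc _ _ _)) (trans (*-∑ _ (suc t) _) (∑-cong (suc t) shift)) ⟩
    ∑[ x < suc t ] (iqfac x * h (j ℕ.+ x))
      ≈⟨ ∑-delay j n (suc t) iqfac h
           (λ m n≤m → *-0 _ (0-* _ (*-0 _ (delay-<-0 iqfac (ℕ.<-≤-trans M<n n≤m)))))
           (λ x t<x → *-0 _ (0-* _ (*-0 _ (delay-<-0 iqfac (ℕ.+-monoʳ-< j t<x))))) ⟨
    ∑[ m < n ] (delay j iqfac m * h m)
      ≈⟨ ∑-cong n (λ m → solve 4 (λ d u k g → d :* (u :* k :* g) := u :* k :* (d :* g)) refl _ _ _ _) ⟩
    ∑[ m < n ] (q ^ (m ℕ.* suc m) * delay m iqfac (j ℕ.+ t) * (delay j iqfac m * iqfac (m ℕ.+ suc j))) ∎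
    where
    c = j ℕ.+ suc j
    h : ℕ → Carrier
    h m = q ^ (m ℕ.* suc m) * delay m iqfac (j ℕ.+ t) * iqfac (m ℕ.+ suc j)
    shift : ∀ x → q ^ (j ℕ.* suc j) * iqfac t * (q ^ (x ℕ.* (x ℕ.+ c)) * gauss t x * iqfac (x ℕ.+ c)) ≈ iqfac x * h (j ℕ.+ x)
    shift x = begin
      q ^ (j ℕ.* suc j) * iqfac t * (q ^ (x ℕ.* (x ℕ.+ c)) * gauss t x * iqfac (x ℕ.+ c))
        ≈⟨ *-congˡ (*-congʳ (*-congˡ (gauss-delay t x))) ⟩
      q ^ (j ℕ.* suc j) * iqfac t * (q ^ (x ℕ.* (x ℕ.+ c)) * (qfac t * (iqfac x * delay x iqfac t)) * iqfac (x ℕ.+ c))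
        ≈⟨ solve 7 (λ u i v f k d l → u :* i :* (v :* (f :* (k :* d)) :* l) := f :* i :* (k :* (u :* v :* d :* l))) refl _ _ _ _ _ _ _ ⟩
      qfac t * iqfac t * (iqfac x * (q ^ (j ℕ.* suc j) * q ^ (x ℕ.* (x ℕ.+ c)) * delay x iqfac t * iqfac (x ℕ.+ c)))
        ≈⟨ trans (*-congʳ (qfac-iqfac t)) (*-identityˡ _) ⟩
      iqfac x * (q ^ (j ℕ.* suc j) * q ^ (x ℕ.* (x ℕ.+ c)) * delay x iqfac t * iqfac (x ℕ.+ c))
        ≈⟨ *-congˡ (*-cong (*-cong (sym (q^-+ (j ℕ.* suc j) (x ℕ.* (x ℕ.+ c)) (square-shift j x)))
                                   (reflexive (≡.sym (delay-+-cancel j x iqfac t))))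
                           (reflexive (≡.cong iqfac (≡.sym (index-shift j x))))) ⟩
      iqfac x * h (j ℕ.+ x) ∎

  -- The pentagonal sum

  -- unitCoeff j = (−1)^j q^{j(j−1)/2}
  unitCoeff : ℕ → Carrier
  unitCoeff zero    = 1#
  unitCoeff (suc j) = - (unitCoeff j * q ^ j)

  -- pentCoeff j = (−1)^j q^{j(3j+1)/2}
  pentCoeff : ℕ → Carrier
  pentCoeff zero    = 1#
  pentCoeff (suc j) = - (pentCoeff j * q ^ (j ℕ.+ (suc j ℕ.+ suc j)))

  pentCoeff-unitCoeff : ∀ j → pentCoeff j ≈ unitCoeff j * q ^ (j ℕ.* suc j)
  pentCoeff-unitCoeff zero    = sym (*-identityˡ 1#)
  pentCoeff-unitCoeff (suc j) = begin
    - (pentCoeff j * q ^ (j ℕ.+ (suc j ℕ.+ suc j)))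
      ≈⟨ -‿cong (*-cong (pentCoeff-unitCoeff j) (q^-+ j (suc j ℕ.+ suc j) ≡.refl)) ⟩
    - (unitCoeff j * q ^ (j ℕ.* suc j) * (q ^ j * q ^ (suc j ℕ.+ suc j)))
      ≈⟨ solve 4 (λ s u v w → :- (s :* u :* (v :* w)) := (:- (s :* v)) :* (u :* w)) refl _ _ _ _ ⟩
    - (unitCoeff j * q ^ j) * (q ^ (j ℕ.* suc j) * q ^ (suc j ℕ.+ suc j))
      ≈⟨ *-congˡ (q^-+ (j ℕ.* suc j) (suc j ℕ.+ suc j) (e j)) ⟨
    - (unitCoeff j * q ^ j) * q ^ (suc j ℕ.* suc (suc j)) ∎
    where
    e : ∀ j → suc j ℕ.* suc (suc j) ≡ j ℕ.* suc j ℕ.+ (suc j ℕ.+ suc j)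
    e = ℕSolver.solve-∀

  ∑-telescope : ∀ n (G : ℕ → Carrier) → ∑[ j < n ] (G j - G (suc j)) ≈ G 0 - G n
  ∑-telescope zero    G = sym (-‿inverseʳ (G 0))
  ∑-telescope (suc n) G = trans (+-congʳ (∑-telescope n G))
    (solve 3 (λ a b c → (a :- b) :+ (b :- c) := a :- c) refl (G 0) (G n) (G (suc n)))

  -- Summand of the unit Bailey pair relative to a = q: the sum over j is 1 for m = 0 and 0
  -- otherwise.
  unitTerm : ℕ → ℕ → Carrier
  unitTerm m j = unitCoeff j * (1# - q ^ (j ℕ.+ suc j)) * (delay j iqfac m * iqfac (m ℕ.+ suc j))

  -- (1 − u)(1 − q u² v) + u (1 − q u)(1 − v) = (1 − u v)(1 − q u²) with u = q^j and v = q^{m−j}.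
  unitTerm-telescopes : ∀ m j → let G = λ j → unitCoeff j * (1# - q ^ j) * (delay j iqfac m * iqfac (m ℕ.+ j)) in
                        (1# - q ^ m) * unitTerm m j ≈ G j - G (suc j)
  unitTerm-telescopes m j with offset j m
  ... | inj₂ m<j = trans (*-0 _ (*-0 _ (0-* _ (delay-<-0 iqfac m<j))))
    (sym (trans (+-cong (*-0 _ (0-* _ (delay-<-0 iqfac m<j)))
                        (-‿cong (*-0 _ (0-* _ (delay-<-0 iqfac (ℕ.m<n⇒m<1+n m<j))))))
                (trans (+-identityˡ _) -0#≈0#)))
  ... | inj₁ (x , ≡.refl) = begin
    (1# - q ^ (j ℕ.+ x)) * (s * (1# - q ^ (j ℕ.+ suc j)) * (delay j iqfac (j ℕ.+ x) * l))
      ≈⟨ *-cong (+-congˡ (-‿cong (q^-+ j x ≡.refl)))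
           (*-cong (*-congˡ (+-congˡ (-‿cong (q^-+ j (suc j) ≡.refl)))) (*-congʳ (reflexive (delay-+ j iqfac x)))) ⟩
    (1# - u * v) * (s * (1# - u * (q * u)) * (i * l))
      ≈⟨ solve 6 (λ q u v s i l → (𝟙 :- u :* v) :* (s :* (𝟙 :- u :* (q :* u)) :* (i :* l))
           := s :* (𝟙 :- u) :* (i :* (l :* (𝟙 :- u :* v :* (q :* u))))
              :- (:- (s :* u)) :* (𝟙 :- q :* u) :* ((i :* (𝟙 :- v)) :* l)) refl q u v s i l ⟩
    s * (1# - u) * (i * (l * (1# - u * v * (q * u)))) - - (s * u) * (1# - q * u) * (i * (1# - v) * l)
      ≈⟨ +-cong (*-congˡ (*-cong (reflexive (≡.sym (delay-+ j iqfac x))) l-step))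
                (-‿cong (*-congˡ (*-congʳ delay-step))) ⟩
    s * (1# - u) * (delay j iqfac (j ℕ.+ x) * iqfac (j ℕ.+ x ℕ.+ j)) - - (s * u) * (1# - q * u) * (delay (suc j) iqfac (j ℕ.+ x) * l) ∎
    where
    s = unitCoeff j
    u = q ^ j
    v = q ^ x
    i = iqfac x
    l = iqfac (j ℕ.+ x ℕ.+ suc j)
    l-step : l * (1# - u * v * (q * u)) ≈ iqfac (j ℕ.+ x ℕ.+ j)
    l-step = begin
      l * (1# - u * v * (q * u))
        ≈⟨ *-congˡ (+-congˡ (-‿cong (trans (q^-+ (j ℕ.+ x) (suc j) (≡.sym (ℕ.+-suc (j ℕ.+ x) j))) (*-congʳ (q^-+ j x ≡.refl))))) ⟨
      l * (1# - q ^ suc (j ℕ.+ x ℕ.+ j))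
        ≡⟨ ≡.cong (λ n → iqfac n * (1# - q ^ suc (j ℕ.+ x ℕ.+ j))) (ℕ.+-suc (j ℕ.+ x) j) ⟩
      iqfac (suc (j ℕ.+ x ℕ.+ j)) * (1# - q ^ suc (j ℕ.+ x ℕ.+ j))
        ≈⟨ iqfac-suc (j ℕ.+ x ℕ.+ j) ⟩
      iqfac (j ℕ.+ x ℕ.+ j) ∎
    delay-step : i * (1# - v) ≈ delay (suc j) iqfac (j ℕ.+ x)
    delay-step = trans (sym (iqfac-pred x))
      (reflexive (≡.trans (≡.sym (delay-+-cancel j 1 iqfac x)) (≡.cong (λ k → delay k iqfac (j ℕ.+ x)) (ℕ.+-comm j 1))))

  -- Only 1 - q^m times the sum telescopes, which says nothing at m = 0; so positive indices are
  -- treated here and zero separately. The end at j = 0 vanishes through 1 - q^0, the end at j = n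
  -- through 1/(q)_(m+1-n).
  unit-sum : ∀ n m → suc m < n → ∑ n (unitTerm (suc m)) ≈ 0#
  unit-sum n m m<n = begin
    ∑ n (unitTerm (suc m))
      ≈⟨ trans (*-congʳ (inv-inverse m)) (*-identityˡ _) ⟨
    inv m * (1# - q ^ suc m) * ∑ n (unitTerm (suc m))
      ≈⟨ trans (*-assoc _ _ _) (*-congˡ (trans (*-∑ _ n _) (∑-cong n (unitTerm-telescopes (suc m))))) ⟩
    inv m * (∑[ j < n ] (G j - G (suc j)))
      ≈⟨ *-congˡ (∑-telescope n G) ⟩
    inv m * (G 0 - G n)
      ≈⟨ *-0 _ (trans (+-cong (0-* _ (*-0 _ (-‿inverseʳ 1#)))
           (trans (-‿cong (*-0 _ (0-* _ (delay-<-0 iqfac m<n)))) -0#≈0#)) (+-identityˡ 0#)) ⟩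
    0# ∎
    where
    G : ℕ → Carrier
    G j = unitCoeff j * (1# - q ^ j) * (delay j iqfac (suc m) * iqfac (suc m ℕ.+ j))

  unit-sum-zero : ∀ n → ∑ (suc n) (unitTerm 0) ≈ 1#
  unit-sum-zero n = begin
    ∑ (suc n) (unitTerm 0)
      ≈⟨ ∑-head n (unitTerm 0) ⟩
    unitTerm 0 0 + (∑[ j < n ] unitTerm 0 (suc j))
      ≈⟨ +-congˡ (∑-zero n λ j _ → *-0 _ (zeroˡ _)) ⟩
    1# * (1# - q ^ 1) * (1# * iqfac 1) + 0#
      ≈⟨ trans (+-identityʳ _) (solve 2 (λ y i → 𝟙 :* (𝟙 :- y) :* (𝟙 :* i) := i :* (𝟙 :- y)) refl (q ^ 1) (iqfac 1)) ⟩
    iqfac 1 * (1# - q ^ 1)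
      ≈⟨ iqfac-suc 0 ⟩
    1# ∎

  -- Since j(3j+1)/2 = j(j-1)/2 + j² + j, one application of `bailey-limit` turns the sum into a
  -- combination of unit sums. Of these only m = 0 survives, with weight 1/(q)_M.
  pent-sum : ∀ n M → M < n →
    ∑[ j < n ] (pentCoeff j * (1# - q ^ (j ℕ.+ suc j)) * (delay j iqfac M * iqfac (M ℕ.+ suc j))) ≈ iqfac M
  pent-sum n@(suc n′) M M<n = begin
    ∑[ j < n ] (pentCoeff j * (1# - q ^ (j ℕ.+ suc j)) * (delay j iqfac M * iqfac (M ℕ.+ suc j)))
      ≈⟨ ∑-cong n expand ⟩
    ∑[ j < n ] ∑[ m < n ] (q ^ (m ℕ.* suc m) * delay m iqfac M * unitTerm m j)
      ≈⟨ trans (∑-swap n n _) (∑-cong n λ m → sym (*-∑ _ n _)) ⟩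
    ∑[ m < n ] (q ^ (m ℕ.* suc m) * delay m iqfac M * ∑ n (unitTerm m))
      ≈⟨ ∑-head n′ _ ⟩
    1# * iqfac M * ∑ n (unitTerm 0) + (∑[ m < n′ ] (q ^ (suc m ℕ.* suc (suc m)) * delay (suc m) iqfac M * ∑ n (unitTerm (suc m))))
      ≈⟨ +-cong (trans (*-cong (*-identityˡ _) (unit-sum-zero n′)) (*-identityʳ _))
                (∑-zero n′ λ m m<n′ → *-0 _ (unit-sum n m (s≤s m<n′))) ⟩
    iqfac M + 0#
      ≈⟨ +-identityʳ _ ⟩
    iqfac M ∎
    where
    expand : ∀ j → pentCoeff j * (1# - q ^ (j ℕ.+ suc j)) * (delay j iqfac M * iqfac (M ℕ.+ suc j))
                 ≈ ∑[ m < n ] (q ^ (m ℕ.* suc m) * delay m iqfac M * unitTerm m j)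
    expand j = begin
      pentCoeff j * (1# - q ^ (j ℕ.+ suc j)) * (delay j iqfac M * iqfac (M ℕ.+ suc j))
        ≈⟨ *-congʳ (*-congʳ (pentCoeff-unitCoeff j)) ⟩
      unitCoeff j * q ^ (j ℕ.* suc j) * (1# - q ^ (j ℕ.+ suc j)) * (delay j iqfac M * iqfac (M ℕ.+ suc j))
        ≈⟨ solve 4 (λ s u d i → s :* u :* d :* i := s :* d :* (u :* i)) refl _ _ _ _ ⟩
      unitCoeff j * (1# - q ^ (j ℕ.+ suc j)) * (q ^ (j ℕ.* suc j) * (delay j iqfac M * iqfac (M ℕ.+ suc j)))
        ≈⟨ *-congˡ (bailey-limit n M j M<n) ⟩
      unitCoeff j * (1# - q ^ (j ℕ.+ suc j)) * (∑[ m < n ] (q ^ (m ℕ.* suc m) * delay m iqfac M * (delay j iqfac m * iqfac (m ℕ.+ suc j))))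
        ≈⟨ trans (*-∑ _ n _) (∑-cong n λ m → solve 3 (λ s u d → s :* (u :* d) := u :* (s :* d)) refl _ _ _) ⟩
      ∑[ m < n ] (q ^ (m ℕ.* suc m) * delay m iqfac M * unitTerm m j) ∎

  -- The Bailey step for a pair of terms

  -- After M = j + x, multiplication by (q)_r (q)_(t+c) with c = 2j + 1 turns the four reciprocals
  -- into [r; x][t+c; x+c], a Vandermonde sum. For r → ∞ this becomes `bailey-limit`.
  bailey-finite : ∀ n r t j → j ℕ.+ t < n →
    ∑[ M < n ] (q ^ (M ℕ.* suc M) * (delay M iqfac (j ℕ.+ r) * delay M iqfac (j ℕ.+ t)) * (delay j iqfac M * iqfac (M ℕ.+ suc j)))
    ≈ q ^ (j ℕ.* suc j) * (iqfac r * iqfac t * iqfac (t ℕ.+ (j ℕ.+ suc j)) * iqfac (r ℕ.+ (j ℕ.+ suc j)) * qfac (r ℕ.+ (t ℕ.+ (j ℕ.+ suc j))))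
  bailey-finite n r t j j+t<n = begin
    ∑[ M < n ] (q ^ (M ℕ.* suc M) * (delay M iqfac (j ℕ.+ r) * delay M iqfac (j ℕ.+ t)) * (delay j iqfac M * iqfac (M ℕ.+ suc j)))
      ≈⟨ ∑-cong n (λ M → solve 4 (λ u k d g → u :* k :* (d :* g) := d :* (u :* k :* g)) refl _ _ _ _) ⟩
    ∑[ M < n ] (delay j iqfac M * h M)
      ≈⟨ ∑-delay j n (suc r) iqfac h
           (λ M n≤M → *-0 _ (0-* _ (*-0 _ (*-0 _ (delay-<-0 iqfac (ℕ.<-≤-trans j+t<n n≤M))))))
           (λ x r<x → *-0 _ (0-* _ (*-0 _ (0-* _ (delay-<-0 iqfac (ℕ.+-monoʳ-< j r<x)))))) ⟩
    ∑[ x < suc r ] (iqfac x * h (j ℕ.+ x))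
      ≈⟨ ∑-cong (suc r) shift ⟩
    ∑[ x < suc r ] (q ^ (j ℕ.* suc j) * (iqfac r * iqfac (t ℕ.+ c)) * (q ^ (x ℕ.* (x ℕ.+ c)) * gauss r x * gauss (t ℕ.+ c) (x ℕ.+ c)))
      ≈⟨ *-∑ _ (suc r) _ ⟨
    q ^ (j ℕ.* suc j) * (iqfac r * iqfac (t ℕ.+ c)) * (∑[ x < suc r ] (q ^ (x ℕ.* (x ℕ.+ c)) * gauss r x * gauss (t ℕ.+ c) (x ℕ.+ c)))
      ≈⟨ *-congˡ (vandermonde gauss gauss-isPascal r (t ℕ.+ c) c) ⟩
    q ^ (j ℕ.* suc j) * (iqfac r * iqfac (t ℕ.+ c)) * gauss (r ℕ.+ (t ℕ.+ c)) (r ℕ.+ c)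
      ≈⟨ *-congˡ gauss-eval ⟩
    q ^ (j ℕ.* suc j) * (iqfac r * iqfac (t ℕ.+ c)) * (qfac (r ℕ.+ (t ℕ.+ c)) * (iqfac (r ℕ.+ c) * iqfac t))
      ≈⟨ solve 6 (λ u a b f d e → u :* (a :* b) :* (f :* (d :* e)) := u :* (a :* e :* b :* d :* f)) refl _ _ _ _ _ _ ⟩
    q ^ (j ℕ.* suc j) * (iqfac r * iqfac t * iqfac (t ℕ.+ c) * iqfac (r ℕ.+ c) * qfac (r ℕ.+ (t ℕ.+ c))) ∎
    where
    c = j ℕ.+ suc j
    h : ℕ → Carrier
    h M = q ^ (M ℕ.* suc M) * (delay M iqfac (j ℕ.+ r) * delay M iqfac (j ℕ.+ t)) * iqfac (M ℕ.+ suc j)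
    gauss-eval : gauss (r ℕ.+ (t ℕ.+ c)) (r ℕ.+ c) ≈ qfac (r ℕ.+ (t ℕ.+ c)) * (iqfac (r ℕ.+ c) * iqfac t)
    gauss-eval = ≡.subst (λ k → gauss k (r ℕ.+ c) ≈ qfac k * (iqfac (r ℕ.+ c) * iqfac t)) (e r t c) (gauss-qfac (r ℕ.+ c) t)
      where
      e : ∀ r t c → r ℕ.+ c ℕ.+ t ≡ r ℕ.+ (t ℕ.+ c)
      e = ℕSolver.solve-∀
    shifted : ∀ x → gauss (t ℕ.+ c) (x ℕ.+ c) ≈ qfac (t ℕ.+ c) * (iqfac (x ℕ.+ c) * delay x iqfac t)
    shifted x = trans (gauss-delay (t ℕ.+ c) (x ℕ.+ c)) (*-congˡ (*-congˡ (reflexive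
      (≡.trans (≡.cong₂ (λ a b → delay a iqfac b) (ℕ.+-comm x c) (ℕ.+-comm t c)) (delay-+-cancel c x iqfac t)))))
    shift : ∀ x → iqfac x * h (j ℕ.+ x)
                ≈ q ^ (j ℕ.* suc j) * (iqfac r * iqfac (t ℕ.+ c)) * (q ^ (x ℕ.* (x ℕ.+ c)) * gauss r x * gauss (t ℕ.+ c) (x ℕ.+ c))
    shift x = sym (begin
      q ^ (j ℕ.* suc j) * (iqfac r * iqfac (t ℕ.+ c)) * (q ^ (x ℕ.* (x ℕ.+ c)) * gauss r x * gauss (t ℕ.+ c) (x ℕ.+ c))
        ≈⟨ *-congˡ (*-cong (*-congˡ (gauss-delay r x)) (shifted x)) ⟩
      q ^ (j ℕ.* suc j) * (iqfac r * iqfac (t ℕ.+ c)) *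
        (q ^ (x ℕ.* (x ℕ.+ c)) * (qfac r * (iqfac x * delay x iqfac r)) * (qfac (t ℕ.+ c) * (iqfac (x ℕ.+ c) * delay x iqfac t)))
        ≈⟨ solve 10 (λ u i k v f l d g m e → u :* (i :* k) :* (v :* (f :* (l :* d)) :* (g :* (m :* e)))
             := (f :* i) :* (g :* k) :* (l :* (u :* v :* (d :* e) :* m))) refl _ _ _ _ _ _ _ _ _ _ ⟩
      (qfac r * iqfac r) * (qfac (t ℕ.+ c) * iqfac (t ℕ.+ c)) *
        (iqfac x * (q ^ (j ℕ.* suc j) * q ^ (x ℕ.* (x ℕ.+ c)) * (delay x iqfac r * delay x iqfac t) * iqfac (x ℕ.+ c)))
        ≈⟨ trans (*-congʳ (trans (*-cong (qfac-iqfac r) (qfac-iqfac (t ℕ.+ c))) (*-identityˡ 1#))) (*-identityˡ _) ⟩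
      iqfac x * (q ^ (j ℕ.* suc j) * q ^ (x ℕ.* (x ℕ.+ c)) * (delay x iqfac r * delay x iqfac t) * iqfac (x ℕ.+ c))
        ≈⟨ *-congˡ (*-cong (*-cong (sym (q^-+ (j ℕ.* suc j) (x ℕ.* (x ℕ.+ c)) (square-shift j x)))
                                   (reflexive (≡.cong₂ _*_ (≡.sym (delay-+-cancel j x iqfac r)) (≡.sym (delay-+-cancel j x iqfac t)))))
                           (reflexive (≡.cong iqfac (≡.sym (index-shift j x))))) ⟩
      iqfac x * h (j ℕ.+ x) ∎)

  -- Writing 1/(q)_(r-1) as (1 - q^r)/(q)_r covers r = 0, where the binomial is zero.
  gauss-pred : ∀ r s → gauss (r ℕ.+ s) (suc s) ≈ qfac (r ℕ.+ s) * (iqfac (suc s) * (iqfac r * (1# - q ^ r)))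
  gauss-pred r s = trans (gauss-delay (r ℕ.+ s) (suc s)) (*-congˡ (*-congˡ (trans
    (reflexive (≡.trans (≡.cong₂ (λ a b → delay a iqfac b) (ℕ.+-comm 1 s) (ℕ.+-comm r s)) (delay-+-cancel s 1 iqfac r)))
    (iqfac-pred r))))

  -- Over common denominators the difference reduces to (1 - w v) - w (1 - v) = 1 - w, with w =
  -- q^(d+1) and v = q^r. For d = 2j the last factor is, up to q^(j²+j), the value of
  -- `bailey-finite`.
  gauss-antisym : ∀ r t d → let P = r ℕ.+ (t ℕ.+ d) in
    gauss P t * gauss (suc P) (t ℕ.+ suc d) - q ^ suc d * (gauss (suc P) t * gauss P (t ℕ.+ suc d))
    ≈ (1# - q ^ suc d) * qfac P * (iqfac r * iqfac t * iqfac (t ℕ.+ suc d) * iqfac (r ℕ.+ suc d) * qfac (suc P))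
  gauss-antisym r t d = begin
    gauss P t * gauss (suc P) (t ℕ.+ suc d) - q ^ suc d * (gauss (suc P) t * gauss P (t ℕ.+ suc d))
      ≈⟨ +-cong (*-cong g₁ g₂) (-‿cong (*-congˡ (*-cong g₃ g₄))) ⟩
    f * (i * (m * (1# - w * v))) * (f′ * (k * l)) - w * (f′ * (i * m) * (f * (k * (l * (1# - v)))))
      ≈⟨ solve 8 (λ f f′ i m k l w v →
           f :* (i :* (m :* (𝟙 :- w :* v))) :* (f′ :* (k :* l)) :- w :* (f′ :* (i :* m) :* (f :* (k :* (l :* (𝟙 :- v)))))
           := (𝟙 :- w) :* f :* (l :* i :* k :* m :* f′)) refl f f′ i m k l w v ⟩
    (1# - w) * f * (l * i * k * m * f′) ∎
    where
    P = r ℕ.+ (t ℕ.+ d)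
    f = qfac P
    f′ = qfac (suc P)
    i = iqfac t
    k = iqfac (t ℕ.+ suc d)
    l = iqfac r
    m = iqfac (r ℕ.+ suc d)
    w = q ^ suc d
    v = q ^ r
    e₁ : ∀ r t d → r ℕ.+ (t ℕ.+ d) ≡ t ℕ.+ (r ℕ.+ d)
    e₁ = ℕSolver.solve-∀
    e₂ : ∀ r t d → suc (r ℕ.+ (t ℕ.+ d)) ≡ t ℕ.+ suc d ℕ.+ r
    e₂ = ℕSolver.solve-∀
    e₃ : ∀ r t d → suc (r ℕ.+ (t ℕ.+ d)) ≡ t ℕ.+ (r ℕ.+ suc d)
    e₃ = ℕSolver.solve-∀
    g₁ : gauss P t ≈ f * (i * (m * (1# - w * v)))
    g₁ = begin
      gauss P t
        ≡⟨ ≡.cong (λ n → gauss n t) (e₁ r t d) ⟩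
      gauss (t ℕ.+ (r ℕ.+ d)) t
        ≈⟨ gauss-qfac t (r ℕ.+ d) ⟩
      qfac (t ℕ.+ (r ℕ.+ d)) * (i * iqfac (r ℕ.+ d))
        ≈⟨ *-cong (reflexive (≡.cong qfac (≡.sym (e₁ r t d)))) (*-congˡ (sym (iqfac-suc (r ℕ.+ d)))) ⟩
      f * (i * (iqfac (suc (r ℕ.+ d)) * (1# - q ^ suc (r ℕ.+ d))))
        ≈⟨ *-congˡ (*-congˡ (*-cong (reflexive (≡.cong iqfac (≡.sym (ℕ.+-suc r d))))
             (+-congˡ (-‿cong (q^-+ (suc d) r (≡.cong suc (ℕ.+-comm r d))))))) ⟩
      f * (i * (m * (1# - w * v))) ∎
    g₂ : gauss (suc P) (t ℕ.+ suc d) ≈ f′ * (k * l)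
    g₂ = ≡.subst (λ n → gauss n (t ℕ.+ suc d) ≈ qfac n * (k * l)) (≡.sym (e₂ r t d)) (gauss-qfac (t ℕ.+ suc d) r)
    g₃ : gauss (suc P) t ≈ f′ * (i * m)
    g₃ = ≡.subst (λ n → gauss n t ≈ qfac n * (i * m)) (≡.sym (e₃ r t d)) (gauss-qfac t (r ℕ.+ suc d))
    g₄ : gauss P (t ℕ.+ suc d) ≈ f * (k * (l * (1# - v)))
    g₄ = ≡.subst (λ n → gauss P n ≈ f * (iqfac n * (l * (1# - v)))) (≡.sym (ℕ.+-suc t d)) (gauss-pred r (t ℕ.+ d))

  -- The terms j and −1−j of the bilateral sum combine to a single product with the factor 1 − q^{2j+1}.
  bailey-antisym : ∀ P n N j → N < n →
    q ^ (j ℕ.* suc j) * (delay j (gauss P) N * gauss (suc P) (N ℕ.+ suc j)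
                         - q ^ (j ℕ.+ suc j) * (delay j (gauss (suc P)) N * gauss P (N ℕ.+ suc j)))
    ≈ ∑[ M < n ] (q ^ (M ℕ.* suc M) * (qfac P * (delay (N ℕ.+ M) iqfac P * delay M iqfac N))
                  * ((1# - q ^ (j ℕ.+ suc j)) * (delay j iqfac M * iqfac (M ℕ.+ suc j))))
  -- Unless j ≤ N and j ≤ P - N, both sides vanish. Otherwise t = N - j and r = P - N - j are the
  -- parameters of `bailey-finite`, and P = r + t + 2j.
  bailey-antisym P n N j N<n with offset N P | offset j N
  ... | _ | inj₂ N<j = trans (*-0 _ (trans (+-cong (0-* _ (delay-<-0 _ N<j)) (-‿cong (*-0 _ (0-* _ (delay-<-0 _ N<j)))))
                             (trans (+-identityˡ _) -0#≈0#)))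
                         (sym (∑-zero n vanish))
    where
    vanish : ∀ M → M < n → q ^ (M ℕ.* suc M) * (qfac P * (delay (N ℕ.+ M) iqfac P * delay M iqfac N))
                  * ((1# - q ^ (j ℕ.+ suc j)) * (delay j iqfac M * iqfac (M ℕ.+ suc j))) ≈ 0#
    vanish M _ with ℕ.≤-<-connex M N
    ... | inj₁ M≤N = *-0 _ (*-0 _ (0-* _ (delay-<-0 _ (ℕ.≤-<-trans M≤N N<j))))
    ... | inj₂ N<M = 0-* _ (*-0 _ (*-0 _ (*-0 _ (delay-<-0 _ N<M))))
  ... | inj₂ P<N | _ = trans (*-0 _ (trans (+-cong (*-0 _ (gauss-> (ℕ.<-≤-trans (s≤s P<N) (ℕ.≤-trans (s≤s (ℕ.m≤m+n N j)) (ℕ.≤-reflexive (≡.sym (ℕ.+-suc N j)))))))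
                                                   (-‿cong (*-0 _ (*-0 _ (gauss-> (ℕ.<-≤-trans P<N (ℕ.m≤m+n N (suc j))))))))
                             (trans (+-identityˡ _) -0#≈0#)))
                         (sym (∑-zero n λ M _ → 0-* _ (*-0 _ (*-0 _ (0-* _ (delay-<-0 _ (ℕ.<-≤-trans P<N (ℕ.m≤m+n N M))))))))
  ... | inj₁ (Q , ≡.refl) | inj₁ (t , ≡.refl) with offset j Q
  ...   | inj₂ Q<j = trans (*-0 _ (trans (+-cong (*-0 _ (gauss-> too-small))
                                                 (-‿cong (*-0 _ (*-0 _ (gauss-> (ℕ.<-trans (ℕ.n<1+n _) too-small))))))
                             (trans (+-identityˡ _) -0#≈0#)))
                         (sym (∑-zero n vanish))
    where
    too-small : suc (j ℕ.+ t ℕ.+ Q) < j ℕ.+ t ℕ.+ suc j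
    too-small = ≡.subst (_< j ℕ.+ t ℕ.+ suc j) (ℕ.+-suc (j ℕ.+ t) Q) (ℕ.+-monoʳ-< (j ℕ.+ t) (s≤s Q<j))
    vanish : ∀ M → M < n → q ^ (M ℕ.* suc M) * (qfac (j ℕ.+ t ℕ.+ Q) * (delay (j ℕ.+ t ℕ.+ M) iqfac (j ℕ.+ t ℕ.+ Q) * delay M iqfac (j ℕ.+ t)))
                  * ((1# - q ^ (j ℕ.+ suc j)) * (delay j iqfac M * iqfac (M ℕ.+ suc j))) ≈ 0#
    vanish M _ with ℕ.≤-<-connex M Q
    ... | inj₁ M≤Q = *-0 _ (*-0 _ (0-* _ (delay-<-0 _ (ℕ.≤-<-trans M≤Q Q<j))))
    ... | inj₂ Q<M = 0-* _ (*-0 _ (*-0 _ (0-* _ (delay-<-0 _ (ℕ.+-monoʳ-< (j ℕ.+ t) Q<M)))))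
  ...   | inj₁ (r , ≡.refl) = begin
    q ^ (j ℕ.* suc j) * (delay j (gauss P₀) (j ℕ.+ t) * gauss (suc P₀) (j ℕ.+ t ℕ.+ suc j)
                         - q ^ c * (delay j (gauss (suc P₀)) (j ℕ.+ t) * gauss P₀ (j ℕ.+ t ℕ.+ suc j)))
      ≈⟨ *-congˡ (reflexive (≡.trans (≡.cong₂ (λ a b → a * gauss (suc P₀) k - q ^ c * (b * gauss P₀ k)) (delay-+ j _ t) (delay-+ j _ t))
           (≡.trans
             (≡.cong (λ p → gauss p t * gauss (suc p) k - q ^ c * (gauss (suc p) t * gauss p k)) (e₁ j t r))
             (≡.cong₂ (λ k c → gauss P₁ t * gauss (suc P₁) k - q ^ c * (gauss (suc P₁) t * gauss P₁ k)) (e₂ j t) (ℕ.+-suc j j))))) ⟩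
    q ^ (j ℕ.* suc j) * (gauss P₁ t * gauss (suc P₁) (t ℕ.+ suc d) - q ^ suc d * (gauss (suc P₁) t * gauss P₁ (t ℕ.+ suc d)))
      ≈⟨ trans (*-congˡ (gauss-antisym r t d)) (solve 3 (λ u x y → u :* (x :* y) := x :* (u :* y)) refl _ _ _) ⟩
    (1# - q ^ suc d) * qfac P₁ * (q ^ (j ℕ.* suc j) * (iqfac r * iqfac t * iqfac (t ℕ.+ suc d) * iqfac (r ℕ.+ suc d) * qfac (suc P₁)))
      ≈⟨ *-cong (*-cong (reflexive (≡.cong (λ c → 1# - q ^ c) (≡.sym (ℕ.+-suc j j)))) (reflexive (≡.cong qfac (≡.sym (e₁ j t r)))))
           (reflexive (≡.cong₂ (λ c p → q ^ (j ℕ.* suc j) * (iqfac r * iqfac t * iqfac (t ℕ.+ c) * iqfac (r ℕ.+ c) * qfac p))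
              (≡.sym (ℕ.+-suc j j)) (e₃ j t r))) ⟩
    (1# - q ^ c) * qfac P₀ * (q ^ (j ℕ.* suc j) * (iqfac r * iqfac t * iqfac (t ℕ.+ c) * iqfac (r ℕ.+ c) * qfac (r ℕ.+ (t ℕ.+ c))))
      ≈⟨ *-congˡ (bailey-finite n r t j N<n) ⟨
    (1# - q ^ c) * qfac P₀ * (∑[ M < n ] (q ^ (M ℕ.* suc M) * (delay M iqfac (j ℕ.+ r) * delay M iqfac (j ℕ.+ t)) * (delay j iqfac M * iqfac (M ℕ.+ suc j))))
      ≈⟨ trans (*-∑ _ n _) (∑-cong n term) ⟩
    ∑[ M < n ] (q ^ (M ℕ.* suc M) * (qfac P₀ * (delay (j ℕ.+ t ℕ.+ M) iqfac P₀ * delay M iqfac (j ℕ.+ t)))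
                  * ((1# - q ^ (j ℕ.+ suc j)) * (delay j iqfac M * iqfac (M ℕ.+ suc j)))) ∎
    where
    c = j ℕ.+ suc j
    d = j ℕ.+ j
    k = j ℕ.+ t ℕ.+ suc j
    P₀ = j ℕ.+ t ℕ.+ (j ℕ.+ r)
    P₁ = r ℕ.+ (t ℕ.+ d)
    e₁ : ∀ j t r → j ℕ.+ t ℕ.+ (j ℕ.+ r) ≡ r ℕ.+ (t ℕ.+ (j ℕ.+ j))
    e₁ = ℕSolver.solve-∀
    e₂ : ∀ j t → j ℕ.+ t ℕ.+ suc j ≡ t ℕ.+ suc (j ℕ.+ j)
    e₂ = ℕSolver.solve-∀
    e₃ : ∀ j t r → suc (r ℕ.+ (t ℕ.+ (j ℕ.+ j))) ≡ r ℕ.+ (t ℕ.+ (j ℕ.+ suc j))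
    e₃ = ℕSolver.solve-∀
    term : ∀ M → (1# - q ^ c) * qfac P₀ * (q ^ (M ℕ.* suc M) * (delay M iqfac (j ℕ.+ r) * delay M iqfac (j ℕ.+ t)) * (delay j iqfac M * iqfac (M ℕ.+ suc j)))
               ≈ q ^ (M ℕ.* suc M) * (qfac P₀ * (delay (j ℕ.+ t ℕ.+ M) iqfac P₀ * delay M iqfac (j ℕ.+ t)))
                  * ((1# - q ^ (j ℕ.+ suc j)) * (delay j iqfac M * iqfac (M ℕ.+ suc j)))
    term M = trans (solve 6 (λ w f u a b z → w :* f :* (u :* (a :* b) :* z) := u :* (f :* (a :* b)) :* (w :* z)) refl _ _ _ _ _ _)
      (*-congʳ (*-congˡ (*-congˡ (*-congʳ (reflexive (≡.sym (delay-+-cancel (j ℕ.+ t) M iqfac (j ℕ.+ r))))))))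

  ∑-linear : ∀ c n f g → ∑ n f - c * ∑ n g ≈ ∑[ i < n ] (f i - c * g i)
  ∑-linear c zero    f g = trans (+-congˡ (trans (-‿cong (zeroʳ c)) -0#≈0#)) (+-identityˡ 0#)
  ∑-linear c (suc n) f g = trans
    (solve 5 (λ a x b y c → (a :+ x) :- c :* (b :+ y) := (a :- c :* b) :+ (x :- c :* y)) refl (∑ n f) (f n) (∑ n g) (g n) c)
    (+-congʳ (∑-linear c n f g))

  -- The three-step chain for the Borwein sum

  -- borweinCoeff j = (−1)^j q^{j(9j+7)/2}
  borweinCoeff : ℕ → Carrier
  borweinCoeff zero    = 1#
  borweinCoeff (suc j) = - (borweinCoeff j * q ^ (8 ℕ.+ 9 ℕ.* j))

  -- j(9j+7)/2 = j(3j+1)/2 + 3(j² + j): each summation step consumes one factor Q, and `pent-sum`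
  -- takes what remains.
  borweinCoeff-pentCoeff : ∀ j → let Q = q ^ (j ℕ.* suc j) in borweinCoeff j ≈ pentCoeff j * Q * Q * Q
  borweinCoeff-pentCoeff zero = sym (trans (*-identityʳ _) (trans (*-identityʳ _) (*-identityʳ _)))
  borweinCoeff-pentCoeff (suc j) = begin
    - (borweinCoeff j * q ^ (8 ℕ.+ 9 ℕ.* j))
      ≈⟨ -‿cong (*-cong (borweinCoeff-pentCoeff j) (trans (q^-+ (e ℕ.+ e ℕ.+ e) (j ℕ.+ e) (e₁ j))
           (*-congʳ (trans (q^-+ (e ℕ.+ e) e ≡.refl) (*-congʳ (q^-+ e e ≡.refl)))))) ⟩
    - (pentCoeff j * Q * Q * Q * (q ^ e * q ^ e * q ^ e * q ^ (j ℕ.+ e)))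
      ≈⟨ solve 4 (λ p Q u v → :- (p :* Q :* Q :* Q :* (u :* u :* u :* v)) := (:- (p :* v)) :* (Q :* u) :* (Q :* u) :* (Q :* u)) refl
           (pentCoeff j) Q (q ^ e) (q ^ (j ℕ.+ e)) ⟩
    pentCoeff (suc j) * (Q * q ^ e) * (Q * q ^ e) * (Q * q ^ e)
      ≈⟨ *-cong (*-cong (*-congˡ Q-suc) Q-suc) Q-suc ⟨
    pentCoeff (suc j) * Q′ * Q′ * Q′ ∎
    where
    e = suc j ℕ.+ suc j
    Q = q ^ (j ℕ.* suc j)
    Q′ = q ^ (suc j ℕ.* suc (suc j))
    e₁ : ∀ j → 8 ℕ.+ 9 ℕ.* j ≡ (suc j ℕ.+ suc j) ℕ.+ (suc j ℕ.+ suc j) ℕ.+ (suc j ℕ.+ suc j) ℕ.+ (j ℕ.+ (suc j ℕ.+ suc j))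
    e₁ = ℕSolver.solve-∀
    e₂ : ∀ j → suc j ℕ.* suc (suc j) ≡ j ℕ.* suc j ℕ.+ (suc j ℕ.+ suc j)
    e₂ = ℕSolver.solve-∀
    Q-suc : Q′ ≈ Q * q ^ e
    Q-suc = q^-+ (j ℕ.* suc j) e (e₂ j)

  burgeKernel : ℕ → ℕ → Carrier
  burgeKernel P y = gauss (P ℕ.+ suc P ℕ.+ y) (P ℕ.+ suc P)

  -- The second product is the first at -1 - j: the tops L + j and L - j become L - 1 - j and L + 1
  -- + j, while the bottoms N - j and N + j + 1 change places.
  antisym₁ : ℕ → ℕ → ℕ → Carrier
  antisym₁ L N j = delay j (gauss (L ℕ.+ j)) N * gauss (L ∸ j) (N ℕ.+ suc j)
                   - q ^ (j ℕ.+ suc j) * (delay j (gauss (suc L ℕ.+ j)) N * gauss (L ∸ suc j) (N ℕ.+ suc j))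

  antisym₂ : ℕ → ℕ → ℕ → Carrier
  antisym₂ P N j = delay j (gauss P) N * gauss (suc P) (N ℕ.+ suc j)
                   - q ^ (j ℕ.+ suc j) * (delay j (gauss (suc P)) N * gauss P (N ℕ.+ suc j))

  antisym-step₀ : ∀ L j → j < L →
    q ^ (j ℕ.* suc j) * (gauss (L ℕ.+ L) (L ℕ.+ (1 ℕ.+ 3 ℕ.* j)) - q ^ (j ℕ.+ suc j) * gauss (L ℕ.+ L) (L ℕ.+ (2 ℕ.+ 3 ℕ.* j)))
    ≈ ∑[ N < L ] (q ^ (N ℕ.* suc N) * antisym₁ L N j)
  antisym-step₀ L j j<L = begin
    Q * (gauss (L ℕ.+ L) (L ℕ.+ (1 ℕ.+ 3 ℕ.* j)) - w * gauss (L ℕ.+ L) (L ℕ.+ (2 ℕ.+ 3 ℕ.* j)))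
      ≡⟨ ≡.cong₂ (λ a b → Q * (a - w * b))
           (≡.cong₂ gauss (top₁ j<L) (e₁ L j)) (≡.cong₂ gauss (top₂ j<L) (e₂ L j)) ⟩
    Q * (gauss (L ℕ.+ j ℕ.+ (L ∸ j)) (L ℕ.+ j ℕ.+ c) - w * gauss (suc L ℕ.+ j ℕ.+ (L ∸ suc j)) (suc L ℕ.+ j ℕ.+ c))
      ≈⟨ solve 4 (λ Q a b w → Q :* (a :- w :* b) := Q :* a :- w :* (Q :* b)) refl Q _ _ w ⟩
    Q * gauss (L ℕ.+ j ℕ.+ (L ∸ j)) (L ℕ.+ j ℕ.+ c) - w * (Q * gauss (suc L ℕ.+ j ℕ.+ (L ∸ suc j)) (suc L ℕ.+ j ℕ.+ c))
      ≈⟨ +-cong (vandermonde-delay (L ℕ.+ j) (L ∸ j) L j (ℕ.≤-trans (ℕ.m∸n≤m L j) (ℕ.m≤m+n L j)))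
           (-‿cong (*-congˡ (vandermonde-delay (suc L ℕ.+ j) (L ∸ suc j) L j (ℕ.≤-trans (ℕ.m∸n≤m L (suc j)) (ℕ.m≤m+n L j))))) ⟩
    (∑[ N < L ] (q ^ (N ℕ.* suc N) * (delay j (gauss (L ℕ.+ j)) N * gauss (L ∸ j) (N ℕ.+ suc j))))
      - w * (∑[ N < L ] (q ^ (N ℕ.* suc N) * (delay j (gauss (suc L ℕ.+ j)) N * gauss (L ∸ suc j) (N ℕ.+ suc j))))
      ≈⟨ ∑-linear w L _ _ ⟩
    ∑[ N < L ] (q ^ (N ℕ.* suc N) * (delay j (gauss (L ℕ.+ j)) N * gauss (L ∸ j) (N ℕ.+ suc j))
                - w * (q ^ (N ℕ.* suc N) * (delay j (gauss (suc L ℕ.+ j)) N * gauss (L ∸ suc j) (N ℕ.+ suc j))))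
      ≈⟨ ∑-cong L (λ N → solve 4 (λ Q a b w → Q :* a :- w :* (Q :* b) := Q :* (a :- w :* b)) refl _ _ _ w) ⟩
    ∑[ N < L ] (q ^ (N ℕ.* suc N) * antisym₁ L N j) ∎
    where
    c = j ℕ.+ suc j
    Q = q ^ (j ℕ.* suc j)
    w = q ^ c
    top₁ : ∀ {L j} → j < L → L ℕ.+ L ≡ L ℕ.+ j ℕ.+ (L ∸ j)
    top₁ {L} {j} j<L = ≡.trans (≡.cong (L ℕ.+_) (≡.sym (ℕ.m+[n∸m]≡n (ℕ.<⇒≤ j<L)))) (≡.sym (ℕ.+-assoc L j _))
    top₂ : ∀ {L j} → j < L → L ℕ.+ L ≡ suc L ℕ.+ j ℕ.+ (L ∸ suc j)
    top₂ {L} {j} j<L = ≡.trans (≡.cong (L ℕ.+_) (≡.sym (ℕ.m+[n∸m]≡n j<L))) (≡.trans (≡.sym (ℕ.+-assoc L (suc j) _)) (≡.cong (ℕ._+ (L ∸ suc j)) (ℕ.+-suc L j)))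
    e₁ : ∀ L j → L ℕ.+ (1 ℕ.+ 3 ℕ.* j) ≡ L ℕ.+ j ℕ.+ (j ℕ.+ suc j)
    e₁ = ℕSolver.solve-∀
    e₂ : ∀ L j → L ℕ.+ (2 ℕ.+ 3 ℕ.* j) ≡ suc L ℕ.+ j ℕ.+ (j ℕ.+ suc j)
    e₂ = ℕSolver.solve-∀

  -- `burge-delay` asks for the tops X + N + j + 1 and Y + N - j; hence the form P + N + 1 for L,
  -- with (X, Y) = (P, P + 1) in the first product and (P + 1, P) in its partner. As X + Y = 2P + 1
  -- in both, the two receive the same kernel and stay paired.
  antisym-step₁ : ∀ n P N j → N < n →
    q ^ (j ℕ.* suc j) * antisym₁ (suc (P ℕ.+ N)) N j
    ≈ ∑[ M < n ] (q ^ (M ℕ.* suc M) * delay M (burgeKernel P) N * antisym₂ P M j)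
  antisym-step₁ n P N j N<n = begin
    Q * antisym₁ (suc (P ℕ.+ N)) N j
      ≡⟨ ≡.cong₂ (λ a b → Q * (delay j (gauss a) N * gauss (suc (P ℕ.+ N) ∸ j) (N ℕ.+ suc j)
                               - w * (delay j (gauss b) N * gauss (P ℕ.+ N ∸ j) (N ℕ.+ suc j))))
           (≡.sym (ℕ.+-suc (P ℕ.+ N) j)) (≡.cong suc (≡.sym (ℕ.+-suc (P ℕ.+ N) j))) ⟩
    Q * (delay j (gauss (P ℕ.+ N ℕ.+ suc j)) N * gauss (suc P ℕ.+ N ∸ j) (N ℕ.+ suc j)
         - w * (delay j (gauss (suc P ℕ.+ N ℕ.+ suc j)) N * gauss (P ℕ.+ N ∸ j) (N ℕ.+ suc j)))
      ≈⟨ solve 4 (λ Q a b w → Q :* (a :- w :* b) := Q :* a :- w :* (Q :* b)) refl Q _ _ w ⟩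
    Q * (delay j (gauss (P ℕ.+ N ℕ.+ suc j)) N * gauss (suc P ℕ.+ N ∸ j) (N ℕ.+ suc j))
      - w * (Q * (delay j (gauss (suc P ℕ.+ N ℕ.+ suc j)) N * gauss (P ℕ.+ N ∸ j) (N ℕ.+ suc j)))
      ≈⟨ +-cong (burge-delay P (suc P) n N j N<n) (-‿cong (*-congˡ (trans (burge-delay (suc P) P n N j N<n)
           (reflexive (≡.cong (λ s → ∑[ M < n ] (q ^ (M ℕ.* suc M) * delay M (λ y → gauss (s ℕ.+ y) s) N
                                                 * (delay j (gauss (suc P)) M * gauss P (M ℕ.+ suc j))))
             (≡.sym (ℕ.+-suc P P))))))) ⟩
    (∑[ M < n ] (q ^ (M ℕ.* suc M) * delay M (burgeKernel P) N * (delay j (gauss P) M * gauss (suc P) (M ℕ.+ suc j))))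
      - w * (∑[ M < n ] (q ^ (M ℕ.* suc M) * delay M (burgeKernel P) N * (delay j (gauss (suc P)) M * gauss P (M ℕ.+ suc j))))
      ≈⟨ ∑-linear w n _ _ ⟩
    ∑[ M < n ] (q ^ (M ℕ.* suc M) * delay M (burgeKernel P) N * (delay j (gauss P) M * gauss (suc P) (M ℕ.+ suc j))
                - w * (q ^ (M ℕ.* suc M) * delay M (burgeKernel P) N * (delay j (gauss (suc P)) M * gauss P (M ℕ.+ suc j))))
      ≈⟨ ∑-cong n (λ M → solve 4 (λ Q a b w → Q :* a :- w :* (Q :* b) := Q :* (a :- w :* b)) refl _ _ _ w) ⟩
    ∑[ M < n ] (q ^ (M ℕ.* suc M) * delay M (burgeKernel P) N * antisym₂ P M j) ∎
    where
    Q = q ^ (j ℕ.* suc j)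
    w = q ^ (j ℕ.+ suc j)

  chainWeight : ℕ → ℕ → ℕ → ℕ → Carrier
  chainWeight L N₁ N₂ N₃ =
    q ^ (N₁ ℕ.* suc N₁) * (q ^ (N₂ ℕ.* suc N₂) * delay N₂ (burgeKernel P) N₁)
    * (q ^ (N₃ ℕ.* suc N₃) * (qfac P * (delay (N₂ ℕ.+ N₃) iqfac P * delay N₃ iqfac N₂)))
    where P = L ∸ suc N₁

  borwein-term : ∀ L j → j < L →
    borweinCoeff j * (gauss (L ℕ.+ L) (L ℕ.+ (1 ℕ.+ 3 ℕ.* j)) - q ^ (j ℕ.+ suc j) * gauss (L ℕ.+ L) (L ℕ.+ (2 ℕ.+ 3 ℕ.* j)))
    ≈ ∑[ N₁ < L ] ∑[ N₂ < L ] ∑[ N₃ < L ]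
        (chainWeight L N₁ N₂ N₃ * (pentCoeff j * (1# - q ^ (j ℕ.+ suc j)) * (delay j iqfac N₃ * iqfac (N₃ ℕ.+ suc j))))
  borwein-term L j j<L = begin
    borweinCoeff j * T
      ≈⟨ *-congʳ (borweinCoeff-pentCoeff j) ⟩
    p * Q * Q * Q * T
      ≈⟨ trans (*-assoc _ _ _) (*-congˡ (antisym-step₀ L j j<L)) ⟩
    p * Q * Q * (∑[ N₁ < L ] (q ^ (N₁ ℕ.* suc N₁) * antisym₁ L N₁ j))
      ≈⟨ trans (*-∑ _ L _) (∑-cong< L step₁) ⟩
    ∑[ N₁ < L ] ∑[ N₂ < L ] (p * (q ^ (N₁ ℕ.* suc N₁) * (q ^ (N₂ ℕ.* suc N₂) * delay N₂ (burgeKernel (L ∸ suc N₁)) N₁)) * (Q * antisym₂ (L ∸ suc N₁) N₂ j))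
      ≈⟨ ∑-cong L (λ N₁ → ∑-cong< L (step₂ N₁)) ⟩
    ∑[ N₁ < L ] ∑[ N₂ < L ] ∑[ N₃ < L ]
        (chainWeight L N₁ N₂ N₃ * (p * w * (delay j iqfac N₃ * iqfac (N₃ ℕ.+ suc j)))) ∎
    where
    p = pentCoeff j
    Q = q ^ (j ℕ.* suc j)
    w = 1# - q ^ (j ℕ.+ suc j)
    T = gauss (L ℕ.+ L) (L ℕ.+ (1 ℕ.+ 3 ℕ.* j)) - q ^ (j ℕ.+ suc j) * gauss (L ℕ.+ L) (L ℕ.+ (2 ℕ.+ 3 ℕ.* j))
    step₁ : ∀ N₁ → N₁ < L → p * Q * Q * (q ^ (N₁ ℕ.* suc N₁) * antisym₁ L N₁ j)
            ≈ ∑[ N₂ < L ] (p * (q ^ (N₁ ℕ.* suc N₁) * (q ^ (N₂ ℕ.* suc N₂) * delay N₂ (burgeKernel (L ∸ suc N₁)) N₁)) * (Q * antisym₂ (L ∸ suc N₁) N₂ j))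
    step₁ N₁ N₁<L = begin
      p * Q * Q * (q ^ (N₁ ℕ.* suc N₁) * antisym₁ L N₁ j)
        ≈⟨ solve 4 (λ p Q u a → p :* Q :* Q :* (u :* a) := p :* Q :* u :* (Q :* a)) refl _ _ _ _ ⟩
      p * Q * q ^ (N₁ ℕ.* suc N₁) * (Q * antisym₁ L N₁ j)
        ≡⟨ ≡.cong (λ l → p * Q * q ^ (N₁ ℕ.* suc N₁) * (Q * antisym₁ l N₁ j))
             (≡.trans (≡.sym (ℕ.m∸n+n≡m N₁<L)) (ℕ.+-suc (L ∸ suc N₁) N₁)) ⟩
      p * Q * q ^ (N₁ ℕ.* suc N₁) * (Q * antisym₁ (suc (L ∸ suc N₁ ℕ.+ N₁)) N₁ j)
        ≈⟨ *-congˡ (antisym-step₁ L (L ∸ suc N₁) N₁ j N₁<L) ⟩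
      p * Q * q ^ (N₁ ℕ.* suc N₁) * (∑[ N₂ < L ] (q ^ (N₂ ℕ.* suc N₂) * delay N₂ (burgeKernel (L ∸ suc N₁)) N₁ * antisym₂ (L ∸ suc N₁) N₂ j))
        ≈⟨ trans (*-∑ _ L _) (∑-cong L λ N₂ → solve 5 (λ p Q u v a → p :* Q :* u :* (v :* a) := p :* (u :* v) :* (Q :* a)) refl _ _ _ _ _) ⟩
      ∑[ N₂ < L ] (p * (q ^ (N₁ ℕ.* suc N₁) * (q ^ (N₂ ℕ.* suc N₂) * delay N₂ (burgeKernel (L ∸ suc N₁)) N₁)) * (Q * antisym₂ (L ∸ suc N₁) N₂ j)) ∎
    step₂ : ∀ N₁ N₂ → N₂ < L → p * (q ^ (N₁ ℕ.* suc N₁) * (q ^ (N₂ ℕ.* suc N₂) * delay N₂ (burgeKernel (L ∸ suc N₁)) N₁)) * (Q * antisym₂ (L ∸ suc N₁) N₂ j)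
            ≈ ∑[ N₃ < L ] (chainWeight L N₁ N₂ N₃ * (p * w * (delay j iqfac N₃ * iqfac (N₃ ℕ.+ suc j))))
    step₂ N₁ N₂ N₂<L = trans (*-congˡ (bailey-antisym (L ∸ suc N₁) L N₂ j N₂<L)) (trans (*-∑ _ L _)
      (∑-cong L λ N₃ → solve 5 (λ p u v w i → p :* u :* (v :* (w :* i)) := u :* v :* (p :* w :* i)) refl _ _ _ _ _))

  borwein-chain : ∀ L →
    ∑[ j < L ] (borweinCoeff j * (gauss (L ℕ.+ L) (L ℕ.+ (1 ℕ.+ 3 ℕ.* j)) - q ^ (j ℕ.+ suc j) * gauss (L ℕ.+ L) (L ℕ.+ (2 ℕ.+ 3 ℕ.* j))))
    ≈ ∑[ N₁ < L ] ∑[ N₂ < L ] ∑[ N₃ < L ] (chainWeight L N₁ N₂ N₃ * iqfac N₃)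
  borwein-chain L = begin
    ∑[ j < L ] (borweinCoeff j * (gauss (L ℕ.+ L) (L ℕ.+ (1 ℕ.+ 3 ℕ.* j)) - q ^ (j ℕ.+ suc j) * gauss (L ℕ.+ L) (L ℕ.+ (2 ℕ.+ 3 ℕ.* j))))
      ≈⟨ ∑-cong< L (borwein-term L) ⟩
    ∑[ j < L ] ∑[ N₁ < L ] ∑[ N₂ < L ] ∑[ N₃ < L ] (chainWeight L N₁ N₂ N₃ * β j N₃)
      ≈⟨ ∑-swap L L _ ⟩
    ∑[ N₁ < L ] ∑[ j < L ] ∑[ N₂ < L ] ∑[ N₃ < L ] (chainWeight L N₁ N₂ N₃ * β j N₃)
      ≈⟨ ∑-cong L (λ N₁ → ∑-swap L L _) ⟩
    ∑[ N₁ < L ] ∑[ N₂ < L ] ∑[ j < L ] ∑[ N₃ < L ] (chainWeight L N₁ N₂ N₃ * β j N₃)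
      ≈⟨ ∑-cong L (λ N₁ → ∑-cong L λ N₂ → ∑-swap L L _) ⟩
    ∑[ N₁ < L ] ∑[ N₂ < L ] ∑[ N₃ < L ] ∑[ j < L ] (chainWeight L N₁ N₂ N₃ * β j N₃)
      ≈⟨ ∑-cong L (λ N₁ → ∑-cong L λ N₂ → ∑-cong< L λ N₃ N₃<L → trans (sym (*-∑ _ L _)) (*-congˡ (pent-sum L N₃ N₃<L))) ⟩
    ∑[ N₁ < L ] ∑[ N₂ < L ] ∑[ N₃ < L ] (chainWeight L N₁ N₂ N₃ * iqfac N₃) ∎
    where
    β : ℕ → ℕ → Carrier
    β j N₃ = pentCoeff j * (1# - q ^ (j ℕ.+ suc j)) * (delay j iqfac N₃ * iqfac (N₃ ℕ.+ suc j))

  -- The triple sum in the variables n₁, n₂, n₃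

  -- The delay vanishes unless N₁ + N₂ + N₃ < L, which encodes the range of summation.
  multiFactor : ℕ → ℕ → ℕ → ℕ → Carrier
  multiFactor L N₁ N₂ N₃ =
    q ^ (N₁ ℕ.* N₁ ℕ.+ N₂ ℕ.* N₂ ℕ.+ N₃ ℕ.* N₃ ℕ.+ N₁ ℕ.+ N₂ ℕ.+ N₃)
    * qfac (L ∸ N₁ ∸ 1) * qfac (2 ℕ.* L ∸ N₁ ∸ N₂ ∸ 1) * iqfac (2 ℕ.* L ∸ 2 ℕ.* N₁ ∸ 1)
    * delay (suc (N₁ ℕ.+ N₂ ℕ.+ N₃)) iqfac L

  multiFactor-0 : ∀ L N₁ N₂ N₃ → L ≤ N₁ ℕ.+ N₂ ℕ.+ N₃ → multiFactor L N₁ N₂ N₃ ≈ 0#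
  multiFactor-0 L N₁ N₂ N₃ L≤N = *-0 _ (delay-<-0 iqfac (s≤s L≤N))

  -- Here 2L - 2N₁ - 1 = 2P + 1 and 2L - N₁ - N₂ - 1 = 2P + 1 + (N₁ - N₂): the two factorials with
  -- 2L in the theorem are the top and one bottom part of the kernel, and the other bottom part will
  -- be 1/(q)_(n₁).
  delay-burgeKernel : ∀ P N₁ N₂ → let L = suc (P ℕ.+ N₁) in
    delay N₂ (burgeKernel P) N₁
    ≈ qfac (2 ℕ.* L ∸ N₁ ∸ N₂ ∸ 1) * iqfac (2 ℕ.* L ∸ 2 ℕ.* N₁ ∸ 1) * delay N₂ iqfac N₁
  delay-burgeKernel P N₁ N₂ with offset N₂ N₁
  ... | inj₂ N₁<N₂ = trans (delay-<-0 _ N₁<N₂) (sym (*-0 _ (delay-<-0 _ N₁<N₂)))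
  ... | inj₁ (n , ≡.refl) = begin
    delay N₂ (burgeKernel P) (N₂ ℕ.+ n)
      ≡⟨ delay-+ N₂ (burgeKernel P) n ⟩
    gauss (P ℕ.+ suc P ℕ.+ n) (P ℕ.+ suc P)
      ≈⟨ gauss-qfac (P ℕ.+ suc P) n ⟩
    qfac (P ℕ.+ suc P ℕ.+ n) * (iqfac (P ℕ.+ suc P) * iqfac n)
      ≡⟨ ≡.cong₂ (λ a b → qfac a * (iqfac b * iqfac n)) a≡ b≡ ⟨
    qfac a * (iqfac b * iqfac n)
      ≈⟨ *-assoc _ _ _ ⟨
    qfac a * iqfac b * iqfac n
      ≡⟨ ≡.cong (qfac a * iqfac b *_) (delay-+ N₂ iqfac n) ⟨
    qfac a * iqfac b * delay N₂ iqfac (N₂ ℕ.+ n) ∎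
    where
    L = suc (P ℕ.+ (N₂ ℕ.+ n))
    a = 2 ℕ.* L ∸ (N₂ ℕ.+ n) ∸ N₂ ∸ 1
    b = 2 ℕ.* L ∸ 2 ℕ.* (N₂ ℕ.+ n) ∸ 1
    e₁ : ∀ P N₂ n → 2 ℕ.* suc (P ℕ.+ (N₂ ℕ.+ n)) ≡ (N₂ ℕ.+ n ℕ.+ N₂ ℕ.+ 1) ℕ.+ (P ℕ.+ suc P ℕ.+ n)
    e₁ = ℕSolver.solve-∀
    e₂ : ∀ P N → 2 ℕ.* suc (P ℕ.+ N) ≡ (2 ℕ.* N ℕ.+ 1) ℕ.+ (P ℕ.+ suc P)
    e₂ = ℕSolver.solve-∀
    a≡ : a ≡ P ℕ.+ suc P ℕ.+ n
    a≡ = ≡.trans (≡.cong (_∸ 1) (ℕ.∸-+-assoc (2 ℕ.* L) (N₂ ℕ.+ n) N₂))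
      (≡.trans (ℕ.∸-+-assoc (2 ℕ.* L) (N₂ ℕ.+ n ℕ.+ N₂) 1)
      (≡.trans (≡.cong (_∸ (N₂ ℕ.+ n ℕ.+ N₂ ℕ.+ 1)) (e₁ P N₂ n)) (ℕ.m+n∸m≡n (N₂ ℕ.+ n ℕ.+ N₂ ℕ.+ 1) _)))
    b≡ : b ≡ P ℕ.+ suc P
    b≡ = ≡.trans (ℕ.∸-+-assoc (2 ℕ.* L) (2 ℕ.* (N₂ ℕ.+ n)) 1)
      (≡.trans (≡.cong (_∸ (2 ℕ.* (N₂ ℕ.+ n) ℕ.+ 1)) (e₂ P (N₂ ℕ.+ n))) (ℕ.m+n∸m≡n (2 ℕ.* (N₂ ℕ.+ n) ℕ.+ 1) _))

  -- With P = L - N₁ - 1, the factors (q)_P and 1/(q)_(P-N₂-N₃) of the Bailey step are the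
  -- factorials with a single L in the theorem. The delays kept apart on the right turn into
  -- 1/(q)_(n₁) and 1/(q)_(n₂).
  chainWeight-multiFactor : ∀ L N₁ N₂ N₃ → N₁ < L →
    chainWeight L N₁ N₂ N₃ ≈ multiFactor L N₁ N₂ N₃ * delay N₂ iqfac N₁ * delay N₃ iqfac N₂
  chainWeight-multiFactor L N₁ N₂ N₃ N₁<L = ≡.subst
    (λ l → chainWeight l N₁ N₂ N₃ ≈ multiFactor l N₁ N₂ N₃ * delay N₂ iqfac N₁ * delay N₃ iqfac N₂)
    (≡.sym L≡) (begin
    q ^ (N₁ ℕ.* suc N₁) * (q ^ (N₂ ℕ.* suc N₂) * delay N₂ (burgeKernel (P ℕ.+ N₁ ∸ N₁)) N₁)
      * (q ^ (N₃ ℕ.* suc N₃) * (qfac (P ℕ.+ N₁ ∸ N₁) * (delay (N₂ ℕ.+ N₃) iqfac (P ℕ.+ N₁ ∸ N₁) * delay N₃ iqfac N₂)))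
      ≡⟨ ≡.cong (λ P → q ^ (N₁ ℕ.* suc N₁) * (q ^ (N₂ ℕ.* suc N₂) * delay N₂ (burgeKernel P) N₁)
                 * (q ^ (N₃ ℕ.* suc N₃) * (qfac P * (delay (N₂ ℕ.+ N₃) iqfac P * delay N₃ iqfac N₂)))) (ℕ.m+n∸n≡m P N₁) ⟩
    q ^ (N₁ ℕ.* suc N₁) * (q ^ (N₂ ℕ.* suc N₂) * delay N₂ (burgeKernel P) N₁)
      * (q ^ (N₃ ℕ.* suc N₃) * (qfac P * (delay (N₂ ℕ.+ N₃) iqfac P * delay N₃ iqfac N₂)))
      ≈⟨ *-congʳ (*-congˡ (*-congˡ (delay-burgeKernel P N₁ N₂))) ⟩
    q ^ (N₁ ℕ.* suc N₁) * (q ^ (N₂ ℕ.* suc N₂) * (f * g * delay N₂ iqfac N₁))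
      * (q ^ (N₃ ℕ.* suc N₃) * (qfac P * (delay (N₂ ℕ.+ N₃) iqfac P * delay N₃ iqfac N₂)))
      ≈⟨ solve 9 (λ x y z f g d p k e → x :* (y :* (f :* g :* d)) :* (z :* (p :* (k :* e)))
           := x :* y :* z :* p :* f :* g :* k :* d :* e) refl _ _ _ f g _ _ _ _ ⟩
    q ^ (N₁ ℕ.* suc N₁) * q ^ (N₂ ℕ.* suc N₂) * q ^ (N₃ ℕ.* suc N₃) * qfac P * f * g * delay (N₂ ℕ.+ N₃) iqfac P
      * delay N₂ iqfac N₁ * delay N₃ iqfac N₂
      ≈⟨ *-congʳ (*-congʳ (*-cong (*-congʳ (*-congʳ (*-cong (sym q-power) (reflexive (≡.cong qfac (≡.sym P≡)))))) (reflexive (≡.sym delay≡)))) ⟩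
    multiFactor l N₁ N₂ N₃ * delay N₂ iqfac N₁ * delay N₃ iqfac N₂ ∎)
    where
    P = L ∸ suc N₁
    l = suc (P ℕ.+ N₁)
    f = qfac (2 ℕ.* l ∸ N₁ ∸ N₂ ∸ 1)
    g = iqfac (2 ℕ.* l ∸ 2 ℕ.* N₁ ∸ 1)
    L≡ : L ≡ l
    L≡ = ≡.trans (≡.sym (ℕ.m∸n+n≡m N₁<L)) (ℕ.+-suc P N₁)
    P≡ : l ∸ N₁ ∸ 1 ≡ P
    P≡ = ≡.trans (≡.cong (_∸ 1) (ℕ.m+n∸n≡m (suc P) N₁)) ≡.refl
    delay≡ : delay (suc (N₁ ℕ.+ N₂ ℕ.+ N₃)) iqfac l ≡ delay (N₂ ℕ.+ N₃) iqfac P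
    delay≡ = ≡.trans (≡.cong₂ (λ a b → delay a iqfac b) (ℕ.+-assoc N₁ N₂ N₃) (ℕ.+-comm P N₁)) (delay-+-cancel N₁ (N₂ ℕ.+ N₃) iqfac P)
    e : ∀ a b c → a ℕ.* a ℕ.+ b ℕ.* b ℕ.+ c ℕ.* c ℕ.+ a ℕ.+ b ℕ.+ c ≡ a ℕ.* suc a ℕ.+ b ℕ.* suc b ℕ.+ c ℕ.* suc c
    e = ℕSolver.solve-∀
    q-power : q ^ (N₁ ℕ.* N₁ ℕ.+ N₂ ℕ.* N₂ ℕ.+ N₃ ℕ.* N₃ ℕ.+ N₁ ℕ.+ N₂ ℕ.+ N₃)
              ≈ q ^ (N₁ ℕ.* suc N₁) * q ^ (N₂ ℕ.* suc N₂) * q ^ (N₃ ℕ.* suc N₃)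
    q-power = trans (q^-+ (N₁ ℕ.* suc N₁ ℕ.+ N₂ ℕ.* suc N₂) (N₃ ℕ.* suc N₃) (e N₁ N₂ N₃)) (*-congʳ (q^-+ (N₁ ℕ.* suc N₁) (N₂ ℕ.* suc N₂) ≡.refl))

  multiTerm : ℕ → ℕ → ℕ → ℕ → Carrier
  multiTerm L n₁ n₂ n₃ =
    multiFactor L (n₁ ℕ.+ n₂ ℕ.+ n₃) (n₂ ℕ.+ n₃) n₃ * iqfac n₁ * iqfac n₂ * iqfac n₃

  multiTerm-< : ∀ L n₁ n₂ n₃ → let N₁ = n₁ ℕ.+ n₂ ℕ.+ n₃; N₂ = n₂ ℕ.+ n₃; N₃ = n₃ in
    N₁ ℕ.+ N₂ ℕ.+ N₃ < L →
    multiTerm L n₁ n₂ n₃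
    ≈ q ^ (N₁ ℕ.* N₁ ℕ.+ N₂ ℕ.* N₂ ℕ.+ N₃ ℕ.* N₃ ℕ.+ N₁ ℕ.+ N₂ ℕ.+ N₃)
      * qfac (L ∸ N₁ ∸ 1) * qfac (2 ℕ.* L ∸ N₁ ∸ N₂ ∸ 1) * iqfac (2 ℕ.* L ∸ 2 ℕ.* N₁ ∸ 1)
      * iqfac (L ∸ N₁ ∸ N₂ ∸ N₃ ∸ 1) * iqfac n₁ * iqfac n₂ * iqfac n₃
  multiTerm-< L n₁ n₂ n₃ N<L = *-congʳ (*-congʳ (*-congʳ (*-congˡ (reflexive delay≡))))
    where
    N₁ = n₁ ℕ.+ n₂ ℕ.+ n₃
    N₂ = n₂ ℕ.+ n₃
    N = N₁ ℕ.+ N₂ ℕ.+ n₃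
    index : L ∸ N₁ ∸ N₂ ∸ n₃ ∸ 1 ≡ L ∸ suc N
    index = ≡.trans (≡.cong (λ a → a ∸ n₃ ∸ 1) (ℕ.∸-+-assoc L N₁ N₂))
      (≡.trans (≡.cong (_∸ 1) (ℕ.∸-+-assoc L (N₁ ℕ.+ N₂) n₃))
      (≡.trans (ℕ.∸-+-assoc L N 1) (≡.cong (L ∸_) (ℕ.+-comm N 1))))
    delay≡ : delay (suc N) iqfac L ≡ iqfac (L ∸ N₁ ∸ N₂ ∸ n₃ ∸ 1)
    delay≡ = ≡.trans (≡.cong (delay (suc N) iqfac) (≡.sym (ℕ.m+[n∸m]≡n N<L)))
      (≡.trans (delay-+ (suc N) iqfac (L ∸ suc N)) (≡.cong iqfac (≡.sym index)))

  multiTerm-≥ : ∀ L n₁ n₂ n₃ → L ≤ (n₁ ℕ.+ n₂ ℕ.+ n₃) ℕ.+ (n₂ ℕ.+ n₃) ℕ.+ n₃ → multiTerm L n₁ n₂ n₃ ≈ 0#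
  multiTerm-≥ L n₁ n₂ n₃ L≤N = 0-* _ (0-* _ (0-* _ (multiFactor-0 L (n₁ ℕ.+ n₂ ℕ.+ n₃) (n₂ ℕ.+ n₃) n₃ L≤N)))

  -- A delayed 1/(q) in N₁ - N₂ or N₂ - N₃ is the restriction to N₁ ≥ N₂ ≥ N₃. The substitution N₁ =
  -- N₂ + n₁ shifts by N₂, so N₁ has to be the innermost variable, which explains the two reversals.
  -- The bound L is kept because `multiFactor` is zero once N₁ + N₂ + N₃ reaches L.
  chain-reindex : ∀ L →
    ∑[ N₁ < L ] ∑[ N₂ < L ] ∑[ N₃ < L ] (chainWeight L N₁ N₂ N₃ * iqfac N₃)
    ≈ ∑[ n₁ < L ] ∑[ n₂ < L ] ∑[ n₃ < L ] multiTerm L n₁ n₂ n₃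
  chain-reindex L = begin
    ∑[ N₁ < L ] ∑[ N₂ < L ] ∑[ N₃ < L ] (chainWeight L N₁ N₂ N₃ * iqfac N₃)
      ≈⟨ ∑-cong< L (λ N₁ N₁<L → ∑-cong L λ N₂ → ∑-cong L λ N₃ →
           trans (*-congʳ (chainWeight-multiFactor L N₁ N₂ N₃ N₁<L))
             (solve 4 (λ g d e i → g :* d :* e :* i := e :* (d :* (g :* i))) refl _ _ _ _)) ⟩
    ∑[ N₁ < L ] ∑[ N₂ < L ] ∑[ N₃ < L ] (delay N₃ iqfac N₂ * (delay N₂ iqfac N₁ * H N₁ N₂ N₃))
      ≈⟨ ∑-reverse _ ⟩
    ∑[ N₃ < L ] ∑[ N₂ < L ] ∑[ N₁ < L ] (delay N₃ iqfac N₂ * (delay N₂ iqfac N₁ * H N₁ N₂ N₃))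
      ≈⟨ ∑-cong L (λ N₃ → ∑-cong L λ N₂ → trans (sym (*-∑ _ L _)) (*-congˡ (inner N₃ N₂))) ⟩
    ∑[ n₃ < L ] ∑[ N₂ < L ] (delay n₃ iqfac N₂ * (∑[ n₁ < L ] (iqfac n₁ * H (N₂ ℕ.+ n₁) N₂ n₃)))
      ≈⟨ ∑-cong L middle ⟩
    ∑[ n₃ < L ] ∑[ n₂ < L ] (iqfac n₂ * (∑[ n₁ < L ] (iqfac n₁ * H (n₃ ℕ.+ n₂ ℕ.+ n₁) (n₃ ℕ.+ n₂) n₃)))
      ≈⟨ ∑-cong L (λ n₃ → ∑-cong L λ n₂ → trans (*-∑ _ L _) (∑-cong L (term n₃ n₂))) ⟩
    ∑[ n₃ < L ] ∑[ n₂ < L ] ∑[ n₁ < L ] multiTerm L n₁ n₂ n₃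
      ≈⟨ ∑-reverse _ ⟩
    ∑[ n₁ < L ] ∑[ n₂ < L ] ∑[ n₃ < L ] multiTerm L n₁ n₂ n₃ ∎
    where
    H : ℕ → ℕ → ℕ → Carrier
    H N₁ N₂ N₃ = multiFactor L N₁ N₂ N₃ * iqfac N₃
    H-0 : ∀ N₁ N₂ N₃ → L ≤ N₁ ℕ.+ N₂ ℕ.+ N₃ → H N₁ N₂ N₃ ≈ 0#
    H-0 N₁ N₂ N₃ L≤N = 0-* _ (multiFactor-0 L N₁ N₂ N₃ L≤N)
    ∑-reverse : ∀ (f : ℕ → ℕ → ℕ → Carrier) →
                ∑[ a < L ] ∑[ b < L ] ∑[ c < L ] f a b c ≈ ∑[ c < L ] ∑[ b < L ] ∑[ a < L ] f a b c
    ∑-reverse f = trans (∑-cong L λ a → ∑-swap L L (f a)) (trans (∑-swap L L _)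
      (∑-cong L λ c → ∑-swap L L λ a b → f a b c))
    inner : ∀ N₃ N₂ → ∑[ N₁ < L ] (delay N₂ iqfac N₁ * H N₁ N₂ N₃) ≈ ∑[ n₁ < L ] (iqfac n₁ * H (N₂ ℕ.+ n₁) N₂ N₃)
    inner N₃ N₂ = ∑-delay N₂ L L iqfac (λ N₁ → H N₁ N₂ N₃)
      (λ N₁ L≤N₁ → *-0 _ (H-0 N₁ N₂ N₃ (ℕ.m≤n⇒m≤n+o N₃ (ℕ.m≤n⇒m≤n+o N₂ L≤N₁))))
      (λ n₁ L≤n₁ → *-0 _ (H-0 (N₂ ℕ.+ n₁) N₂ N₃ (ℕ.m≤n⇒m≤n+o N₃ (ℕ.m≤n⇒m≤n+o N₂ (ℕ.m≤n⇒m≤o+n N₂ L≤n₁)))))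
    middle : ∀ n₃ → ∑[ N₂ < L ] (delay n₃ iqfac N₂ * (∑[ n₁ < L ] (iqfac n₁ * H (N₂ ℕ.+ n₁) N₂ n₃)))
                  ≈ ∑[ n₂ < L ] (iqfac n₂ * (∑[ n₁ < L ] (iqfac n₁ * H (n₃ ℕ.+ n₂ ℕ.+ n₁) (n₃ ℕ.+ n₂) n₃)))
    middle n₃ = ∑-delay n₃ L L iqfac (λ N₂ → ∑[ n₁ < L ] (iqfac n₁ * H (N₂ ℕ.+ n₁) N₂ n₃))
      (λ N₂ L≤N₂ → *-0 _ (vanish L≤N₂))
      (λ n₂ L≤n₂ → *-0 _ (vanish (ℕ.m≤n⇒m≤o+n n₃ L≤n₂)))
      where
      vanish : ∀ {N₂} → L ≤ N₂ → ∑[ n₁ < L ] (iqfac n₁ * H (N₂ ℕ.+ n₁) N₂ n₃) ≈ 0#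
      vanish {N₂} L≤N₂ = ∑-zero L λ n₁ _ → *-0 _ (H-0 (N₂ ℕ.+ n₁) N₂ n₃ (ℕ.m≤n⇒m≤n+o n₃ (ℕ.m≤n⇒m≤o+n (N₂ ℕ.+ n₁) L≤N₂)))
    term : ∀ n₃ n₂ n₁ → iqfac n₂ * (iqfac n₁ * H (n₃ ℕ.+ n₂ ℕ.+ n₁) (n₃ ℕ.+ n₂) n₃) ≈ multiTerm L n₁ n₂ n₃
    term n₃ n₂ n₁ = trans
      (reflexive (≡.cong₂ (λ a b → iqfac n₂ * (iqfac n₁ * H a b n₃)) (e n₁ n₂ n₃) (ℕ.+-comm n₃ n₂)))
      (solve 4 (λ i k g l → k :* (i :* (g :* l)) := g :* i :* k :* l) refl _ _ _ _)
      where
      e : ∀ a b c → c ℕ.+ b ℕ.+ a ≡ a ℕ.+ b ℕ.+ c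
      e = ℕSolver.solve-∀

  borwein-multisum : ∀ L →
    ∑[ j < L ] (borweinCoeff j * (gauss (L ℕ.+ L) (L ℕ.+ (1 ℕ.+ 3 ℕ.* j)) - q ^ (j ℕ.+ suc j) * gauss (L ℕ.+ L) (L ℕ.+ (2 ℕ.+ 3 ℕ.* j))))
    ≈ ∑[ n₁ < L ] ∑[ n₂ < L ] ∑[ n₃ < L ] multiTerm L n₁ n₂ n₃
  borwein-multisum L = trans (borwein-chain L) (chain-reindex L)

-- Sections modulo three

-- S r f stands for the series f_r in f(q) = f₀(q³) + q f₁(q³) + q² f₂(q³).
record Trisection (R : CommutativeRing 0ℓ 0ℓ) (q : CommutativeRing.Carrier R) : Set where
  open CommutativeRing R
  open Exp semiring using (_^_)
  field
    S      : ℕ → Carrier → Carrier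
    S-cong : ∀ r {f g} → f ≈ g → S r f ≈ S r g
    S-+    : ∀ r f g → S r (f + g) ≈ S r f + S r g
    S-neg  : ∀ r f → S r (- f) ≈ - S r f
    S-q    : ∀ r f → S (suc r) (q * f) ≈ S r f
    S-q³   : ∀ r f → r < 3 → S r (q ^ 3 * f) ≈ q * S r f
    S₀-1   : S 0 1# ≈ 1#
    S₁-1   : S 1 1# ≈ 0#
    S₂-1   : S 2 1# ≈ 0#

module TrisectedProducts (R : CommutativeRing 0ℓ 0ℓ)
                         (fromℤ : ℤ.+-*-rawRing -Raw-AlmostCommutative⟶ fromCommutativeRing R)
                         (q : CommutativeRing.Carrier R) (inv : ℕ → CommutativeRing.Carrier R)
                         (inv-inverse : InvertsOneMinusPowers R q inv)
                         (trisection : Trisection R q) where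
  open CommutativeRing R
  open Trisection trisection
  open Exp semiring using (_^_; ^-homo-*; ^-assocʳ)
  open import Relation.Binary.Reasoning.Setoid setoid
  open import Algebra.Properties.Ring ring using (-0#≈0#)
  open Sums R
  open QBinomial R fromℤ q
  open QSeries R fromℤ q inv inv-inverse
  module Cubed = QBinomial R fromℤ (q ^ 3)

  S-0 : ∀ r → S r 0# ≈ 0#
  S-0 r = begin
    S r 0#               ≈⟨ S-cong r (-‿inverseʳ 1#) ⟨
    S r (1# - 1#)        ≈⟨ trans (S-+ r 1# (- 1#)) (+-congˡ (S-neg r 1#)) ⟩
    S r 1# - S r 1#      ≈⟨ -‿inverseʳ (S r 1#) ⟩
    0#                   ∎

  S-∑ : ∀ r n f → S r (∑ n f) ≈ ∑[ i < n ] S r (f i)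
  S-∑ r zero    f = S-0 r
  S-∑ r (suc n) f = trans (S-+ r _ _) (+-congʳ (S-∑ r n f))

  S-q³^ : ∀ r m f → r < 3 → S r ((q ^ 3) ^ m * f) ≈ q ^ m * S r f
  S-q³^ r zero    f r<3 = trans (S-cong r (*-identityˡ f)) (sym (*-identityˡ _))
  S-q³^ r (suc m) f r<3 = begin
    S r (q ^ 3 * (q ^ 3) ^ m * f)    ≈⟨ S-cong r (*-assoc _ _ _) ⟩
    S r (q ^ 3 * ((q ^ 3) ^ m * f))  ≈⟨ S-q³ r _ r<3 ⟩
    q * S r ((q ^ 3) ^ m * f)        ≈⟨ *-congˡ (S-q³^ r m f r<3) ⟩
    q * (q ^ m * S r f)              ≈⟨ *-assoc _ _ _ ⟨
    q ^ suc m * S r f                ∎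

  -- f(q) = g(q³)
  record IsCubed (f g : Carrier) : Set where
    field
      section₀ : S 0 f ≈ g
      section₁ : S 1 f ≈ 0#
      section₂ : S 2 f ≈ 0#
  open IsCubed

  isCubed-resp : ∀ {f f′ g} → f ≈ f′ → IsCubed f g → IsCubed f′ g
  isCubed-resp f≈f′ c = record
    { section₀ = trans (S-cong 0 (sym f≈f′)) (section₀ c)
    ; section₁ = trans (S-cong 1 (sym f≈f′)) (section₁ c)
    ; section₂ = trans (S-cong 2 (sym f≈f′)) (section₂ c) }

  isCubed-1 : IsCubed 1# 1#
  isCubed-1 = record { section₀ = S₀-1 ; section₁ = S₁-1 ; section₂ = S₂-1 }

  isCubed-0 : IsCubed 0# 0#
  isCubed-0 = record { section₀ = S-0 0 ; section₁ = S-0 1 ; section₂ = S-0 2 }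

  isCubed-+ : ∀ {f f′ g g′} → IsCubed f g → IsCubed f′ g′ → IsCubed (f + f′) (g + g′)
  isCubed-+ c c′ = record
    { section₀ = trans (S-+ 0 _ _) (+-cong (section₀ c) (section₀ c′))
    ; section₁ = trans (S-+ 1 _ _) (trans (+-cong (section₁ c) (section₁ c′)) (+-identityˡ 0#))
    ; section₂ = trans (S-+ 2 _ _) (trans (+-cong (section₂ c) (section₂ c′)) (+-identityˡ 0#)) }

  isCubed-neg : ∀ {f g} → IsCubed f g → IsCubed (- f) (- g)
  isCubed-neg c = record
    { section₀ = trans (S-neg 0 _) (-‿cong (section₀ c))
    ; section₁ = trans (S-neg 1 _) (trans (-‿cong (section₁ c)) -0#≈0#)
    ; section₂ = trans (S-neg 2 _) (trans (-‿cong (section₂ c)) -0#≈0#) }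

  isCubed-q^ : ∀ m {f g} → IsCubed f g → IsCubed ((q ^ 3) ^ m * f) (q ^ m * g)
  isCubed-q^ m c = record
    { section₀ = trans (S-q³^ 0 m _ (s≤s z≤n)) (*-congˡ (section₀ c))
    ; section₁ = trans (S-q³^ 1 m _ (s≤s (s≤s z≤n))) (*-0 _ (section₁ c))
    ; section₂ = trans (S-q³^ 2 m _ (s≤s (s≤s (s≤s z≤n)))) (*-0 _ (section₂ c)) }

  -- Sections are additive but not multiplicative. Pascal's rule suffices, since it builds the
  -- binomials from 0 and 1 by sums and multiplications by powers of q³.
  isCubed-gauss : ∀ n k → IsCubed (Cubed.gauss n k) (gauss n k)
  isCubed-gauss zero    zero    = isCubed-1
  isCubed-gauss (suc n) zero    = isCubed-1
  isCubed-gauss zero    (suc k) = isCubed-0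
  isCubed-gauss (suc n) (suc k) = isCubed-+ (isCubed-gauss n k) (isCubed-q^ (suc k) (isCubed-gauss n (suc k)))

  -- The factor f avoids a product of two cubed elements: each step of the induction moves one
  -- factor - q^(3d) into f.
  isCubed-binomCoeff : ∀ d {f g} → IsCubed f g → IsCubed (Cubed.binomCoeff 1# d * f) (binomCoeff 1# d * g)
  isCubed-binomCoeff zero    {f} {g} c = record
    { section₀ = trans (S-cong 0 (*-identityˡ f)) (trans (section₀ c) (sym (*-identityˡ g)))
    ; section₁ = trans (S-cong 1 (*-identityˡ f)) (section₁ c)
    ; section₂ = trans (S-cong 2 (*-identityˡ f)) (section₂ c) }
  isCubed-binomCoeff (suc d) {f} {g} c = record
    { section₀ = trans (section₀ c′) (rearrange (binomCoeff 1# d) (q ^ d) g)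
    ; section₁ = section₁ c′
    ; section₂ = section₂ c′ }
    where
    rearrange : ∀ b u f → b * - (u * f) ≈ - (b * (1# * u)) * f
    rearrange = solve 3 (λ b u f → b :* (:- (u :* f)) := (:- (b :* (𝟙 :* u))) :* f) refl
    c′ = isCubed-resp (rearrange (Cubed.binomCoeff 1# d) ((q ^ 3) ^ d) f)
           (isCubed-binomCoeff d (isCubed-neg (isCubed-q^ d c)))

  -- This isolates z^d, a power of q for z = q or q², as the only factor that decides the residue
  -- modulo three.
  binomCoeff-scale : ∀ z d → Cubed.binomCoeff z d ≈ z ^ d * Cubed.binomCoeff 1# d
  binomCoeff-scale z zero    = sym (*-identityˡ 1#)
  binomCoeff-scale z (suc d) = trans (-‿cong (*-congʳ (binomCoeff-scale z d)))
    (solve 4 (λ z p b u → :- (p :* b :* (z :* u)) := z :* p :* (:- (b :* (𝟙 :* u)))) refl z (z ^ d) (Cubed.binomCoeff 1# d) ((q ^ 3) ^ d))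

  -- Used with s + r = 2: section 2 of q^(s+3m) f comes from section 2 - s of f, which for cubed f
  -- can be nonzero only when s = 2.
  section-shift : ∀ r m f → r < 3 → ∀ s → S (s ℕ.+ r) (q ^ (s ℕ.+ 3 ℕ.* m) * f) ≈ q ^ m * S r f
  section-shift r m f r<3 zero    = trans (S-cong r (*-congʳ (sym (^-assocʳ q 3 m)))) (S-q³^ r m f r<3)
  section-shift r m f r<3 (suc s) = trans (S-cong (suc (s ℕ.+ r)) (*-assoc _ _ _))
    (trans (S-q (s ℕ.+ r) _) (section-shift r m f r<3 s))

  -- The section of residue two

  -- (3j+1)(3j)/2 + 2j = j(9j+7)/2. The summand 2j stems from w^d = q^(2d) at d = 3j + 1, whose
  -- exponent is 2 + 3·2j.
  borweinCoeff-binomCoeff : ∀ j → q ^ (j ℕ.+ j) * binomCoeff 1# (1 ℕ.+ 3 ℕ.* j) ≈ - borweinCoeff j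
  borweinCoeff-binomCoeff zero = solve 0 (𝟙 :* (:- (𝟙 :* (𝟙 :* 𝟙))) := :- 𝟙) refl
  borweinCoeff-binomCoeff (suc j) = begin
    q ^ (suc j ℕ.+ suc j) * binomCoeff 1# (1 ℕ.+ 3 ℕ.* suc j)
      ≡⟨ ≡.cong₂ (λ a b → q ^ suc a * binomCoeff 1# (suc b)) (ℕ.+-suc j j) (ℕ.*-suc 3 j) ⟩
    q * (q * u) * binomCoeff 1# (4 ℕ.+ 3 ℕ.* j)
      ≈⟨ solve 4 (λ q u v b → q :* (q :* u) :* (:- ((:- ((:- (b :* (𝟙 :* (q :* v)))) :* (𝟙 :* (q :* (q :* v))))) :* (𝟙 :* (q :* (q :* (q :* v))))))
           := :- (:- (:- (u :* b :* (q :^ 8 :* (v :* v :* v)))))) refl q u v b ⟩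
    - - - (u * b * (q ^ 8 * (v * v * v)))
      ≈⟨ -‿cong (-‿cong (-‿cong (*-cong (borweinCoeff-binomCoeff j) (sym power)))) ⟩
    - - - (- borweinCoeff j * q ^ (8 ℕ.+ 9 ℕ.* j))
      ≈⟨ solve 2 (λ b u → :- (:- (:- ((:- b) :* u))) := :- (:- (b :* u))) refl (borweinCoeff j) (q ^ (8 ℕ.+ 9 ℕ.* j)) ⟩
    - borweinCoeff (suc j) ∎
    where
    u = q ^ (j ℕ.+ j)
    v = q ^ (3 ℕ.* j)
    b = binomCoeff 1# (1 ℕ.+ 3 ℕ.* j)
    e : ∀ j → 8 ℕ.+ 9 ℕ.* j ≡ 8 ℕ.+ (3 ℕ.* j ℕ.+ 3 ℕ.* j ℕ.+ 3 ℕ.* j)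
    e = ℕSolver.solve-∀
    power : q ^ (8 ℕ.+ 9 ℕ.* j) ≈ q ^ 8 * (v * v * v)
    power = trans (q^-+ 8 (3 ℕ.* j ℕ.+ 3 ℕ.* j ℕ.+ 3 ℕ.* j) (e j))
      (*-congˡ (trans (q^-+ (3 ℕ.* j ℕ.+ 3 ℕ.* j) (3 ℕ.* j) ≡.refl) (*-congʳ (q^-+ (3 ℕ.* j) (3 ℕ.* j) ≡.refl))))

  -- The partner term: at -1 - j the exponent j(9j+7)/2 grows by exactly 2j + 1.
  borweinCoeff-binomCoeff′ : ∀ j → q ^ j * binomCoeff 1# (2 ℕ.+ 3 ℕ.* j) ≈ borweinCoeff j * q ^ (j ℕ.+ suc j)
  borweinCoeff-binomCoeff′ j = begin
    q ^ j * - (b * (1# * q ^ (1 ℕ.+ 3 ℕ.* j)))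
      ≈⟨ solve 3 (λ u b v → u :* (:- (b :* (𝟙 :* v))) := :- (b :* (u :* v))) refl (q ^ j) b (q ^ (1 ℕ.+ 3 ℕ.* j)) ⟩
    - (b * (q ^ j * q ^ (1 ℕ.+ 3 ℕ.* j)))
      ≈⟨ -‿cong (*-congˡ (trans (sym (q^-+ j (1 ℕ.+ 3 ℕ.* j) (e j))) (q^-+ (j ℕ.+ j) (j ℕ.+ suc j) ≡.refl))) ⟩
    - (b * (q ^ (j ℕ.+ j) * q ^ (j ℕ.+ suc j)))
      ≈⟨ solve 3 (λ b u v → :- (b :* (u :* v)) := (:- (u :* b)) :* v) refl b (q ^ (j ℕ.+ j)) (q ^ (j ℕ.+ suc j)) ⟩
    - (q ^ (j ℕ.+ j) * b) * q ^ (j ℕ.+ suc j)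
      ≈⟨ *-congʳ (trans (-‿cong (borweinCoeff-binomCoeff j)) (solve 1 (λ b → :- (:- b) := b) refl (borweinCoeff j))) ⟩
    borweinCoeff j * q ^ (j ℕ.+ suc j) ∎
    where
    b = binomCoeff 1# (1 ℕ.+ 3 ℕ.* j)
    e : ∀ j → (j ℕ.+ j) ℕ.+ (j ℕ.+ suc j) ≡ j ℕ.+ (1 ℕ.+ 3 ℕ.* j)
    e = ℕSolver.solve-∀

  ∑-triples : ∀ n f → ∑ (3 ℕ.* n) f ≈ ∑[ j < n ] (f (3 ℕ.* j) + f (1 ℕ.+ 3 ℕ.* j) + f (2 ℕ.+ 3 ℕ.* j))
  ∑-triples zero    f = refl
  ∑-triples (suc n) f = begin
    ∑ (3 ℕ.* suc n) f
      ≡⟨ ≡.cong (λ k → ∑ k f) (ℕ.*-suc 3 n) ⟩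
    ∑ (3 ℕ.* n) f + f (3 ℕ.* n) + f (1 ℕ.+ 3 ℕ.* n) + f (2 ℕ.+ 3 ℕ.* n)
      ≈⟨ trans (+-congʳ (+-assoc _ _ _)) (+-assoc _ _ _) ⟩
    ∑ (3 ℕ.* n) f + (f (3 ℕ.* n) + f (1 ℕ.+ 3 ℕ.* n) + f (2 ℕ.+ 3 ℕ.* n))
      ≈⟨ +-congʳ (∑-triples n f) ⟩
    ∑[ j < suc n ] (f (3 ℕ.* j) + f (1 ℕ.+ 3 ℕ.* j) + f (2 ℕ.+ 3 ℕ.* j)) ∎

  module _ (L : ℕ) where
    term : Carrier → ℕ → ℕ → Carrier
    term z d k = Cubed.binomCoeff z d * Cubed.gauss (L ℕ.+ L) k

    term-0 : ∀ z d {k} → L ℕ.+ L < k → term z d k ≈ 0#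
    term-0 z d 2L<k = *-0 _ (Cubed.gauss-> 2L<k)

    term-cubed : ∀ d k → IsCubed (Cubed.binomCoeff 1# d * Cubed.gauss (L ℕ.+ L) k) (binomCoeff 1# d * gauss (L ℕ.+ L) k)
    term-cubed d k = isCubed-binomCoeff d (isCubed-gauss (L ℕ.+ L) k)

    term-power : ∀ a e d k → a ℕ.* d ≡ e →
                 term (q ^ a) d k ≈ q ^ e * (Cubed.binomCoeff 1# d * Cubed.gauss (L ℕ.+ L) k)
    term-power a e d k ≡.refl = trans (*-congʳ (trans (binomCoeff-scale (q ^ a) d) (*-congʳ (^-assocʳ q a d)))) (*-assoc _ _ _)

    section-term₂ : ∀ a d k m → a ℕ.* d ≡ 2 ℕ.+ 3 ℕ.* m → S 2 (term (q ^ a) d k) ≈ q ^ m * (binomCoeff 1# d * gauss (L ℕ.+ L) k)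
    section-term₂ a d k m e = trans (S-cong 2 (term-power a _ d k e))
      (trans (section-shift 0 m _ (s≤s z≤n) 2) (*-congˡ (section₀ (term-cubed d k))))

    section-term₁ : ∀ a d k m → a ℕ.* d ≡ 1 ℕ.+ 3 ℕ.* m → S 2 (term (q ^ a) d k) ≈ 0#
    section-term₁ a d k m e = trans (S-cong 2 (term-power a _ d k e))
      (trans (section-shift 1 m _ (s≤s (s≤s z≤n)) 1) (*-0 _ (section₁ (term-cubed d k))))

    section-term₀ : ∀ a d k m → a ℕ.* d ≡ 3 ℕ.* m → S 2 (term (q ^ a) d k) ≈ 0#
    section-term₀ a d k m e = trans (S-cong 2 (term-power a _ d k e))
      (trans (section-shift 2 m _ (s≤s (s≤s (s≤s z≤n))) 0) (*-0 _ (section₂ (term-cubed d k))))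

    section-∑ : ∀ f → (∀ d → suc L ≤ d → f d ≈ 0#) →
                S 2 (∑ (suc L) f) ≈ ∑[ j < suc L ] (S 2 (f (3 ℕ.* j)) + S 2 (f (1 ℕ.+ 3 ℕ.* j)) + S 2 (f (2 ℕ.+ 3 ℕ.* j)))
    section-∑ f f≈0 = begin
      S 2 (∑ (suc L) f)
        -- The range is padded with zero terms to a multiple of three, so that the indices fall into
        -- complete triples.
        ≈⟨ S-cong 2 (∑-bounds (suc L) (3 ℕ.* suc L) f≈0 (λ d 3L<d → f≈0 d (ℕ.≤-trans (ℕ.m≤n*m (suc L) 3) 3L<d))) ⟩
      S 2 (∑ (3 ℕ.* suc L) f)
        ≈⟨ S-∑ 2 (3 ℕ.* suc L) f ⟩
      ∑[ d < 3 ℕ.* suc L ] S 2 (f d)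
        ≈⟨ ∑-triples (suc L) (λ d → S 2 (f d)) ⟩
      ∑[ j < suc L ] (S 2 (f (3 ℕ.* j)) + S 2 (f (1 ℕ.+ 3 ℕ.* j)) + S 2 (f (2 ℕ.+ 3 ℕ.* j))) ∎

    g₁ g₂ : ℕ → Carrier
    g₁ j = gauss (L ℕ.+ L) (L ℕ.+ (1 ℕ.+ 3 ℕ.* j))
    g₂ j = gauss (L ℕ.+ L) (L ℕ.+ (2 ℕ.+ 3 ℕ.* j))

    -- Residue two occurs for q^d at d = 3j + 2 and for q^(2d) at d = 3j + 1. The first class, from
    -- the half with z = q, gives the terms -1 - j; the second, from the half with w = q², gives the
    -- terms j.
    section-pochhammer :
      - S 2 (Cubed.pochhammer (q ^ 1) L * Cubed.pochhammer (q ^ 2) L)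
      ≈ ∑[ j < L ] (borweinCoeff j * (g₁ j - q ^ (j ℕ.+ suc j) * g₂ j))
    section-pochhammer = begin
      - S 2 (Cubed.pochhammer (q ^ 1) L * Cubed.pochhammer (q ^ 2) L)
        ≈⟨ -‿cong (S-cong 2 (Cubed.pochhammer-* (q ^ 1) (q ^ 2) (sym (^-homo-* q 1 2)) L)) ⟩
      - S 2 ((∑[ d < suc L ] term (q ^ 1) d (L ℕ.+ d)) + (∑[ d < suc L ] term (q ^ 2) (suc d) (L ℕ.+ suc d)))
        ≈⟨ -‿cong (trans (S-+ 2 _ _) (+-cong (section-∑ _ vanish₁) (section-∑ _ vanish₂))) ⟩
      - ((∑[ j < suc L ] (S 2 (term (q ^ 1) (3 ℕ.* j) (L ℕ.+ 3 ℕ.* j)) + S 2 (term (q ^ 1) (1 ℕ.+ 3 ℕ.* j) (L ℕ.+ (1 ℕ.+ 3 ℕ.* j)))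
                          + S 2 (term (q ^ 1) (2 ℕ.+ 3 ℕ.* j) (L ℕ.+ (2 ℕ.+ 3 ℕ.* j)))))
         + (∑[ j < suc L ] (S 2 (term (q ^ 2) (1 ℕ.+ 3 ℕ.* j) (L ℕ.+ (1 ℕ.+ 3 ℕ.* j))) + S 2 (term (q ^ 2) (2 ℕ.+ 3 ℕ.* j) (L ℕ.+ (2 ℕ.+ 3 ℕ.* j)))
                            + S 2 (term (q ^ 2) (3 ℕ.+ 3 ℕ.* j) (L ℕ.+ (3 ℕ.+ 3 ℕ.* j))))))
        ≈⟨ -‿cong (+-cong (∑-cong (suc L) sections₁) (∑-cong (suc L) sections₂)) ⟩
      - ((∑[ j < suc L ] (borweinCoeff j * q ^ (j ℕ.+ suc j) * g₂ j)) + (∑[ j < suc L ] (- borweinCoeff j * g₁ j)))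
        ≈⟨ -‿cong (∑-+ (suc L) _ _) ⟨
      - (∑[ j < suc L ] (borweinCoeff j * q ^ (j ℕ.+ suc j) * g₂ j + - borweinCoeff j * g₁ j))
        ≈⟨ ∑-neg (suc L) _ ⟩
      ∑[ j < suc L ] (- (borweinCoeff j * q ^ (j ℕ.+ suc j) * g₂ j + - borweinCoeff j * g₁ j))
        ≈⟨ ∑-cong (suc L) (λ j → solve 4 (λ b u g g′ → :- (b :* u :* g′ :+ (:- b) :* g) := b :* (g :- u :* g′)) refl
             (borweinCoeff j) (q ^ (j ℕ.+ suc j)) (g₁ j) (g₂ j)) ⟩
      ∑[ j < suc L ] (borweinCoeff j * (g₁ j - q ^ (j ℕ.+ suc j) * g₂ j))
        ≈⟨ trans (+-congˡ (*-0 _ (trans (+-cong (gauss-> (L+L< 0)) (-‿cong (*-0 _ (gauss-> (L+L< 1))))) (trans (+-identityˡ _) -0#≈0#)))) (+-identityʳ _) ⟩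
      ∑[ j < L ] (borweinCoeff j * (g₁ j - q ^ (j ℕ.+ suc j) * g₂ j)) ∎
      where
      ∑-neg : ∀ n f → - ∑ n f ≈ ∑[ i < n ] (- f i)
      ∑-neg zero    f = -0#≈0#
      ∑-neg (suc n) f = trans (solve 2 (λ a b → :- (a :+ b) := (:- a) :+ (:- b)) refl (∑ n f) (f n)) (+-congʳ (∑-neg n f))
      L+L< : ∀ i → L ℕ.+ L < L ℕ.+ (suc i ℕ.+ 3 ℕ.* L)
      L+L< i = ℕ.+-monoʳ-< L (s≤s (ℕ.≤-trans (ℕ.m≤n*m L 3) (ℕ.m≤n+m (3 ℕ.* L) i)))
      vanish₁ : ∀ d → suc L ≤ d → term (q ^ 1) d (L ℕ.+ d) ≈ 0#
      vanish₁ d L<d = term-0 (q ^ 1) d (ℕ.+-monoʳ-< L L<d)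
      vanish₂ : ∀ d → suc L ≤ d → term (q ^ 2) (suc d) (L ℕ.+ suc d) ≈ 0#
      vanish₂ d L<d = term-0 (q ^ 2) (suc d) (ℕ.+-monoʳ-< L (ℕ.m<n⇒m<1+n L<d))
      sections₁ : ∀ j → S 2 (term (q ^ 1) (3 ℕ.* j) (L ℕ.+ 3 ℕ.* j)) + S 2 (term (q ^ 1) (1 ℕ.+ 3 ℕ.* j) (L ℕ.+ (1 ℕ.+ 3 ℕ.* j)))
                          + S 2 (term (q ^ 1) (2 ℕ.+ 3 ℕ.* j) (L ℕ.+ (2 ℕ.+ 3 ℕ.* j)))
                        ≈ borweinCoeff j * q ^ (j ℕ.+ suc j) * g₂ j
      sections₁ j = trans
        (+-cong (trans (+-cong (section-term₀ 1 _ (L ℕ.+ 3 ℕ.* j) j (ℕ.*-identityˡ (3 ℕ.* j))) (section-term₁ 1 _ (L ℕ.+ (1 ℕ.+ 3 ℕ.* j)) j (ℕ.*-identityˡ (1 ℕ.+ 3 ℕ.* j)))) (+-identityˡ 0#))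
                (trans (section-term₂ 1 _ (L ℕ.+ (2 ℕ.+ 3 ℕ.* j)) j (ℕ.*-identityˡ (2 ℕ.+ 3 ℕ.* j))) (trans (sym (*-assoc _ _ _)) (*-congʳ (borweinCoeff-binomCoeff′ j)))))
        (+-identityˡ _)
      sections₂ : ∀ j → S 2 (term (q ^ 2) (1 ℕ.+ 3 ℕ.* j) (L ℕ.+ (1 ℕ.+ 3 ℕ.* j))) + S 2 (term (q ^ 2) (2 ℕ.+ 3 ℕ.* j) (L ℕ.+ (2 ℕ.+ 3 ℕ.* j)))
                            + S 2 (term (q ^ 2) (3 ℕ.+ 3 ℕ.* j) (L ℕ.+ (3 ℕ.+ 3 ℕ.* j)))
                        ≈ - borweinCoeff j * g₁ j
      sections₂ j = trans
        (+-cong (trans (+-cong (trans (section-term₂ 2 (1 ℕ.+ 3 ℕ.* j) (L ℕ.+ (1 ℕ.+ 3 ℕ.* j)) (j ℕ.+ j) (e₂ j)) (trans (sym (*-assoc _ _ _)) (*-congʳ (borweinCoeff-binomCoeff j))))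
                               (section-term₁ 2 (2 ℕ.+ 3 ℕ.* j) (L ℕ.+ (2 ℕ.+ 3 ℕ.* j)) (1 ℕ.+ (j ℕ.+ j)) (e₁ j)))
                       (+-identityʳ _))
                (section-term₀ 2 (3 ℕ.+ 3 ℕ.* j) (L ℕ.+ (3 ℕ.+ 3 ℕ.* j)) (2 ℕ.+ (j ℕ.+ j)) (e₀ j)))
        (+-identityʳ _)
        where
        e₂ : ∀ j → 2 ℕ.* (1 ℕ.+ 3 ℕ.* j) ≡ 2 ℕ.+ 3 ℕ.* (j ℕ.+ j)
        e₂ = ℕSolver.solve-∀
        e₁ : ∀ j → 2 ℕ.* (2 ℕ.+ 3 ℕ.* j) ≡ 1 ℕ.+ 3 ℕ.* (1 ℕ.+ (j ℕ.+ j))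
        e₁ = ℕSolver.solve-∀
        e₀ : ∀ j → 2 ℕ.* (3 ℕ.+ 3 ℕ.* j) ≡ 3 ℕ.* (2 ℕ.+ (j ℕ.+ j))
        e₀ = ℕSolver.solve-∀

-- The ring of formal power series

open import Data.Bool using (true; false; if_then_else_; T)
open import Data.Integer using (ℤ; 0ℤ; 1ℤ; _+_; _*_; -_)
open ≡ using (refl; sym; trans; cong; cong₂)
open ≡.≡-Reasoning

sumTo-cong : ∀ n {f g : ℕ → ℤ} → (∀ i → f i ≡ g i) → sumTo n f ≡ sumTo n g
sumTo-cong zero    f≡g = refl
sumTo-cong (suc n) f≡g = cong₂ _+_ (sumTo-cong n f≡g) (f≡g n)

sumTo-head : ∀ n (f : ℕ → ℤ) → sumTo (suc n) f ≡ f 0 + sumTo n (λ i → f (suc i))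
sumTo-head zero    f = ℤ.+-comm 0ℤ (f 0)
sumTo-head (suc n) f = trans (cong (_+ f (suc n)) (sumTo-head n f)) (ℤ.+-assoc (f 0) _ _)

tail : PS → PS
tail f n = f (suc n)

infix 4 _≐_
_≐_ : PS → PS → Set
f ≐ g = ∀ n → f n ≡ g n

infixl 6 _⊕_
_⊕_ : PS → PS → PS
(f ⊕ g) n = f n + g n

infix 8 ⊖_
⊖_ : PS → PS
(⊖ f) n = - f n

zeroP : PS
zeroP _ = 0ℤ

⊛-zero : ∀ f g → (f ⊛ g) 0 ≡ f 0 * g 0
⊛-zero f g = ℤ.+-identityˡ _

-- Coefficient form of f g = f(0) g + q (tail f) g, on which the inductions for the ring laws rest.
⊛-suc : ∀ f g n → (f ⊛ g) (suc n) ≡ f 0 * g (suc n) + (tail f ⊛ g) n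
⊛-suc f g n = sumTo-head (suc n) (λ i → f i * g (suc n ∸ i))

⊛-cong : ∀ {f f′ g g′} → f ≐ f′ → g ≐ g′ → f ⊛ g ≐ f′ ⊛ g′
⊛-cong p r n = sumTo-cong (suc n) λ i → cong₂ _*_ (p i) (r (n ∸ i))

⊛-distribʳ : ∀ h f g → (f ⊕ g) ⊛ h ≐ f ⊛ h ⊕ g ⊛ h
⊛-distribʳ h f g zero = begin
  ((f ⊕ g) ⊛ h) 0             ≡⟨ ⊛-zero (f ⊕ g) h ⟩
  (f 0 + g 0) * h 0           ≡⟨ ℤ.*-distribʳ-+ (h 0) (f 0) (g 0) ⟩
  f 0 * h 0 + g 0 * h 0       ≡⟨ cong₂ _+_ (⊛-zero f h) (⊛-zero g h) ⟨
  (f ⊛ h ⊕ g ⊛ h) 0           ∎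
⊛-distribʳ h f g (suc n) = begin
  ((f ⊕ g) ⊛ h) (suc n)
    ≡⟨ ⊛-suc (f ⊕ g) h n ⟩
  (f 0 + g 0) * h (suc n) + ((tail f ⊕ tail g) ⊛ h) n
    ≡⟨ cong ((f 0 + g 0) * h (suc n) +_) (⊛-distribʳ h (tail f) (tail g) n) ⟩
  (f 0 + g 0) * h (suc n) + ((tail f ⊛ h) n + (tail g ⊛ h) n)
    ≡⟨ rearrange (f 0) (g 0) (h (suc n)) _ _ ⟩
  (f 0 * h (suc n) + (tail f ⊛ h) n) + (g 0 * h (suc n) + (tail g ⊛ h) n)
    ≡⟨ cong₂ _+_ (⊛-suc f h n) (⊛-suc g h n) ⟨
  (f ⊛ h ⊕ g ⊛ h) (suc n) ∎
  where
  rearrange : ∀ a b c x y → (a + b) * c + (x + y) ≡ (a * c + x) + (b * c + y)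
  rearrange = ℤSolver.solve-∀

const : ℤ → PS
const c zero    = c
const c (suc _) = 0ℤ

⊛-zeroˡ : ∀ f → zeroP ⊛ f ≐ zeroP
⊛-zeroˡ f zero    = ⊛-zero zeroP f
⊛-zeroˡ f (suc n) = trans (⊛-suc zeroP f n) (trans (ℤ.+-identityˡ _) (⊛-zeroˡ f n))

const-⊛ : ∀ c f n → (const c ⊛ f) n ≡ c * f n
const-⊛ c f zero    = ⊛-zero (const c) f
const-⊛ c f (suc n) =
  trans (⊛-suc (const c) f n) (trans (cong (c * f (suc n) +_) (⊛-zeroˡ f n)) (ℤ.+-identityʳ _))

-- One unfolding peels only the left factor. Swapping the remainder by induction lets a second
-- unfolding peel the other, so both orders arrive at the product of the tails two coefficients
-- lower; hence the separate cases 0 and 1.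
⊛-comm : ∀ f g → f ⊛ g ≐ g ⊛ f
⊛-comm f g zero = trans (⊛-zero f g) (trans (ℤ.*-comm (f 0) (g 0)) (sym (⊛-zero g f)))
⊛-comm f g (suc zero) = begin
  (f ⊛ g) 1                        ≡⟨ ⊛-suc f g 0 ⟩
  f 0 * g 1 + (tail f ⊛ g) 0       ≡⟨ cong (f 0 * g 1 +_) (⊛-zero (tail f) g) ⟩
  f 0 * g 1 + f 1 * g 0            ≡⟨ rearrange (f 0) (f 1) (g 0) (g 1) ⟩
  g 0 * f 1 + g 1 * f 0            ≡⟨ cong (g 0 * f 1 +_) (⊛-zero (tail g) f) ⟨
  g 0 * f 1 + (tail g ⊛ f) 0       ≡⟨ ⊛-suc g f 0 ⟨
  (g ⊛ f) 1                        ∎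
  where
  rearrange : ∀ a b c d → a * d + b * c ≡ c * b + d * a
  rearrange = ℤSolver.solve-∀
⊛-comm f g (suc (suc n)) = begin
  (f ⊛ g) (2 ℕ.+ n)
    ≡⟨ unfold₂ f g (⊛-comm (tail f) g (suc n)) ⟩
  f 0 * g (2 ℕ.+ n) + (g 0 * f (2 ℕ.+ n) + (tail g ⊛ tail f) n)
    ≡⟨ cong (λ z → f 0 * g (2 ℕ.+ n) + (g 0 * f (2 ℕ.+ n) + z)) (⊛-comm (tail g) (tail f) n) ⟩
  f 0 * g (2 ℕ.+ n) + (g 0 * f (2 ℕ.+ n) + (tail f ⊛ tail g) n)
    ≡⟨ rearrange (f 0 * g (2 ℕ.+ n)) (g 0 * f (2 ℕ.+ n)) _ ⟩
  g 0 * f (2 ℕ.+ n) + (f 0 * g (2 ℕ.+ n) + (tail f ⊛ tail g) n)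
    ≡⟨ unfold₂ g f (⊛-comm (tail g) f (suc n)) ⟨
  (g ⊛ f) (2 ℕ.+ n) ∎
  where
  rearrange : ∀ a b c → a + (b + c) ≡ b + (a + c)
  rearrange = ℤSolver.solve-∀
  unfold₂ : ∀ f g → (tail f ⊛ g) (suc n) ≡ (g ⊛ tail f) (suc n) →
            (f ⊛ g) (2 ℕ.+ n) ≡ f 0 * g (2 ℕ.+ n) + (g 0 * f (2 ℕ.+ n) + (tail g ⊛ tail f) n)
  unfold₂ f g tail-comm = begin
    (f ⊛ g) (2 ℕ.+ n)                                              ≡⟨ ⊛-suc f g (suc n) ⟩
    f 0 * g (2 ℕ.+ n) + (tail f ⊛ g) (suc n)                       ≡⟨ cong (f 0 * g (2 ℕ.+ n) +_) tail-comm ⟩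
    f 0 * g (2 ℕ.+ n) + (g ⊛ tail f) (suc n)                       ≡⟨ cong (f 0 * g (2 ℕ.+ n) +_) (⊛-suc g (tail f) n) ⟩
    f 0 * g (2 ℕ.+ n) + (g 0 * f (2 ℕ.+ n) + (tail g ⊛ tail f) n)  ∎

⊛-assoc : ∀ f g h → (f ⊛ g) ⊛ h ≐ f ⊛ (g ⊛ h)
⊛-assoc f g h zero = begin
  ((f ⊛ g) ⊛ h) 0      ≡⟨ ⊛-zero (f ⊛ g) h ⟩
  (f ⊛ g) 0 * h 0      ≡⟨ cong (_* h 0) (⊛-zero f g) ⟩
  f 0 * g 0 * h 0      ≡⟨ ℤ.*-assoc (f 0) (g 0) (h 0) ⟩
  f 0 * (g 0 * h 0)    ≡⟨ cong (f 0 *_) (⊛-zero g h) ⟨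
  f 0 * (g ⊛ h) 0      ≡⟨ ⊛-zero f (g ⊛ h) ⟨
  (f ⊛ (g ⊛ h)) 0      ∎
⊛-assoc f g h (suc n) = begin
  ((f ⊛ g) ⊛ h) (suc n)
    ≡⟨ ⊛-suc (f ⊛ g) h n ⟩
  (f ⊛ g) 0 * h (suc n) + (tail (f ⊛ g) ⊛ h) n
    ≡⟨ cong₂ _+_ (cong (_* h (suc n)) (⊛-zero f g)) tail-⊛ ⟩
  f 0 * g 0 * h (suc n) + (f 0 * (tail g ⊛ h) n + (tail f ⊛ (g ⊛ h)) n)
    ≡⟨ rearrange (f 0) (g 0) (h (suc n)) _ _ ⟩
  f 0 * (g 0 * h (suc n) + (tail g ⊛ h) n) + (tail f ⊛ (g ⊛ h)) n
    ≡⟨ cong (λ z → f 0 * z + (tail f ⊛ (g ⊛ h)) n) (⊛-suc g h n) ⟨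
  f 0 * (g ⊛ h) (suc n) + (tail f ⊛ (g ⊛ h)) n
    ≡⟨ ⊛-suc f (g ⊛ h) n ⟨
  (f ⊛ (g ⊛ h)) (suc n) ∎
  where
  rearrange : ∀ a b c x y → a * b * c + (a * x + y) ≡ a * (b * c + x) + y
  rearrange = ℤSolver.solve-∀
  scaled : ∀ c u v → ((λ k → c * u k) ⊛ v) n ≡ c * (u ⊛ v) n
  scaled c u v = begin
    ((λ k → c * u k) ⊛ v) n  ≡⟨ sumTo-scale (suc n) ⟩
    c * (u ⊛ v) n            ∎
    where
    sumTo-scale : ∀ m → sumTo m (λ i → c * u i * v (n ∸ i)) ≡ c * sumTo m (λ i → u i * v (n ∸ i))
    sumTo-scale zero    = sym (ℤ.*-zeroʳ c)
    sumTo-scale (suc m) = trans (cong₂ _+_ (sumTo-scale m) (ℤ.*-assoc c (u m) _)) (sym (ℤ.*-distribˡ-+ c _ _))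
  tail-⊛ : (tail (f ⊛ g) ⊛ h) n ≡ f 0 * (tail g ⊛ h) n + (tail f ⊛ (g ⊛ h)) n
  tail-⊛ = begin
    (tail (f ⊛ g) ⊛ h) n
      ≡⟨ ⊛-cong {g = h} (⊛-suc f g) (λ _ → refl) n ⟩
    (((λ k → f 0 * tail g k) ⊕ tail f ⊛ g) ⊛ h) n
      ≡⟨ ⊛-distribʳ h (λ k → f 0 * tail g k) (tail f ⊛ g) n ⟩
    ((λ k → f 0 * tail g k) ⊛ h) n + ((tail f ⊛ g) ⊛ h) n
      ≡⟨ cong₂ _+_ (scaled (f 0) (tail g) h) (⊛-assoc (tail f) g h n) ⟩
    f 0 * (tail g ⊛ h) n + (tail f ⊛ (g ⊛ h)) n ∎

oneP≐const : oneP ≐ const 1ℤ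
oneP≐const zero    = refl
oneP≐const (suc _) = refl

⊛-identityˡ : ∀ f → oneP ⊛ f ≐ f
⊛-identityˡ f n = trans (⊛-cong {g = f} oneP≐const (λ _ → refl) n) (trans (const-⊛ 1ℤ f n) (ℤ.*-identityˡ (f n)))

⊛-distribˡ : ∀ h f g → h ⊛ (f ⊕ g) ≐ h ⊛ f ⊕ h ⊛ g
⊛-distribˡ h f g n = trans (⊛-comm h (f ⊕ g) n)
  (trans (⊛-distribʳ h f g n) (cong₂ _+_ (⊛-comm f h n) (⊛-comm g h n)))

psRing : CommutativeRing 0ℓ 0ℓ
psRing = record
  { Carrier = PS ; _≈_ = _≐_ ; _+_ = _⊕_ ; _*_ = _⊛_ ; -_ = ⊖_ ; 0# = zeroP ; 1# = oneP
  ; isCommutativeRing = record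
    { isRing = record
      { +-isAbelianGroup = record
        { isGroup = record
          { isMonoid = record
            { isSemigroup = record
              { isMagma = record
                { isEquivalence = record
                  { refl = λ _ → refl ; sym = λ p n → sym (p n) ; trans = λ p r n → trans (p n) (r n) }
                ; ∙-cong = λ p r n → cong₂ _+_ (p n) (r n) }
              ; assoc = λ f g h n → ℤ.+-assoc (f n) (g n) (h n) }
            ; identity = (λ f n → ℤ.+-identityˡ (f n)) , (λ f n → ℤ.+-identityʳ (f n)) }
          ; inverse = (λ f n → ℤ.+-inverseˡ (f n)) , (λ f n → ℤ.+-inverseʳ (f n))
          ; ⁻¹-cong = λ p n → cong -_ (p n) }
        ; comm = λ f g n → ℤ.+-comm (f n) (g n) }
      ; *-cong = λ {f} {f′} {g} {g′} → ⊛-cong {f} {f′} {g} {g′}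
      ; *-assoc = ⊛-assoc
      ; *-identity = ⊛-identityˡ , λ f n → trans (⊛-comm f oneP n) (⊛-identityˡ f n)
      ; distrib = ⊛-distribˡ , ⊛-distribʳ }
    ; *-comm = ⊛-comm } }

constHom : ℤ.+-*-rawRing -Raw-AlmostCommutative⟶ fromCommutativeRing psRing
constHom = record
  { ⟦_⟧    = const
  ; +-homo = λ { c d zero → refl ; c d (suc _) → refl }
  ; *-homo = λ { c d zero    → sym (const-⊛ c (const d) 0)
               ; c d (suc n) → sym (trans (const-⊛ c (const d) (suc n)) (ℤ.*-zeroʳ c)) }
  ; -‿homo = λ { c zero → refl ; c (suc _) → refl }
  ; 0-homo = λ { zero → refl ; (suc _) → refl }
  ; 1-homo = λ n → sym (oneP≐const n)
  }

private
  module PSRing = CommutativeRing psRing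
open Exp PSRing.semiring using (_^_; ^-homo-*; ^-assocʳ)
open import Algebra.Properties.Ring PSRing.ring using (-‿distribʳ-*)
open Sums psRing

-- The series variable, geometric series and sections of power series

X : PS
X = mono 1

X-⊛-zero : ∀ f → (X ⊛ f) 0 ≡ 0ℤ
X-⊛-zero f = ⊛-zero X f

X-⊛-suc : ∀ f n → (X ⊛ f) (suc n) ≡ f n
X-⊛-suc f n = trans (⊛-suc X f n) (trans (ℤ.+-identityˡ _) (⊛-identityˡ f n))

X^-⊛ : ∀ a f n → (X ^ a ⊛ f) (a ℕ.+ n) ≡ f n
X^-⊛ zero    f n = ⊛-identityˡ f n
X^-⊛ (suc a) f n = trans (⊛-assoc X (X ^ a) f (suc a ℕ.+ n)) (trans (X-⊛-suc (X ^ a ⊛ f) (a ℕ.+ n)) (X^-⊛ a f n))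

X^-⊛-< : ∀ a f n → n < a → (X ^ a ⊛ f) n ≡ 0ℤ
X^-⊛-< (suc a) f zero    _         = trans (⊛-assoc X (X ^ a) f 0) (X-⊛-zero (X ^ a ⊛ f))
X^-⊛-< (suc a) f (suc n) (s≤s n<a) = trans (⊛-assoc X (X ^ a) f (suc n)) (trans (X-⊛-suc (X ^ a ⊛ f) n) (X^-⊛-< a f n n<a))

mono-X^ : ∀ a → mono a ≐ X ^ a
mono-X^ zero    n       = refl
mono-X^ (suc a) zero    = sym (X-⊛-zero (X ^ a))
mono-X^ (suc a) (suc n) = trans (mono-X^ a n) (sym (X-⊛-suc (X ^ a) n))

oneMinus-X^ : ∀ a → oneMinus a ≐ oneP ⊕ ⊖ (X ^ a)
oneMinus-X^ a n = cong (λ z → oneP n + - z) (mono-X^ a n)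

geo-initial : ∀ j {n} → n < suc j → geo j n ≡ oneP n
geo-initial j {n} n<j rewrite m<n⇒m%n≡m n<j with n
... | zero  = refl
... | suc _ = refl

geo-periodic : ∀ j n → geo j (suc j ℕ.+ n) ≡ geo j n
geo-periodic j n = cong (λ r → if r ≡ᵇ 0 then 1ℤ else 0ℤ)
  (trans (cong (_% suc j) (ℕ.+-comm (suc j) n)) ([m+n]%n≡m%n n (suc j)))

-- The coefficients of `geo j` have period j + 1; subtracting the copy shifted by one period leaves
-- the first period, which is 1, 0, ..., 0.
geo-inverse : ∀ j → geo j ⊛ (oneP ⊕ ⊖ (X ^ suc j)) ≐ oneP
geo-inverse j n = begin
  (geo j ⊛ (oneP ⊕ ⊖ (X ^ suc j))) n
    ≡⟨ ⊛-distribˡ (geo j) oneP (⊖ (X ^ suc j)) n ⟩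
  (geo j ⊛ oneP) n + (geo j ⊛ ⊖ (X ^ suc j)) n
    ≡⟨ cong₂ _+_ (trans (⊛-comm (geo j) oneP n) (⊛-identityˡ (geo j) n))
         (trans (sym (-‿distribʳ-* (geo j) (X ^ suc j) n)) (cong -_ (⊛-comm (geo j) (X ^ suc j) n))) ⟩
  geo j n + - (X ^ suc j ⊛ geo j) n
    ≡⟨ difference (offset (suc j) n) ⟩
  oneP n ∎
  where
  difference : (∃ λ x → n ≡ suc j ℕ.+ x) ⊎ n < suc j → geo j n + - (X ^ suc j ⊛ geo j) n ≡ oneP n
  difference (inj₁ (x , refl)) =
    trans (cong₂ (λ a b → a + - b) (geo-periodic j x) (X^-⊛ (suc j) (geo j) x)) (ℤ.+-inverseʳ (geo j x))
  difference (inj₂ n<j) =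
    trans (cong₂ (λ a b → a + - b) (geo-initial j n<j) (X^-⊛-< (suc j) (geo j) n n<j)) (ℤ.+-identityʳ (oneP n))

section : ℕ → PS → PS
section r f k = f (r ℕ.+ 3 ℕ.* k)

-- The bound on r matters at k = 0: for r ≥ 3 the left side would have the constant coefficient f(r
-- - 3), the right side 0.
section-X³ : ∀ r f → r < 3 → section r (X ^ 3 ⊛ f) ≐ X ⊛ section r f
section-X³ r f r<3 zero = trans (X^-⊛-< 3 f (r ℕ.+ 0) (≡.subst (_< 3) (sym (ℕ.+-identityʳ r)) r<3)) (sym (X-⊛-zero (section r f)))
section-X³ r f r<3 (suc k) = begin
  (X ^ 3 ⊛ f) (r ℕ.+ 3 ℕ.* suc k)    ≡⟨ cong (X ^ 3 ⊛ f) (e r k) ⟩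
  (X ^ 3 ⊛ f) (3 ℕ.+ (r ℕ.+ 3 ℕ.* k))  ≡⟨ X^-⊛ 3 f (r ℕ.+ 3 ℕ.* k) ⟩
  f (r ℕ.+ 3 ℕ.* k)                  ≡⟨ X-⊛-suc (section r f) k ⟨
  (X ⊛ section r f) (suc k)          ∎
  where
  e : ∀ r k → r ℕ.+ 3 ℕ.* suc k ≡ 3 ℕ.+ (r ℕ.+ 3 ℕ.* k)
  e = ℕSolver.solve-∀

psTrisection : Trisection psRing X
psTrisection = record
  { S      = section
  ; S-cong = λ r f≐g k → f≐g (r ℕ.+ 3 ℕ.* k)
  ; S-+    = λ _ _ _ _ → refl
  ; S-neg  = λ _ _ _ → refl
  ; S-q    = λ r f k → X-⊛-suc f (r ℕ.+ 3 ℕ.* k)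
  ; S-q³   = section-X³
  ; S₀-1   = λ { zero → refl ; (suc _) → refl }
  ; S₁-1   = λ _ → refl
  ; S₂-1   = λ _ → refl
  }

open QSeries psRing constHom X geo geo-inverse
open TrisectedProducts psRing constHom X geo geo-inverse psTrisection

-- Translation to the given definitions

qpoch-pochhammer : ∀ a n → qpoch a 3 n ≐ Cubed.pochhammer (X ^ a) n
qpoch-pochhammer a zero    = λ _ → refl
qpoch-pochhammer a (suc n) = ⊛-cong (qpoch-pochhammer a n) λ k → trans (oneMinus-X^ (a ℕ.+ 3 ℕ.* n) k)
  (cong (λ z → oneP k + - z) (trans (^-homo-* X a (3 ℕ.* n) k)
    (⊛-cong {X ^ a} (λ _ → refl) (λ i → sym (^-assocʳ X 3 n i)) k)))

qq-qfac : ∀ n → qq n ≐ qfac n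
qq-qfac zero    = λ _ → refl
qq-qfac (suc n) = ⊛-cong (qq-qfac n) λ k → trans (oneMinus-X^ (1 ℕ.+ 1 ℕ.* n) k)
  (cong (λ a → (oneP ⊕ ⊖ (X ^ suc a)) k) (ℕ.*-identityˡ n))

invqq-iqfac : ∀ n → invqq n ≐ iqfac n
invqq-iqfac zero    = λ _ → refl
invqq-iqfac (suc n) = ⊛-cong {g = geo n} (invqq-iqfac n) (λ _ → refl)

∑-coefficient : ∀ n F k → ∑ n F k ≡ sumTo n (λ i → F i k)
∑-coefficient zero    F k = refl
∑-coefficient (suc n) F k = cong (_+ F n k) (∑-coefficient n F k)

if-<ᵇ : ∀ m n {x y : ℤ} → (m < n → x ≡ y) → (n ≤ m → x ≡ 0ℤ) → x ≡ (if m <ᵇ n then y else 0ℤ)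
if-<ᵇ m n x≡y x≡0 with m <ᵇ n in m<ᵇn
... | true  = x≡y (ℕ.<ᵇ⇒< m n (≡.subst T (sym m<ᵇn) _))
... | false = x≡0 (ℕ.≮⇒≥ λ m<n → ≡.subst T m<ᵇn (ℕ.<⇒<ᵇ m<n))

multiTerm-summand : ∀ L n₁ n₂ n₃ → (n₁ ℕ.+ n₂ ℕ.+ n₃) ℕ.+ (n₂ ℕ.+ n₃) ℕ.+ n₃ < L →
                    multiTerm L n₁ n₂ n₃ ≐ summand L n₁ n₂ n₃
multiTerm-summand L n₁ n₂ n₃ N<L k = trans (multiTerm-< L n₁ n₂ n₃ N<L k) (sym (factors k))
  where
  N₁ = n₁ ℕ.+ n₂ ℕ.+ n₃
  N₂ = n₂ ℕ.+ n₃
  factors = *-cong₈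
    (mono-X^ (N₁ ℕ.* N₁ ℕ.+ N₂ ℕ.* N₂ ℕ.+ n₃ ℕ.* n₃ ℕ.+ N₁ ℕ.+ N₂ ℕ.+ n₃))
    (qq-qfac (L ∸ N₁ ∸ 1))
    (qq-qfac (2 ℕ.* L ∸ N₁ ∸ N₂ ∸ 1))
    (invqq-iqfac (2 ℕ.* L ∸ 2 ℕ.* N₁ ∸ 1))
    (invqq-iqfac (L ∸ N₁ ∸ N₂ ∸ n₃ ∸ 1))
    (invqq-iqfac n₁) (invqq-iqfac n₂) (invqq-iqfac n₃)

theorem9p17 : (L : ℕ) → (k : ℕ) → borweinC L k ≡ rhs L k
theorem9p17 L k = begin
  - borweinProd L (2 ℕ.+ 3 ℕ.* k)
    ≡⟨ cong -_ (⊛-cong (qpoch-pochhammer 1 L) (qpoch-pochhammer 2 L) (2 ℕ.+ 3 ℕ.* k)) ⟩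
  (⊖ section 2 (Cubed.pochhammer (X ^ 1) L ⊛ Cubed.pochhammer (X ^ 2) L)) k
    ≡⟨ section-pochhammer L k ⟩
  _
    ≡⟨ borwein-multisum L k ⟩
  (∑[ n₁ < L ] ∑[ n₂ < L ] ∑[ n₃ < L ] multiTerm L n₁ n₂ n₃) k
    -- Where the `if` of `rhs` yields 0, so does the delayed reciprocal inside `multiTerm`.
    ≡⟨ trans (∑-coefficient L _ k) (sumTo-cong L λ n₁ → trans (∑-coefficient L _ k) (sumTo-cong L λ n₂ →
         trans (∑-coefficient L _ k) (sumTo-cong L λ n₃ → 
           if-<ᵇ ((n₁ ℕ.+ n₂ ℕ.+ n₃) ℕ.+ (n₂ ℕ.+ n₃) ℕ.+ n₃) L
             (λ N<L → multiTerm-summand L n₁ n₂ n₃ N<L k) (λ L≤N → multiTerm-≥ L n₁ n₂ n₃ L≤N k)))) ⟩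
  rhs L k ∎
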